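{- The topological isomorphism relation between automorphism groups of countable $\omega$-categorical structures with weak elimination of imaginaries is smooth. That is, let $\mathcal{W}$ be the Borel set of all closed subgroups $G\leq \mathrm{Sym}(\omega)$ of the form $G=\mathrm{Aut}(M)$ with $M$ an $\omega$-categorical structure with domain $\omega$ having weak elimination of imaginaries. Then there are a standard Borel space $Y$ and a Borel map $f:\mathcal{W}\to Y$ such that for all $G,H\in\mathcal{W}$: $G$ and $H$ are topologically isomorphic if and only if $f(G)=f(H)$.
   Context: A countable structure is $\omega$-categorical if it is, up to isomorphism, the only countable model of its first-order theory. For a countable structure $M$, $\mathrm{Aut}(M)$ carries the topology whose basic open subgroups are the pointwise stabilizers of finite subsets of $M$. A topological isomorphism is a group isomorphism which is also a homeomorphism. The closed subgroups of $\mathrm{Sym}(\omega)$ form a standard Borel space with the usual (Effros) Borel structure. The automorphism groups of $\omega$-categorical structures with domain $\omega$ are exactly the oligomorphic groups, i.e. the closed subgroups of $\mathrm{Sym}(\omega)$ having only finitely many orbits on $\omega^n$ for every $n<\omega$; they form a Borel subset of this space. Let $M$ be a countable $\omega$-categorical structure and $G=\mathrm{Aut}(M)$. For $A\subseteq M$, $G_{(A)}$ and $G_{\{A\}}$ denote the pointwise and the setwise stabilizer of $A$ in $G$. An element $a\in M$ is algebraic over $A$ if its orbit under $G_{(A)}$ is finite ($A$ finite), and a finite set $A\subseteq M$ is algebraically closed if it contains all elements algebraic over it. $M$ has weak elimination of imaginaries if for every subgroup $H\leq G$ which contains the pointwise stabilizer of a finite set there is a unique smallest finite algebraically closed set $K\subseteq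 M$ such that $G_{(K)}\leq H\leq G_{\{K\}}$. An equivalence relation on a (standard) Borel space is smooth if it is Borel reducible to the equality relation on a Borel space. -}

module Defs where

open import Algebra.Bundles using (Group)
open import Algebra.Morphism.Structures using (IsGroupHomomorphism)
import Data.Empty as Empty
open import Data.Fin.Base using (Fin; zero; suc)
open import Data.List.Base using (List)
open import Data.List.Membership.Propositional using (_∈_)
open import Data.List.Relation.Binary.BagAndSetEquality using (_∼[_]_; set)
import Data.List.Relation.Binary.Subset.Propositional as List
open import Data.Maybe.Base using (Maybe; just)
open import Data.Nat.Base using (ℕ; suc; _≥_)
open import Data.Product using (∃!)
open import Data.Product.Base using (Σ; Σ-syntax; ∃; ∃-syntax; _×_; _,_; proj₁; proj₂)
open import Data.Rational.Base using (ℚ; 0ℚ; _+_; _<_)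
open import Data.Vec.Base using (Vec; []; _∷_; map)
open import Function.Base using (id; _∘_; _on_)
open import Function.Bundles using (Func; Inverse; _↔_; _↣_; _⇔_)
open import Function.Properties.Inverse using (↔-refl; ↔-sym; ↔-trans)
open import Level using (Level; _⊔_; 0ℓ) renaming (suc to lsuc)
open import Relation.Binary.Bundles using (Setoid)
import Relation.Binary.Construct.On as On
open import Relation.Binary.Core using (Rel)
open import Relation.Binary.Definitions using (_Respects_)
open import Relation.Binary.PropositionalEquality
  using (_≡_; _≗_; refl; sym; trans; cong)
open import Relation.Unary using (Pred; ∅; ∁; ⋃; _≐_; _⊆_; _≬_)
open import Relation.Unary.Properties using (≐-sym; ≐-trans; ≐-refl)

private
  variable
    a b c ℓ m : Level

------------------------------------------------------------------------
-- Measurable spaces and standard Borel spaces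

data Generated {X : Set a} (𝒢 : Pred (Pred X 0ℓ) b) :
               Pred (Pred X 0ℓ) (a ⊔ b ⊔ lsuc 0ℓ) where
  gen   : ∀ {S} → 𝒢 S → Generated 𝒢 S
  gen-≐ : ∀ {S T} → S ≐ T → Generated 𝒢 S → Generated 𝒢 T
  gen-∅ : Generated 𝒢 ∅
  gen-∁ : ∀ {S} → Generated 𝒢 S → Generated 𝒢 (∁ S)
  gen-⋃ : ∀ {S : ℕ → Pred X 0ℓ} →
          (∀ n → Generated 𝒢 (S n)) → Generated 𝒢 (⋃ ℕ S)

record MeasurableSpace c ℓ m : Set (lsuc (c ⊔ ℓ ⊔ m)) where
  field
    setoid : Setoid c ℓ
  open Setoid setoid public using (Carrier; _≈_)
  field
    Measurable  : Pred (Pred Carrier 0ℓ) m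
    respects    : ∀ {S} → Measurable S → S Respects _≈_
    extensional : ∀ {S T} → S ≐ T → Measurable S → Measurable T
    empty       : Measurable ∅
    complement  : ∀ {S} → Measurable S → Measurable (∁ S)
    union       : ∀ {S : ℕ → Pred Carrier 0ℓ} →
                  (∀ n → Measurable (S n)) → Measurable (⋃ ℕ S)

generatedSpace : (X : Setoid c ℓ) (𝒢 : Pred (Pred (Setoid.Carrier X) 0ℓ) m) →
                 (∀ {S} → 𝒢 S → S Respects (Setoid._≈_ X)) →
                 MeasurableSpace c ℓ (c ⊔ m ⊔ lsuc 0ℓ)
generatedSpace X 𝒢 𝒢-respects = record
  { setoid      = X
  ; Measurable  = Generated 𝒢
  ; respects    = respects
  ; extensional = gen-≐
  ; empty       = gen-∅
  ; complement  = gen-∁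
  ; union       = gen-⋃
  }
  where
  open Setoid X using (_≈_) renaming (sym to ≈-sym)

  respects : ∀ {S} → Generated 𝒢 S → S Respects _≈_
  respects (gen S∈𝒢)              = 𝒢-respects S∈𝒢
  respects (gen-≐ (p , q) s) e    = p ∘ respects s e ∘ q
  respects gen-∅ _ ()
  respects (gen-∁ s) e x∉S y∈S    = x∉S (respects s (≈-sym e) y∈S)
  respects (gen-⋃ s) e (n , x∈Sₙ) = n , respects (s n) e x∈Sₙ

-- W is allowed to live in a larger universe than the measurable sets, so
-- being Borel means having the same elements as a measurable set.
IsBorel : (X : MeasurableSpace c ℓ m) → Pred (MeasurableSpace.Carrier X) b →
          Set (c ⊔ m ⊔ b ⊔ lsuc 0ℓ)
IsBorel X W = ∃[ B ] Measurable B × B ≐ W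
  where open MeasurableSpace X

subspace : (X : MeasurableSpace c ℓ m) → Pred (MeasurableSpace.Carrier X) b →
           MeasurableSpace (c ⊔ b) ℓ (c ⊔ m ⊔ b ⊔ lsuc 0ℓ)
subspace X W = record
  { setoid      = On.setoid X.setoid (proj₁ {B = W})
  ; Measurable  = λ S → ∃[ B ] X.Measurable B × S ≐ (B ∘ proj₁)
  ; respects    = λ { (B , mB , p , q) e → q ∘ X.respects mB e ∘ p }
  ; extensional = λ { S≐T (B , mB , S≐B) → B , mB , ≐-trans (≐-sym S≐T) S≐B }
  ; empty       = ∅ , X.empty , ≐-refl
  ; complement  = λ { (B , mB , p , q) →
                    ∁ B , X.complement mB , (λ x∉S → x∉S ∘ q) , (λ x∉B → x∉B ∘ p) }
  ; union       = λ s → ⋃ ℕ (proj₁ ∘ s)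
                      , X.union (proj₁ ∘ proj₂ ∘ s)
                      , (λ { (n , x) → n , proj₁ (proj₂ (proj₂ (s n))) x })
                      , (λ { (n , x) → n , proj₂ (proj₂ (proj₂ (s n))) x })
  }
  where module X = MeasurableSpace X

record BorelMap {c₁ ℓ₁ m₁ c₂ ℓ₂ m₂}
                (X : MeasurableSpace c₁ ℓ₁ m₁) (Y : MeasurableSpace c₂ ℓ₂ m₂) :
                Set (c₁ ⊔ ℓ₁ ⊔ m₁ ⊔ c₂ ⊔ ℓ₂ ⊔ m₂ ⊔ lsuc 0ℓ) where
  private
    module X = MeasurableSpace X
    module Y = MeasurableSpace Y
  field
    func  : Func X.setoid Y.setoid
    borel : ∀ {S} → Y.Measurable S → X.Measurable (S ∘ Func.to func)
  open Func func public

-- A real-valued metric d, given by its strict rational upper bounds: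
-- Near ε x y stands for d(x,y) < ε, and d(x,y) = inf {ε | Near ε x y}.
record Metric (X : Setoid c ℓ) : Set (c ⊔ ℓ ⊔ lsuc 0ℓ) where
  open Setoid X using (Carrier; _≈_)
  field
    Near      : ℚ → Rel Carrier 0ℓ
    monotone  : ∀ {δ ε x y} → δ < ε → Near δ x y → Near ε x y
    rounded   : ∀ {ε x y} → Near ε x y → ∃[ δ ] δ < ε × Near δ x y
    finite    : ∀ x y → ∃[ ε ] Near ε x y
    positive  : ∀ {ε x y} → Near ε x y → 0ℚ < ε
    zero-≈    : ∀ {x y} → x ≈ y → ∀ {ε} → 0ℚ < ε → Near ε x y
    separated : ∀ {x y} → (∀ {ε} → 0ℚ < ε → Near ε x y) → x ≈ y
    symmetric : ∀ {ε x y} → Near ε x y → Near ε y x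
    triangle  : ∀ {δ ε x y z} → Near δ x y → Near ε y z → Near (δ + ε) x z

  Open : Pred (Pred Carrier 0ℓ) c
  Open U = ∀ {x} → U x → ∃[ ε ] 0ℚ < ε × (∀ {y} → Near ε x y → U y)

  Cauchy : (ℕ → Carrier) → Set
  Cauchy s = ∀ {ε} → 0ℚ < ε → ∃[ N ] (∀ {i j} → i ≥ N → j ≥ N → Near ε (s i) (s j))

  _ConvergesTo_ : (ℕ → Carrier) → Carrier → Set
  s ConvergesTo x = ∀ {ε} → 0ℚ < ε → ∃[ N ] (∀ {i} → i ≥ N → Near ε (s i) x)

  Complete : Set c
  Complete = ∀ s → Cauchy s → ∃[ x ] s ConvergesTo x

  -- Maybe accounts for the empty space.
  Separable : Set c
  Separable = Σ[ d ∈ (ℕ → Maybe Carrier) ]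
    (∀ x {ε} → 0ℚ < ε → ∃[ n ] ∃[ y ] d n ≡ just y × Near ε x y)

IsStandardBorel : MeasurableSpace c ℓ m → Set (c ⊔ ℓ ⊔ m ⊔ lsuc 0ℓ)
IsStandardBorel X = Σ[ d ∈ Metric setoid ]
  Metric.Complete d × Metric.Separable d ×
  (∀ S → Measurable S ⇔ Generated (Metric.Open d) S)
  where open MeasurableSpace X

------------------------------------------------------------------------
-- Permutation groups on ℕ

Perm : Set
Perm = ℕ ↔ ℕ

open Inverse using (to; from)

infix 4 _≈ₚ_ _≈[_]_

_≈ₚ_ : Rel Perm 0ℓ
g ≈ₚ h = to g ≗ to h

_≈[_]_ : Perm → List ℕ → Perm → Set
g ≈[ A ] h = ∀ {x} → x ∈ A → to g x ≡ to h x

Sym : Group 0ℓ 0ℓ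
Sym = record
  { Carrier = Perm
  ; _≈_     = _≈ₚ_
  ; _∙_     = λ g h → ↔-trans h g
  ; ε       = ↔-refl
  ; _⁻¹     = ↔-sym
  ; isGroup = record
    { isMonoid = record
      { isSemigroup = record
        { isMagma = record
          { isEquivalence = record
            { refl  = λ _ → refl
            ; sym   = λ p x → sym (p x)
            ; trans = λ p q x → trans (p x) (q x)
            }
          ; ∙-cong = λ {_} {g} p q x → trans (p _) (cong (to g) (q x))
          }
        ; assoc = λ _ _ _ _ → refl
        }
      ; identity = (λ _ _ → refl) , (λ _ _ → refl)
      }
    ; inverse = (λ g → Inverse.strictlyInverseʳ g) , (λ g → Inverse.strictlyInverseˡ g)
    ; ⁻¹-cong = λ {g} {h} p x → trans
        (cong (from g) (trans (sym (Inverse.strictlyInverseˡ h x)) (sym (p (from h x)))))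
        (Inverse.strictlyInverseʳ g (from h x))
    }
  }

record IsSubgroup (H : Pred Perm 0ℓ) : Set where
  open Group Sym using (_∙_; ε; _⁻¹)
  field
    respects  : H Respects _≈ₚ_
    ε-closed  : H ε
    ∙-closed  : ∀ {g h} → H g → H h → H (g ∙ h)
    ⁻¹-closed : ∀ {g} → H g → H (g ⁻¹)

-- The topology on a family of permutations: the coset of g modulo the
-- pointwise stabilizer of A consists of the h with h ≈[ A ] g.
Open : {I : Set} → (I → Perm) → Pred (Pred I 0ℓ) 0ℓ
Open perm U = ∀ {i} → U i → ∃[ A ] (∀ {j} → perm j ≈[ A ] perm i → U j)

Continuous : {I J : Set} → (I → Perm) → (J → Perm) → (I → J) → Set₁
Continuous perm₁ perm₂ φ = ∀ {U} → Open perm₂ U → Open perm₁ (U ∘ φ)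

record ClosedSubgroup : Set₁ where
  field
    member     : Pred Perm 0ℓ
    isSubgroup : IsSubgroup member
    closed     : Open id (∁ member)

  Element : Set
  Element = Σ Perm member

  perm : Element → Perm
  perm = proj₁

  group : Group 0ℓ 0ℓ
  group = record
    { Carrier = Element
    ; _≈_     = _≈ₚ_ on perm
    ; _∙_     = λ { (g , p) (h , q) → g S.∙ h , ∙-closed p q }
    ; ε       = S.ε , ε-closed
    ; _⁻¹     = λ { (g , p) → g S.⁻¹ , ⁻¹-closed p }
    ; isGroup = record
      { isMonoid = record
        { isSemigroup = record
          { isMagma = record
            { isEquivalence = On.isEquivalence perm S.isEquivalence
            ; ∙-cong = λ {x} {y} {u} {v} →
                S.∙-cong {perm x} {perm y} {perm u} {perm v}
            }
          ; assoc = λ _ _ _ _ → refl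
          }
        ; identity = (λ _ _ → refl) , (λ _ _ → refl)
        }
      ; inverse = (λ x → S.inverseˡ (perm x)) , (λ x → S.inverseʳ (perm x))
      ; ⁻¹-cong = λ {x} {y} → S.⁻¹-cong {perm x} {perm y}
      }
    }
    where
    module S = Group Sym
    open IsSubgroup isSubgroup

open ClosedSubgroup using (member; perm; group)

record TopologicalIsomorphism (G H : ClosedSubgroup) : Set₁ where
  private
    module G = Group (group G)
    module H = Group (group H)
  field
    bijection           : Inverse G.setoid H.setoid
    isGroupHomomorphism : IsGroupHomomorphism G.rawGroup H.rawGroup (to bijection)
    to-continuous       : Continuous (perm G) (perm H) (to bijection)
    from-continuous     : Continuous (perm H) (perm G) (from bijection)

closedSubgroups : Setoid (lsuc 0ℓ) 0ℓ
closedSubgroups = record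
  { Carrier       = ClosedSubgroup
  ; _≈_           = λ G H → member G ≐ member H
  ; isEquivalence = record { refl = ≐-refl ; sym = ≐-sym ; trans = ≐-trans }
  }

data EffrosGenerator : Pred (Pred ClosedSubgroup 0ℓ) (lsuc 0ℓ) where
  hits : ∀ {U} → Open id U → EffrosGenerator (λ G → member G ≬ U)

effros : MeasurableSpace (lsuc 0ℓ) 0ℓ (lsuc 0ℓ)
effros = generatedSpace closedSubgroups EffrosGenerator
  λ { (hits _) (G⊆H , _) (g , g∈G , g∈U) → g , G⊆H g∈G , g∈U }

pointwise setwise : Pred Perm 0ℓ → List ℕ → Pred Perm 0ℓ
pointwise G A g = G g × (∀ {x} → x ∈ A → to g x ≡ x)
setwise   G A g = G g × (∀ {x} → x ∈ A ⇔ to g x ∈ A)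

------------------------------------------------------------------------
-- First-order logic

record Language : Set₁ where
  field
    Function Relation : ℕ → Set

Countable : Language → Set
Countable L = (∃ Function ↣ ℕ) × (∃ Relation ↣ ℕ)
  where open Language L

module _ (L : Language) where
  open Language L

  data Term (n : ℕ) : Set where
    var : Fin n → Term n
    app : ∀ {k} → Function k → Vec (Term n) k → Term n

  infixr 5 _⇒_

  -- The connectives are a complete set for classical logic.
  data Formula (n : ℕ) : Set where
    _≈ₜ_ : Term n → Term n → Formula n
    atom : ∀ {k} → Relation k → Vec (Term n) k → Formula n
    ⊥    : Formula n
    _⇒_  : Formula n → Formula n → Formula n
    all  : Formula (suc n) → Formula n

  Sentence : Set
  Sentence = Formula 0

  record Structure (A : Set) : Set₁ where
    field
      fun : ∀ {k} → Function k → Vec A k → A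
      rel : ∀ {k} → Relation k → Pred (Vec A k) 0ℓ

module _ {L : Language} where
  open Language L

  module _ {A : Set} (M : Structure L A) where
    private module M = Structure M

    mutual
      ⟦_⟧ : ∀ {n} → Term L n → (Fin n → A) → A
      ⟦ var i ⟧    v = v i
      ⟦ app f ts ⟧ v = M.fun f (⟦ ts ⟧* v)

      ⟦_⟧* : ∀ {n k} → Vec (Term L n) k → (Fin n → A) → Vec A k
      ⟦ [] ⟧*     v = []
      ⟦ t ∷ ts ⟧* v = ⟦ t ⟧ v ∷ ⟦ ts ⟧* v

    extend : ∀ {n} → A → (Fin n → A) → Fin (suc n) → A
    extend x v zero    = x
    extend x v (suc i) = v i

    Satisfies : ∀ {n} → Formula L n → (Fin n → A) → Set
    Satisfies (s ≈ₜ t)   v = ⟦ s ⟧ v ≡ ⟦ t ⟧ v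
    Satisfies (atom R ts) v = M.rel R (⟦ ts ⟧* v)
    Satisfies ⊥          v = Empty.⊥
    Satisfies (φ ⇒ ψ)    v = Satisfies φ v → Satisfies ψ v
    Satisfies (all φ)    v = ∀ x → Satisfies φ (extend x v)

    infix 4 _⊨_

    _⊨_ : Sentence L → Set
    _⊨_ φ = Satisfies φ (λ ())

  record IsIsomorphism {A B : Set} (M : Structure L A) (N : Structure L B)
                       (h : A ↔ B) : Set where
    private
      module M = Structure M
      module N = Structure N
    field
      fun : ∀ {k} (f : Function k) xs → to h (M.fun f xs) ≡ N.fun f (map (to h) xs)
      rel : ∀ {k} (R : Relation k) xs → M.rel R xs ⇔ N.rel R (map (to h) xs)

  IsωCategorical : Structure L ℕ → Set₁
  IsωCategorical M = ∀ {B : Set} → B ↣ ℕ → (N : Structure L B) →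
    (∀ φ → M ⊨ φ → N ⊨ φ) → ∃ (IsIsomorphism M N)

  Aut : Structure L ℕ → Pred Perm 0ℓ
  Aut M = IsIsomorphism M M

------------------------------------------------------------------------
-- Weak elimination of imaginaries

module _ (G : Pred Perm 0ℓ) where

  Algebraic : List ℕ → Pred ℕ 0ℓ
  Algebraic A x = Σ[ orbit ∈ List ℕ ] (∀ {g} → pointwise G A g → to g x ∈ orbit)

  AlgebraicallyClosed : Pred (List ℕ) 0ℓ
  AlgebraicallyClosed K = ∀ {x} → Algebraic K x → x ∈ K

  Supports : Pred Perm 0ℓ → Pred (List ℕ) 0ℓ
  Supports H K = AlgebraicallyClosed K × pointwise G K ⊆ H × H ⊆ setwise G K

  -- Lists stand for finite sets, hence are compared up to set equality.
  WeakElimination : Set₁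
  WeakElimination = ∀ (H : Pred Perm 0ℓ) → IsSubgroup H → H ⊆ G →
    (∃[ A ] pointwise G A ⊆ H) →
    ∃! _∼[ set ]_ λ K → Supports H K × (∀ {K′} → Supports H K′ → K List.⊆ K′)

WeakEliminationOfImaginaries : {L : Language} → Structure L ℕ → Set₁
WeakEliminationOfImaginaries M = WeakElimination (Aut M)

𝒲 : Pred ClosedSubgroup (lsuc 0ℓ)
𝒲 G = Σ[ L ∈ Language ] Countable L × (Σ[ M ∈ Structure L ℕ ]
  IsωCategorical M × WeakEliminationOfImaginaries M × member G ≐ Aut M)

-- Let G be a closed oligomorphic group with weak elimination of imaginaries.
-- The pointwise stabilizers G_(K) of finite algebraically closed sets K are
-- the open subgroups of G without proper open subgroups of finite index, so a
-- topological isomorphism matches them with those of the other group.  If a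
-- tuple t enumerates such a K whose translates determine all points (a base),
-- then G acts faithfully on its orbit of t as a closed oligomorphic group, and
-- G, H are topologically isomorphic iff suitable bases give isomorphic
-- permutation groups.  The invariant of G is the set of patterns (n, k, E)
-- that occur: E is the orbit equivalence on the words of length at most n over
-- k translates of a base, where these words represent all orbits.
--
-- Suppose the patterns of G occur in H, and fix a base t of G.  For each n
-- some base t′ of H matches t up to words of length n.  The length of t′ is
-- bounded by the number of orbits on pairs of translates, as independent
-- entries of t′ give inequivalent pairs; so one t′ serves all n, and since
-- finite tuples have finitely many orbits the matchings can be chosen
-- coherently in a back-and-forth construction.
--
-- The class 𝒲 is Borel because, by the theorem of Ryll-Nardzewski, it consists
-- of the oligomorphic groups with weak elimination of imaginaries, and in such
-- a group an open subgroup containing G_(A) is a finite union of double cosets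
-- of G_(A), so that only countably many codes of subgroups matter.
module Submission where

open import Defs
open import Axiom.ExcludedMiddle using (ExcludedMiddle)
open import Data.Product.Base using (Σ-syntax; _×_; _,_)
open import Function.Bundles using (_⇔_)

-- Measurable sets are predicates in `Set` built by countable operations, whereas `𝒲` quantifies
-- over languages, structures and arbitrary subgroups. Properties of a group are therefore phrased
-- through `Orbit`: for fixed tuples it says that the group meets a certain open set, and
-- quantifiers over tuples are countable.
--
-- The full orbit equivalence on words over the translates of one base would determine the group,
-- but it depends on the base and on an enumeration of its translates. Binding both existentially
-- removes the choice at the price of cutting the information into finite pieces, whose witnesses
-- for different n have a priori nothing in common. Hence the length of a base must be bounded from
-- inside a pattern; repeated entries would defeat any such bound, so the bases in a pattern have
-- none.
--
-- Categoricity compares countable models, so to exclude infinitely many types a nonisolated type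
-- has to be realised in one countable model and omitted in another. One Henkin construction yields
-- both.

module Classical (em : ∀ ℓ → ExcludedMiddle ℓ) where

  open import Algebra.Bundles using (Group)
  open import Algebra.Morphism.Structures using (IsGroupHomomorphism)
  open import Data.Bool.Base using (Bool; false; true)
  import Data.Bool.Properties as Bool
  import Data.Empty as Empty
  open import Data.Empty using (⊥-elim)
  open import Data.Fin.Base as Fin using (Fin; _↑ʳ_; _↑ˡ_; fromℕ<; inject≤; splitAt; suc; toℕ; zero)
  open import Data.Fin.Properties
    using (fromℕ<-toℕ; injective⇒≤; pigeonhole; splitAt-↑ʳ; splitAt-↑ˡ; toℕ-fromℕ<; toℕ-injective;
      toℕ-inject≤; toℕ<n)
  open import Data.Integer.Base as ℤ using (+<+; +≤+)
  import Data.Integer.Properties as ℤ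
  open import Data.List.Base as List
    using (List; []; _++_; _∷_; applyUpTo; cartesianProduct; cartesianProductWith; concat; concatMap;
      deduplicate; filter; foldr; length; lookup; map; upTo)
  open import Data.List.Membership.Propositional using (_∈_)
  open import Data.List.Membership.Propositional.Properties
    using (∈-++⁺ʳ; ∈-++⁺ˡ; ∈-cartesianProductWith⁺; ∈-cartesianProduct⁺; ∈-concat⁺′; ∈-concat⁻′;
      ∈-deduplicate⁺; ∈-deduplicate⁻; ∈-filter⁺; ∈-filter⁻; ∈-lookup; ∈-map⁺; ∈-map⁻; ∈-tabulate⁺;
      ∈-tabulate⁻; ∈-upTo⁺)
  open import Data.List.Properties
    using (++-identityʳ; length-++; length-map; length-tabulate; map-++; map-cong; map-id; map-tabulate;
      map-∘; tabulate-cong; tabulate-lookup; ∷-injective; ∷-injectiveʳ; ∷-injectiveˡ)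
  open import Data.List.Relation.Binary.Pointwise as Pointwise
    using (Pointwise; Pointwise-length; []; _∷_)
  import Data.List.Relation.Binary.Subset.Propositional as List
  open import Data.List.Relation.Unary.All as All using (All; []; _∷_)
  import Data.List.Relation.Unary.All.Properties as All
  open import Data.List.Relation.Unary.AllPairs.Core using ([]; _∷_)
  open import Data.List.Relation.Unary.Any as Any using (Any; here; there)
  open import Data.List.Relation.Unary.Any.Properties using (lookup-index)
  open import Data.List.Relation.Unary.Unique.Propositional using (Unique)
  import Data.List.Relation.Unary.Unique.Propositional.Properties as Unique
  open import Data.Maybe.Base using (just)
  open import Data.Nat.Base
  open import Data.Nat.Coprimality using (1-coprimeTo)
  open import Data.Nat.Divisibility using (∣1⇒≡1)
  open import Data.Nat.Properties
  open import Data.Product.Base using (proj₁; proj₂; swap; uncurry; Σ; ∃; ∃-syntax)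
  open import Data.Rational.Base as ℚ using (*<*; *≤*; 0ℚ; mkℚ; ℚ)
  import Data.Rational.Properties as ℚ
  open import Data.Sum.Base using ([_,_]′; _⊎_; inj₁; inj₂)
  open import Data.Unit.Base using (tt; ⊤)
  open import Data.Vec.Base as Vec using (Vec; []; _∷_; tabulate)
  import Data.Vec.Properties as Vec
  open import Function.Base using (_∘_; flip; id)
  open import Function.Bundles using (Equivalence; Injection; Inverse; _↔_; _↣_; mk↔ₛ′; mk↣; mk⇔)
  open import Function.Definitions using (Injective)
  open import Level using (Level; 0ℓ) renaming (suc to lsuc)
  open import Relation.Binary.Bundles using (Setoid)
  open import Relation.Binary.PropositionalEquality
  open import Relation.Nullary using (Dec; does; no; yes; ¬_)
  open import Relation.Unary using (Pred; _≐_; _⊆_)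
  open import Relation.Unary.Properties using (≐-sym)
  open import Data.List.Relation.Unary.Unique.DecPropositional.Properties _≟_ using (deduplicate-!)

  -- Finite choice, codes and the back-and-forth construction

  private variable
    ℓ ℓ₁ ℓ₂ : Level
    A : Set ℓ₁
    B : Set ℓ₂

  dec : (P : Set ℓ) → Dec P
  dec P = em _

  byContradiction : {P : Set ℓ} → ¬ ¬ P → P
  byContradiction {P = P} ¬¬p with dec P
  ... | yes p = p
  ... | no ¬p = ⊥-elim (¬¬p ¬p)

  ¬∀⇒∃¬ : {P : A → Set ℓ} → ¬ (∀ x → P x) → ∃ λ x → ¬ P x
  ¬∀⇒∃¬ ¬∀ = byContradiction λ ¬∃ → ¬∀ λ x → byContradiction λ ¬p → ¬∃ (x , ¬p)

  ¬→⇒× : {P : Set ℓ₁} {Q : Set ℓ₂} → ¬ (P → Q) → P × ¬ Q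
  ¬→⇒× ¬f = byContradiction (λ ¬p → ¬f (λ p → ⊥-elim (¬p p))) , λ q → ¬f (λ _ → q)

  -- Finite choice: at most one witness is taken per element of `as`. The resulting bound on
  -- `length bs` later carries a bound on orbits of pairs from one group to the other.
  representatives : (R : A → B → Set ℓ) (as : List A) → Σ[ bs ∈ List B ] length bs ≤ length as ×
    (∀ {y} → y ∈ bs → ∃[ x ] x ∈ as × R x y) ×
    (∀ {x y} → x ∈ as → R x y → ∃[ y₀ ] y₀ ∈ bs × R x y₀)
  representatives R [] = [] , z≤n , (λ ()) , λ ()
  representatives R (x ∷ as) with dec (∃ (R x)) | representatives R as
  ... | yes (y , r) | bs , short , sound , complete = y ∷ bs , s≤s short
    , (λ { (here refl) → x , here refl , r
         ; (there y∈) → let x′ , x′∈ , r′ = sound y∈ in x′ , there x′∈ , r′ })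
    , λ { (here refl) _ → y , here refl , r
        ; (there x∈) r′ → let y₀ , y₀∈ , r₀ = complete x∈ r′ in y₀ , there y₀∈ , r₀ }
  ... | no ¬r | bs , short , sound , complete = bs , m≤n⇒m≤1+n short
    , (λ y∈ → let x′ , x′∈ , r′ = sound y∈ in x′ , there x′∈ , r′)
    , λ { (here refl) r′ → ⊥-elim (¬r (_ , r′))
        ; (there x∈) r′ → complete x∈ r′ }

  -- If each candidate failed at some level, antitonicity would make all of them fail at the maximum
  -- of these levels. In this way one base, and one image in a back-and-forth step, is chosen for
  -- all word lengths at once.
  uniformWitness : (P : ℕ → A → Set ℓ) → (∀ {m n x} → m ≤ n → P n x → P m x) →
    ∀ as → (∀ n → ∃[ x ] x ∈ as × P n x) → ∃[ x ] x ∈ as × (∀ n → P n x)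
  uniformWitness P antitone as some = byContradiction λ none →
    let N , refute = bound as (λ x∈ p → none (_ , x∈ , p))
        x , x∈ , p = some N
    in refute x∈ p
    where
    bound : ∀ as → (∀ {x} → x ∈ as → ¬ (∀ n → P n x)) →
            ∃[ N ] (∀ {x} → x ∈ as → ¬ P N x)
    bound [] _ = 0 , λ ()
    bound (x ∷ as) none with ¬∀⇒∃¬ (none (here refl)) | bound as (none ∘ there)
    ... | m , ¬p | n , refute = m ⊔ n
      , λ { (here refl) p → ¬p (antitone (m≤m⊔n m n) p)
          ; (there x∈) p → refute x∈ (antitone (m≤n⊔m m n) p) }

  least : (P : ℕ → Set) → ∃ P → ∃[ m ] P m × (∀ {k} → P k → m ≤ k)
  least P (n , p) = search n 0 (λ _ → z≤n) (n , ≤-reflexive (sym (+-identityʳ n)) , p)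
    where
    search : ∀ fuel i → (∀ {k} → P k → i ≤ k) → ∃[ j ] j ≤ fuel + i × P j →
             ∃[ m ] P m × (∀ {k} → P k → m ≤ k)
    search zero i low (j , j≤i , q) = i , subst P (≤-antisym j≤i (low q)) q , low
    search (suc fuel) i low (j , j≤ , q) with dec (P i)
    ... | yes pᵢ = i , pᵢ , low
    ... | no ¬pᵢ = search fuel (suc i)
      (λ {k} r → ≤∧≢⇒< (low r) (λ { refl → ¬pᵢ r }))
      (j , ≤-trans j≤ (≤-reflexive (sym (+-suc fuel i))) , q)

  ++-split : (us vs : List A) {us′ vs′ : List A} → length us ≡ length vs →
    us ++ us′ ≡ vs ++ vs′ → us ≡ vs × us′ ≡ vs′
  ++-split []       []       _ e = refl , e
  ++-split (u ∷ us) (v ∷ vs) l e with refl , e′ ← ∷-injective e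
    with refl , e″ ← ++-split us vs (suc-injective l) e′ = refl , e″

  to-injective : (h : A ↔ B) → Injective _≡_ _≡_ (Inverse.to h)
  to-injective h e = trans (sym (Inverse.strictlyInverseʳ h _))
    (trans (cong (Inverse.from h) e) (Inverse.strictlyInverseʳ h _))

  -- Injective codes into the natural numbers

  private
    double-injective : ∀ m n → m + m ≡ n + n → m ≡ n
    double-injective zero    zero    _ = refl
    double-injective (suc m) (suc n) e = cong suc (double-injective m n
      (suc-injective (trans (sym (+-suc m m)) (trans (suc-injective e) (+-suc n n)))))

    odd≢even : ∀ m n → suc (m + m) ≢ n + n
    odd≢even zero    (suc zero)    ()
    odd≢even zero    (suc (suc n)) ()
    odd≢even (suc m) (suc n) e = odd≢even m n
      (suc-injective (trans (cong suc (sym (+-suc m m))) (trans (suc-injective e) (+-suc n n))))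

  abstract
    -- This is 2^m (2n + 1). It is never 0, which leaves 0 free to code the empty list.
    pair : ℕ → ℕ → ℕ
    pair zero    n = suc (n + n)
    pair (suc m) n = pair m n + pair m n

    pair-injective : ∀ {m n m′ n′} → pair m n ≡ pair m′ n′ → m ≡ m′ × n ≡ n′
    pair-injective {zero}  {n} {zero}   {n′} e = refl , double-injective n n′ (suc-injective e)
    pair-injective {zero}  {n} {suc m′} {n′} e = ⊥-elim (odd≢even n (pair m′ n′) e)
    pair-injective {suc m} {n} {zero}   {n′} e = ⊥-elim (odd≢even n′ (pair m n) (sym e))
    pair-injective {suc m} {n} {suc m′} {n′} e
      with refl , refl ← pair-injective {m} {n} {m′} {n′} (double-injective (pair m n) (pair m′ n′) e) = refl , refl

    0≢pair : ∀ m n → 0 ≢ pair m n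
    0≢pair zero n ()
    0≢pair (suc m) n e = 0≢pair m n (sym (m+n≡0⇒m≡0 (pair m n) (sym e)))

  code : A ↣ ℕ → A → ℕ
  code = Injection.to

  code-injective : (i : A ↣ ℕ) → Injective _≡_ _≡_ (code i)
  code-injective = Injection.injective

  ℕ-code : ℕ ↣ ℕ
  ℕ-code = mk↣ id

  ×-code : A ↣ ℕ → B ↣ ℕ → (A × B) ↣ ℕ
  ×-code i j = mk↣ {to = λ (x , y) → pair (code i x) (code j y)} λ e →
    let p , q = pair-injective e in cong₂ _,_ (code-injective i p) (code-injective j q)

  List-code : A ↣ ℕ → List A ↣ ℕ
  List-code {A = A} i = mk↣ {to = f} inj
    where
    f : List A → ℕ
    f []       = 0
    f (x ∷ xs) = pair (code i x) (f xs)

    inj : ∀ {xs ys} → f xs ≡ f ys → xs ≡ ys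
    inj {[]}     {[]}     e = refl
    inj {[]}     {y ∷ ys} e = ⊥-elim (0≢pair (code i y) (f ys) e)
    inj {x ∷ xs} {[]}     e = ⊥-elim (0≢pair (code i x) (f xs) (sym e))
    inj {x ∷ xs} {y ∷ ys} e =
      let p , q = pair-injective e in cong₂ _∷_ (code-injective i p) (inj q)

  Vec-code : A ↣ ℕ → ∀ {n} → Vec A n ↣ ℕ
  Vec-code {A = A} i = mk↣ inj
    where
    f : ∀ {n} → Vec A n → ℕ
    f Vec.[]       = 0
    f (x Vec.∷ xs) = pair (code i x) (f xs)

    inj : ∀ {n} {xs ys : Vec A n} → f xs ≡ f ys → xs ≡ ys
    inj {xs = Vec.[]}     {Vec.[]}     e = refl
    inj {xs = x Vec.∷ xs} {y Vec.∷ ys} e =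
      let p , q = pair-injective e in cong₂ Vec._∷_ (code-injective i p) (inj q)

  Σ-code : {B : ℕ → Set ℓ₂} → (∀ n → B n ↣ ℕ) → Σ ℕ B ↣ ℕ
  Σ-code {B = B} i = mk↣ {to = λ (n , y) → pair n (code (i n) y)} inj
    where
    inj : ∀ {x y : Σ ℕ B} → pair (proj₁ x) (code (i (proj₁ x)) (proj₂ x)) ≡
                            pair (proj₁ y) (code (i (proj₁ y)) (proj₂ y)) → x ≡ y
    inj {m , x} {n , y} e with refl , q ← pair-injective e = cong (m ,_) (code-injective (i m) q)

  module _ (i : A ↣ ℕ) (default : A) where

    abstract
      -- A left inverse of the code turns the injection into a surjective enumeration, the form
      -- required by countable unions and by the scheduling of tasks. Numbers that code nothing go
      -- to the default.
      decode : ℕ → A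
      decode n with dec (∃ λ x → code i x ≡ n)
      ... | yes (x , _) = x
      ... | no _        = default

      decode-code : ∀ x → decode (code i x) ≡ x
      decode-code x with dec (∃ λ y → code i y ≡ code i x)
      ... | yes (y , e) = code-injective i e
      ... | no ¬e       = ⊥-elim (¬e (x , refl))

  -- The back-and-forth construction

  module BackAndForth
    {A B : Set} (A-code : A ↣ ℕ) (B-code : B ↣ ℕ) (P : Pred A 0ℓ) (Q : Pred B 0ℓ)
    (R : Pred (List (A × B)) ℓ)
    (forth : ∀ {l x} → R l → P x → ∃[ y ] R ((x , y) ∷ l))
    (back  : ∀ {l y} → R l → Q y → ∃[ x ] R ((x , y) ∷ l))
    where

    Stage : Set _
    Stage = Σ (List (A × B)) R

    private
      tryForth tryBack step : ℕ → Stage → Stage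
      tryForth n (l , r) with dec (∃ λ x → code A-code x ≡ n × P x)
      ... | yes (x , _ , p) = _ , proj₂ (forth r p)
      ... | no _            = l , r
      tryBack n (l , r) with dec (∃ λ y → code B-code y ≡ n × Q y)
      ... | yes (y , _ , q) = _ , proj₂ (back r q)
      ... | no _            = l , r
      step n = tryBack n ∘ tryForth n

      tryForth-grows : ∀ n s → proj₁ s List.⊆ proj₁ (tryForth n s)
      tryForth-grows n (l , r) with dec (∃ λ x → code A-code x ≡ n × P x)
      ... | yes _ = there
      ... | no _  = id

      tryBack-grows : ∀ n s → proj₁ s List.⊆ proj₁ (tryBack n s)
      tryBack-grows n (l , r) with dec (∃ λ y → code B-code y ≡ n × Q y)
      ... | yes _ = there
      ... | no _  = id

      forth-meets : ∀ s {x} → P x → ∃[ y ] (x , y) ∈ proj₁ (tryForth (code A-code x) s)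
      forth-meets (l , r) {x} p with dec (∃ λ x′ → code A-code x′ ≡ code A-code x × P x′)
      ... | yes (x′ , e , p′) with refl ← code-injective A-code e = _ , here refl
      ... | no none = ⊥-elim (none (x , refl , p))

      back-meets : ∀ s {y} → Q y → ∃[ x ] (x , y) ∈ proj₁ (tryBack (code B-code y) s)
      back-meets (l , r) {y} q with dec (∃ λ y′ → code B-code y′ ≡ code B-code y × Q y′)
      ... | yes (y′ , e , q′) with refl ← code-injective B-code e = _ , here refl
      ... | no none = ⊥-elim (none (y , refl , q))

    module Limit (start : Stage) where

      stage : ℕ → Stage
      stage zero    = start
      stage (suc n) = step n (stage n)

      -- Recording only membership in a finite stage keeps the limit in `Set` even where `R` lives
      -- in a larger universe, as it does for partial matchings.
      Graph : Pred (A × B) 0ℓ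
      Graph z = ∃[ n ] z ∈ proj₁ (stage n)

      private
        stage-suc : ∀ n → proj₁ (stage n) List.⊆ proj₁ (stage (suc n))
        stage-suc n = tryBack-grows n (tryForth n (stage n)) ∘ tryForth-grows n (stage n)

        stage-+ : ∀ m n → proj₁ (stage n) List.⊆ proj₁ (stage (m + n))
        stage-+ zero    n = id
        stage-+ (suc m) n = stage-suc (m + n) ∘ stage-+ m n

        stage-mono : ∀ {m n} → m ≤ n → proj₁ (stage m) List.⊆ proj₁ (stage n)
        stage-mono {m} {n} m≤n =
          subst (λ k → proj₁ (stage m) List.⊆ proj₁ (stage k)) (m∸n+n≡m m≤n) (stage-+ (n ∸ m) m)

      start⊆Graph : ∀ {z} → z ∈ proj₁ start → Graph z
      start⊆Graph z∈ = 0 , z∈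

      finite-part : ∀ {w} → All Graph w → ∃[ l ] R l × w List.⊆ l
      finite-part alls = let n , w⊆ = go alls in _ , proj₂ (stage n) , w⊆
        where
        go : ∀ {w} → All Graph w → ∃[ n ] w List.⊆ proj₁ (stage n)
        go [] = 0 , λ ()
        go ((m , z∈) ∷ alls) with go alls
        ... | n , w⊆ = m ⊔ n , λ { (here refl) → stage-mono (m≤m⊔n m n) z∈
                                 ; (there z′∈) → stage-mono (m≤n⊔m m n) (w⊆ z′∈) }

      total : ∀ {x} → P x → ∃[ y ] Graph (x , y)
      total {x} p = let y , m = forth-meets (stage (code A-code x)) p in
        y , suc (code A-code x) , tryBack-grows (code A-code x) (tryForth (code A-code x) (stage (code A-code x))) m

      surjective : ∀ {y} → Q y → ∃[ x ] Graph (x , y)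
      surjective {y} q = let x , m = back-meets (tryForth (code B-code y) (stage (code B-code y))) q in
        x , suc (code B-code y) , m

  -- First-order logic

  open Equivalence using () renaming (to to fwd; from to bwd)

  module Syntax {L : Language} where
    open Language L

    Term-code : ∃ Function ↣ ℕ → ∀ {n} → Term L n ↣ ℕ
    Term-code F = mk↣ inj
      where
      f : ∀ {n} → Term L n → ℕ
      f* : ∀ {n k} → Vec (Term L n) k → ℕ
      f (var i)    = pair 0 (toℕ i)
      f (app g ts) = pair 1 (pair (code F (_ , g)) (f* ts))
      f* []        = 0
      f* (t ∷ ts)  = pair (f t) (f* ts)

      inj : ∀ {n} {s t : Term L n} → f s ≡ f t → s ≡ t
      inj* : ∀ {n k} {ss ts : Vec (Term L n) k} → f* ss ≡ f* ts → ss ≡ ts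
      inj {s = var i} {var j} e =
        cong var (toℕ-injective (proj₂ (pair-injective e)))
      inj {s = var i} {app g ts} e with () ← proj₁ (pair-injective e)
      inj {s = app g ts} {var j} e with () ← proj₁ (pair-injective e)
      inj {s = app g ts} {app h us} e
        with p , q ← pair-injective
                       (proj₂ (pair-injective e))
        with refl ← code-injective F p = cong (app g) (inj* q)
      inj* {ss = []} {[]} e = refl
      inj* {ss = s ∷ ss} {t ∷ ts} e with p , q ← pair-injective e =
        cong₂ _∷_ (inj p) (inj* q)

    Formula-code : Countable L → ∀ {n} → Formula L n ↣ ℕ
    Formula-code (F , R) = mk↣ (λ {φ} e → let p , q = pair-injective e in inj p q)
      where
      T : ∀ {n} → Term L n ↣ ℕ
      T = Term-code F

      -- The head symbol is coded separately from the rest: once the equality of tags is matched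
      -- with `refl`, only pairs of formulas with the same head remain to be compared.
      tag body f : ∀ {n} → Formula L n → ℕ
      f φ = pair (tag φ) (body φ)
      tag (_ ≈ₜ _)   = 0
      tag (atom _ _) = 1
      tag ⊥          = 2
      tag (_ ⇒ _)    = 3
      tag (all _)    = 4
      body (s ≈ₜ t)    = pair (code T s) (code T t)
      body (atom r ts) = pair (code R (_ , r)) (code (Vec-code T) ts)
      body ⊥           = 0
      body (φ ⇒ ψ)     = pair (f φ) (f ψ)
      body (all φ)     = f φ

      inj : ∀ {n} {φ ψ : Formula L n} → tag φ ≡ tag ψ → body φ ≡ body ψ → φ ≡ ψ
      inj {φ = s ≈ₜ t} {s′ ≈ₜ t′} refl e with p , q ← pair-injective e =
        cong₂ _≈ₜ_ (code-injective T p) (code-injective T q)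
      inj {φ = atom r ts} {atom r′ ts′} refl e
        with p , q ← pair-injective e
        with refl ← code-injective R p = cong (atom r) (code-injective (Vec-code T) q)
      inj {φ = ⊥} {⊥} refl e = refl
      inj {φ = φ ⇒ ψ} {φ′ ⇒ ψ′} refl e
        with p , q ← pair-injective e
        with p₁ , p₂ ← pair-injective p
        with q₁ , q₂ ← pair-injective q = cong₂ _⇒_ (inj p₁ p₂) (inj q₁ q₂)
      inj {φ = all φ} {all ψ} refl e with p , q ← pair-injective e =
        cong all (inj p q)

    rename-term : ∀ {m n} → (Fin m → Fin n) → Term L m → Term L n
    rename-terms : ∀ {m n k} → (Fin m → Fin n) → Vec (Term L m) k → Vec (Term L n) k
    rename-term ρ (var i)    = var (ρ i)
    rename-term ρ (app f ts) = app f (rename-terms ρ ts)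
    rename-terms ρ []        = []
    rename-terms ρ (t ∷ ts)  = rename-term ρ t ∷ rename-terms ρ ts

    under : ∀ {m n} → (Fin m → Fin n) → Fin (suc m) → Fin (suc n)
    under ρ zero    = zero
    under ρ (suc i) = suc (ρ i)

    rename : ∀ {m n} → (Fin m → Fin n) → Formula L m → Formula L n
    rename ρ (s ≈ₜ t)    = rename-term ρ s ≈ₜ rename-term ρ t
    rename ρ (atom R ts) = atom R (rename-terms ρ ts)
    rename ρ ⊥           = ⊥
    rename ρ (φ ⇒ ψ)     = rename ρ φ ⇒ rename ρ ψ
    rename ρ (all φ)     = all (rename (under ρ) φ)

    ¬′_ : ∀ {n} → Formula L n → Formula L n
    ¬′ φ = φ ⇒ ⊥

    infixr 6 _∧′_
    infix 7 ¬′_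
    _∧′_ : ∀ {n} → Formula L n → Formula L n → Formula L n
    φ ∧′ ψ = ¬′ (φ ⇒ ¬′ ψ)

    ⊤′ : ∀ {n} → Formula L n
    ⊤′ = ⊥ ⇒ ⊥

    some : ∀ {n} → Formula L (suc n) → Formula L n
    some φ = ¬′ all (¬′ φ)

    somes : ∀ k {n} → Formula L (k + n) → Formula L n
    somes zero    φ = φ
    somes (suc k) φ = somes k (some φ)

    closure : ∀ {n} → Formula L n → Sentence L
    closure {zero}  φ = φ
    closure {suc n} φ = closure (all φ)

    ⋁ ⋀ : ∀ {n} → List (Formula L n) → Formula L n
    ⋁ = foldr (λ φ ψ → ¬′ φ ⇒ ψ) ⊥
    ⋀ = foldr _∧′_ ⊤′

    module Semantics {A : Set} (M : Structure L A) where
      private module M = Structure M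

      eval-cong : ∀ {n} (t : Term L n) {v w} → v ≗ w → ⟦_⟧ M t v ≡ ⟦_⟧ M t w
      eval-cong* : ∀ {n k} (ts : Vec (Term L n) k) {v w} → v ≗ w → ⟦_⟧* M ts v ≡ ⟦_⟧* M ts w
      eval-cong (var i) e    = e i
      eval-cong (app f ts) e = cong (M.fun f) (eval-cong* ts e)
      eval-cong* [] e        = refl
      eval-cong* (t ∷ ts) e  = cong₂ _∷_ (eval-cong t e) (eval-cong* ts e)

      extend-cong : ∀ {n} {x} {v w : Fin n → A} → v ≗ w → extend M x v ≗ extend M x w
      extend-cong e zero    = refl
      extend-cong e (suc i) = e i

      sat-cong : ∀ {n} (φ : Formula L n) {v w} → v ≗ w → Satisfies M φ v → Satisfies M φ w
      sat-cong (s ≈ₜ t) e p = trans (sym (eval-cong s e)) (trans p (eval-cong t e))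
      sat-cong (atom R ts) e p = subst (M.rel R) (eval-cong* ts e) p
      sat-cong ⊥ e p = p
      sat-cong (φ ⇒ ψ) e p = sat-cong ψ e ∘ p ∘ sat-cong φ (sym ∘ e)
      sat-cong (all φ) e p x = sat-cong φ (extend-cong e) (p x)

      eval-rename : ∀ {m n} {ρ : Fin m → Fin n} t {v} →
        ⟦_⟧ M (rename-term ρ t) v ≡ ⟦_⟧ M t (v ∘ ρ)
      eval-rename* : ∀ {m n k} {ρ : Fin m → Fin n} (ts : Vec (Term L m) k) {v} →
        ⟦_⟧* M (rename-terms ρ ts) v ≡ ⟦_⟧* M ts (v ∘ ρ)
      eval-rename (var i)     = refl
      eval-rename (app f ts)  = cong (M.fun f) (eval-rename* ts)
      eval-rename* []         = refl
      eval-rename* (t ∷ ts)   = cong₂ _∷_ (eval-rename t) (eval-rename* ts)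

      extend-under : ∀ {m n} {ρ : Fin m → Fin n} {x v} →
        extend M x v ∘ under ρ ≗ extend M x (v ∘ ρ)
      extend-under zero    = refl
      extend-under (suc i) = refl

      sat-rename : ∀ {m n} {ρ : Fin m → Fin n} φ {v} →
        Satisfies M (rename ρ φ) v ⇔ Satisfies M φ (v ∘ ρ)
      sat-rename {ρ = ρ} φ = mk⇔ (to φ) (from φ)
        where
        to : ∀ {m n} {ρ : Fin m → Fin n} φ {v} → Satisfies M (rename ρ φ) v → Satisfies M φ (v ∘ ρ)
        from : ∀ {m n} {ρ : Fin m → Fin n} φ {v} → Satisfies M φ (v ∘ ρ) → Satisfies M (rename ρ φ) v
        to (s ≈ₜ t) p = trans (sym (eval-rename s)) (trans p (eval-rename t))
        to (atom R ts) p = subst (M.rel R) (eval-rename* ts) p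
        to ⊥ p = p
        to (φ ⇒ ψ) p = to ψ ∘ p ∘ from φ
        to (all φ) p x = sat-cong φ extend-under (to φ (p x))
        from (s ≈ₜ t) p = trans (eval-rename s) (trans p (sym (eval-rename t)))
        from (atom R ts) p = subst (M.rel R) (sym (eval-rename* ts)) p
        from ⊥ p = p
        from (φ ⇒ ψ) p = from ψ ∘ p ∘ to φ
        from (all φ) p x = from φ (sat-cong φ (sym ∘ extend-under) (p x))

      sat-∧ : ∀ {n} {φ ψ : Formula L n} {v} →
        Satisfies M (φ ∧′ ψ) v ⇔ (Satisfies M φ v × Satisfies M ψ v)
      sat-∧ = mk⇔ (λ p → let q , r = ¬→⇒× p in q , byContradiction r) (λ (p , q) r → r p q)

      sat-some : ∀ {n} {φ : Formula L (suc n)} {v} →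
        Satisfies M (some φ) v ⇔ (∃[ x ] Satisfies M φ (extend M x v))
      sat-some = mk⇔ (λ p → let x , q = ¬∀⇒∃¬ p in x , byContradiction q) (λ (x , p) q → q x p)

      sat-somes : ∀ k {n} {φ : Formula L (k + n)} {u} →
        Satisfies M (somes k φ) u ⇔ (∃[ w ] (∀ i → w (k ↑ʳ i) ≡ u i) × Satisfies M φ w)
      sat-somes zero {φ = φ} = mk⇔ (λ p → _ , (λ _ → refl) , p) (λ (w , e , p) → sat-cong φ e p)
      sat-somes (suc k) {φ = φ} = mk⇔
        (λ p → let w , e , q = fwd (sat-somes k) p
                   x , r     = fwd (sat-some {φ = φ}) q
               in extend M x w , e , r)
        (λ (w , e , p) → bwd (sat-somes k) (w ∘ suc , e ,
          bwd (sat-some {φ = φ}) (w zero , sat-cong φ (λ { zero → refl ; (suc i) → refl }) p)))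

      ⊨-closure : ∀ {n} (φ : Formula L n) → (M ⊨ closure φ) ⇔ (∀ v → Satisfies M φ v)
      ⊨-closure {zero} φ = mk⇔ (λ p v → sat-cong φ (λ ()) p) (λ p → p _)
      ⊨-closure {suc n} φ = mk⇔
        (λ p v → sat-cong φ (λ { zero → refl ; (suc i) → refl })
                   (fwd (⊨-closure (all φ)) p (v ∘ suc) (v zero)))
        (λ p → bwd (⊨-closure (all φ)) (λ v x → p (extend M x v)))

      sat-⋁ : ∀ {n} {φs : List (Formula L n)} {v} →
        Satisfies M (⋁ φs) v ⇔ (∃[ φ ] φ ∈ φs × Satisfies M φ v)
      sat-⋁ = mk⇔ to from
        where
        to : ∀ {n} {φs : List (Formula L n)} {v} →
          Satisfies M (⋁ φs) v → ∃[ φ ] φ ∈ φs × Satisfies M φ v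
        to {φs = φ ∷ φs} {v} p with dec (Satisfies M φ v)
        ... | yes q = φ , here refl , q
        ... | no ¬q = let ψ , ψ∈ , r = to (p ¬q) in ψ , there ψ∈ , r

        from : ∀ {n} {φs : List (Formula L n)} {v} →
          (∃[ φ ] φ ∈ φs × Satisfies M φ v) → Satisfies M (⋁ φs) v
        from (φ , here refl , p) ¬p = ⊥-elim (¬p p)
        from (φ , there φ∈ , p) _ = from (φ , φ∈ , p)

      sat-⋀ : ∀ {n} {φs : List (Formula L n)} {v} →
        Satisfies M (⋀ φs) v ⇔ (∀ {φ} → φ ∈ φs → Satisfies M φ v)
      sat-⋀ = mk⇔ to from
        where
        to : ∀ {n} {φs : List (Formula L n)} {v} →
          Satisfies M (⋀ φs) v → ∀ {φ} → φ ∈ φs → Satisfies M φ v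
        to {φs = φ ∷ φs} p (here refl) = proj₁ (fwd (sat-∧ {φ = φ} {⋀ φs}) p)
        to {φs = φ ∷ φs} p (there φ∈) = to {φs = φs} (proj₂ (fwd (sat-∧ {φ = φ} {⋀ φs}) p)) φ∈

        from : ∀ {n} {φs : List (Formula L n)} {v} →
          (∀ {φ} → φ ∈ φs → Satisfies M φ v) → Satisfies M (⋀ φs) v
        from {φs = []} p = id
        from {φs = φ ∷ φs} p =
          bwd (sat-∧ {φ = φ} {⋀ φs}) (p (here refl) , from {φs = φs} (p ∘ there))

      eval-vars : ∀ {n k} (ρ : Fin k → Fin n) {v} →
        ⟦_⟧* M (tabulate (var ∘ ρ)) v ≡ tabulate (v ∘ ρ)
      eval-vars {k = zero}  ρ = refl
      eval-vars {k = suc k} ρ = cong (_ ∷_) (eval-vars (ρ ∘ suc))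

    open Semantics public using (sat-cong; ⊨-closure)

    module _ {A B : Set} {M : Structure L A} {N : Structure L B} {h : A ↔ B}
             (iso : IsIsomorphism M N h) where
      private
        module M = Structure M
        module N = Structure N
        module iso = IsIsomorphism iso
      open Inverse h using (to; from; strictlyInverseˡ)

      iso-eval : ∀ {n} (t : Term L n) {v} → to (⟦_⟧ M t v) ≡ ⟦_⟧ N t (to ∘ v)
      iso-eval* : ∀ {n k} (ts : Vec (Term L n) k) {v} →
        Vec.map to (⟦_⟧* M ts v) ≡ ⟦_⟧* N ts (to ∘ v)
      iso-eval (var i)    = refl
      iso-eval (app f ts) = trans (iso.fun f _) (cong (N.fun f) (iso-eval* ts))
      iso-eval* []        = refl
      iso-eval* (t ∷ ts)  = cong₂ _∷_ (iso-eval t) (iso-eval* ts)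

      iso-sat : ∀ {n} (φ : Formula L n) {v} → Satisfies M φ v ⇔ Satisfies N φ (to ∘ v)
      iso-sat (s ≈ₜ t) = mk⇔
        (λ p → trans (sym (iso-eval s)) (trans (cong to p) (iso-eval t)))
        (λ p → to-injective h (trans (iso-eval s) (trans p (sym (iso-eval t)))))
      iso-sat (atom R ts) = mk⇔
        (λ p → subst (N.rel R) (iso-eval* ts) (fwd (iso.rel R _) p))
        (λ p → bwd (iso.rel R _) (subst (N.rel R) (sym (iso-eval* ts)) p))
      iso-sat ⊥ = mk⇔ id id
      iso-sat (φ ⇒ ψ) = mk⇔
        (λ p → fwd (iso-sat ψ) ∘ p ∘ bwd (iso-sat φ))
        (λ p → bwd (iso-sat ψ) ∘ p ∘ fwd (iso-sat φ))
      iso-sat (all φ) = mk⇔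
        (λ p y → sat-cong N φ (λ { zero → strictlyInverseˡ y ; (suc i) → refl })
                   (fwd (iso-sat φ) (p (from y))))
        (λ p x → bwd (iso-sat φ) (sat-cong N φ (λ { zero → refl ; (suc i) → refl }) (p (to x))))

  -- Henkin models

  supremum : ∀ {n} (ρ : Fin n → ℕ) → ∃[ N ] (∀ i → ρ i < N)
  supremum {zero}  ρ = 0 , λ ()
  supremum {suc n} ρ with supremum (ρ ∘ suc)
  ... | N , ρ<N = suc (ρ zero) ⊔ N , λ
    { zero    → m≤m⊔n (suc (ρ zero)) N
    ; (suc i) → ≤-trans (ρ<N i) (m≤n⊔m (suc (ρ zero)) N) }

  _[_≔_] : (ℕ → ℕ) → ℕ → ℕ → ℕ → ℕ
  (α [ j ≔ x ]) i with i ≟ j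
  ... | yes _ = x
  ... | no _  = α i

  update-same : ∀ α j x → (α [ j ≔ x ]) j ≡ x
  update-same α j x with j ≟ j
  ... | yes _  = refl
  ... | no j≢j = ⊥-elim (j≢j refl)

  update-other : ∀ α {i j} x → i < j → (α [ j ≔ x ]) i ≡ α i
  update-other α {i} {j} x i<j with i ≟ j
  ... | yes refl = ⊥-elim (<-irrefl refl i<j)
  ... | no _     = refl

  module Conditions {L : Language} (M : Structure L ℕ) where
    open Syntax {L}
    open Semantics M hiding (sat-cong; ⊨-closure)

    -- A condition is a formula in the first so many of the variables
    -- indexed by ℕ.
    Condition : Set
    Condition = Σ ℕ (Formula L)

    infix 4 _⊩_ _≼_
    infixr 6 _&_

    -- These are kept abstract so that α and c can be inferred from α ⊩ c.
    abstract
      _⊩_ : (ℕ → ℕ) → Condition → Set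
      α ⊩ (_ , θ) = Satisfies M θ (α ∘ toℕ)

      ⊩-satisfies : ∀ {α} c → α ⊩ c ⇔ Satisfies M (proj₂ c) (α ∘ toℕ)
      ⊩-satisfies c = mk⇔ id id

      ⊩-local : ∀ c {α β} → (∀ {i} → i < proj₁ c → α i ≡ β i) → α ⊩ c → β ⊩ c
      ⊩-local (k , θ) e = sat-cong M θ (λ i → e (toℕ<n i))

      named : ∀ {n} → Formula L n → (Fin n → ℕ) → Condition
      named φ ρ = _ , rename (λ i → fromℕ< (proj₂ (supremum ρ) i)) φ

      ⊩-named : ∀ {n} (φ : Formula L n) ρ {α} → α ⊩ named φ ρ ⇔ Satisfies M φ (α ∘ ρ)
      ⊩-named φ ρ {α} = mk⇔
        (λ p → sat-cong M φ (λ i → cong α (toℕ-fromℕ< _)) (fwd (sat-rename φ) p))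
        (λ p → bwd (sat-rename φ) (sat-cong M φ (λ i → cong α (sym (toℕ-fromℕ< _))) p))

      _&_ : Condition → Condition → Condition
      (k , θ) & (m , η) = k ⊔ m ,
        rename (λ i → inject≤ i (m≤m⊔n k m)) θ ∧′ rename (λ i → inject≤ i (m≤n⊔m k m)) η

      ⊩-& : ∀ {c d α} → α ⊩ (c & d) ⇔ (α ⊩ c × α ⊩ d)
      ⊩-& {k , θ} {m , η} {α} = mk⇔
        (λ p → let q , r = fwd (sat-∧ {φ = rename _ θ} {rename _ η}) p in
          sat-cong M θ (λ i → cong α (toℕ-inject≤ i _)) (fwd (sat-rename θ) q) ,
          sat-cong M η (λ i → cong α (toℕ-inject≤ i _)) (fwd (sat-rename η) r))
        (λ (q , r) → bwd (sat-∧ {φ = rename _ θ} {rename _ η})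
          ( bwd (sat-rename θ) (sat-cong M θ (λ i → cong α (sym (toℕ-inject≤ i _))) q)
          , bwd (sat-rename η) (sat-cong M η (λ i → cong α (sym (toℕ-inject≤ i _))) r)))

    _≼_ : Condition → Condition → Set
    c ≼ d = ∀ α → α ⊩ c → α ⊩ d

    -- Henkin's construction: a generic decreasing sequence of conditions,
    -- each compatible with all of the decreasing formulas D, decides every
    -- formula and names a counterexample to every universal formula that
    -- fails; in addition it meets the requirements E.
    module Generic
      (codes : Countable L) {n₀} (D : ℕ → Formula L n₀)
      (D-decreasing : ∀ {s t v} → s ≤ t → Satisfies M (D t) v → Satisfies M (D s) v)
      where

      -- Consistency with the theory of `M` and with all of `D`, measured by assignments into `M`
      -- itself rather than by provability.
      Positive : Condition → Set
      Positive c = ∀ s → ∃[ α ] α ⊩ c × Satisfies M (D s) (α ∘ toℕ)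

      -- If one extension failed at `s` and the other at `t`, an assignment for `c` and `D (s ⊔ t)`
      -- would contradict one of the two failures, according to the truth value of `φ`.
      positive-& : ∀ {n} c (φ : Formula L n) ρ → Positive c →
        Positive (c & named φ ρ) ⊎ Positive (c & named (¬′ φ) ρ)
      positive-& c φ ρ pos with dec (Positive (c & named φ ρ)) | dec (Positive (c & named (¬′ φ) ρ))
      ... | yes p | _ = inj₁ p
      ... | no _ | yes q = inj₂ q
      ... | no ¬p | no ¬q with ¬∀⇒∃¬ ¬p | ¬∀⇒∃¬ ¬q
      ... | s , ¬p′ | t , ¬q′ with pos (s ⊔ t)
      ... | α , α⊩c , α∈D with dec (Satisfies M φ (α ∘ ρ))
      ... | yes r = ⊥-elim (¬p′ (α , bwd ⊩-& (α⊩c , bwd (⊩-named φ ρ) r)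
                                 , D-decreasing (m≤m⊔n s t) α∈D))
      ... | no ¬r = ⊥-elim (¬q′ (α , bwd ⊩-& (α⊩c , bwd (⊩-named (¬′ φ) ρ) ¬r)
                                 , D-decreasing (m≤n⊔m s t) α∈D))

      _at_ : ∀ {n} → ℕ → (Fin n → ℕ) → Fin (suc n) → ℕ
      (j at ρ) zero    = j
      (j at ρ) (suc i) = ρ i

      extend-at : ∀ {n} (α : ℕ → ℕ) j (ρ : Fin n → ℕ) → α ∘ (j at ρ) ≗ extend M (α j) (α ∘ ρ)
      extend-at α j ρ zero    = refl
      extend-at α j ρ (suc i) = refl

      Decides : ∀ {n} → Formula L (suc n) → (Fin n → ℕ) → Condition → Set
      Decides φ ρ c =
        (∀ α → α ⊩ c → Satisfies M (all φ) (α ∘ ρ)) ⊎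
        (∃[ j ] (∀ α → α ⊩ c → ¬ Satisfies M φ (extend M (α j) (α ∘ ρ))))

      decide : ∀ {n} (φ : Formula L (suc n)) ρ c → Positive c →
        ∃[ c′ ] Positive c′ × c′ ≼ c × Decides φ ρ c′
      decide φ ρ c pos with positive-& c (all φ) ρ pos
      ... | inj₁ pos′ = _ , pos′ , (λ _ p → proj₁ (fwd ⊩-& p))
        , inj₁ λ α p → fwd (⊩-named (all φ) ρ) (proj₂ (fwd ⊩-& p))
      ... | inj₂ pos′ = c & named (¬′ φ) (j at ρ) , pos″ , (λ _ p → proj₁ (fwd ⊩-& p))
        , inj₂ (j , λ α p r → fwd (⊩-named (¬′ φ) (j at ρ)) (proj₂ (fwd ⊩-& p))
                                  (sat-cong M φ (sym ∘ extend-at α j ρ) r))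
        where
        N = proj₁ (supremum ρ)
        -- a variable on which neither c nor ρ nor D depends
        j = (proj₁ c ⊔ N) ⊔ n₀

        pos″ : Positive (c & named (¬′ φ) (j at ρ))
        pos″ s with pos′ s
        ... | α , p , α∈D with fwd ⊩-& p
        ... | α⊩c , q with ¬∀⇒∃¬ (fwd (⊩-named (¬′ (all φ)) ρ) q)
        ... | x , ¬r = β
          , bwd ⊩-&
              ( ⊩-local c (λ i< → sym (keep (≤-trans i< (≤-trans (m≤m⊔n _ N) (m≤m⊔n _ n₀))))) α⊩c
              , bwd (⊩-named (¬′ φ) (j at ρ)) (λ r → ¬r (sat-cong M φ β-at r)))
          , sat-cong M (D s) (λ i → sym (keep (≤-trans (toℕ<n i) (m≤n⊔m (proj₁ c ⊔ N) n₀)))) α∈D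
          where
          β = α [ j ≔ x ]

          keep : ∀ {i} → i < j → β i ≡ α i
          keep = update-other α x

          β-at : β ∘ (j at ρ) ≗ extend M x (α ∘ ρ)
          β-at zero    = update-same α j x
          β-at (suc i) = keep (≤-trans (proj₂ (supremum ρ) i) (≤-trans (m≤n⊔m (proj₁ c) N) (m≤m⊔n _ n₀)))

      module Construct
        (D-satisfiable : ∀ s → ∃ (Satisfies M (D s)))
        (E : ℕ → ℕ → Pred (ℕ → ℕ) 0ℓ)
        (E-dense : ∀ i c → Positive c →
          ∃[ c′ ] Positive c′ × c′ ≼ c × (∃[ s ] (∀ α → α ⊩ c′ → E i s α)))
        where

        private module M = Structure M

        Task : Set
        Task = Σ ℕ λ n → Formula L (suc n) × Vec ℕ n

        task : ℕ → Task
        task = decode (Σ-code λ n → ×-code (Formula-code codes) (Vec-code ℕ-code)) (0 , ⊥ , [])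

        task-surjective : ∀ t → ∃[ i ] task i ≡ t
        task-surjective t = _ , decode-code (Σ-code λ n → ×-code (Formula-code codes) (Vec-code ℕ-code)) (0 , ⊥ , []) t

        Stage : Set
        Stage = Σ Condition Positive

        start : Stage
        start = (0 , ⊤′) , λ s → let v , p = D-satisfiable s in
          assign v , bwd (⊩-satisfies _) id , sat-cong M (D s) (λ i → sym (assign-toℕ v i)) p
          where
          assign : ∀ {n} → (Fin n → ℕ) → ℕ → ℕ
          assign {zero}  v i       = 0
          assign {suc n} v zero    = v zero
          assign {suc n} v (suc i) = assign (v ∘ suc) i

          assign-toℕ : ∀ {n} (v : Fin n → ℕ) → assign v ∘ toℕ ≗ v
          assign-toℕ v zero    = refl
          assign-toℕ v (suc i) = assign-toℕ (v ∘ suc) i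

        module Step (i : ℕ) (c : Condition) (pos : Positive c) where
          φ = proj₁ (proj₂ (task i))
          ρ = Vec.lookup (proj₂ (proj₂ (task i)))

          first = decide φ ρ c pos
          c₁ = proj₁ first

          second = E-dense i c₁ (proj₁ (proj₂ first))
          c₂ = proj₁ second

          positive = proj₁ (proj₂ second)

          c₂≼c₁ : c₂ ≼ c₁
          c₂≼c₁ = proj₁ (proj₂ (proj₂ second))

          c₁≼c : c₁ ≼ c
          c₁≼c = proj₁ (proj₂ (proj₂ first))

        stage : ℕ → Stage
        stage zero    = start
        stage (suc i) = Step.c₂ i (proj₁ (stage i)) (proj₂ (stage i))
                      , Step.positive i (proj₁ (stage i)) (proj₂ (stage i))

        module StageStep i = Step i (proj₁ (stage i)) (proj₂ (stage i))

        stage-+ : ∀ m n → proj₁ (stage (m + n)) ≼ proj₁ (stage n)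
        stage-+ zero    n _ = id
        stage-+ (suc m) n α = stage-+ m n α ∘ StageStep.c₁≼c (m + n) α ∘ StageStep.c₂≼c₁ (m + n) α

        stage-antitone : ∀ {m n} → m ≤ n → proj₁ (stage n) ≼ proj₁ (stage m)
        stage-antitone {m} {n} m≤n =
          subst (λ k → proj₁ (stage k) ≼ proj₁ (stage m)) (m∸n+n≡m m≤n) (stage-+ (n ∸ m) m)

        abstract
          Forced : Pred (ℕ → ℕ) 0ℓ → Set
          Forced P = ∃[ i ] (∀ α → α ⊩ proj₁ (stage i) → P α)

          always : ∀ {P} → (∀ α → P α) → Forced P
          always p = 0 , λ α _ → p α

          forced-map : ∀ {P Q} → (∀ α → P α → Q α) → Forced P → Forced Q
          forced-map f (i , p) = i , λ α q → f α (p α q)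

          forced-zip : ∀ {P Q R} → (∀ α → P α → Q α → R α) → Forced P → Forced Q → Forced R
          forced-zip f (i , p) (j , q) = i ⊔ j , λ α r →
            f α (p α (stage-antitone (m≤m⊔n i j) α r)) (q α (stage-antitone (m≤n⊔m i j) α r))

          forced-consistent : ∀ {P} → Forced P → ∃ P
          forced-consistent (i , p) = let α , q , _ = proj₂ (stage i) 0 in α , p α q

          forced-E : ∀ i → ∃[ s ] Forced (E i s)
          forced-E i = let s , e = proj₂ (proj₂ (proj₂ (StageStep.second i))) in s , suc i , e

          Resolved : ∀ {n} → Formula L (suc n) → (Fin n → ℕ) → Set
          Resolved φ ρ = Forced (λ α → Satisfies M (all φ) (α ∘ ρ)) ⊎
            (∃[ j ] Forced (λ α → ¬ Satisfies M φ (extend M (α j) (α ∘ ρ))))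

          forced-all : ∀ {n} (φ : Formula L (suc n)) (ρ : Fin n → ℕ) → Resolved φ ρ
          forced-all φ ρ = let i , e = task-surjective (_ , φ , tabulate ρ) in
            convert (subst ResolvedTask e (outcome i (proj₂ (proj₂ (proj₂ (StageStep.first i))))))
            where
            ResolvedTask : Task → Set
            ResolvedTask (_ , φ , r) = Resolved φ (Vec.lookup r)

            outcome : ∀ i → Decides (StageStep.φ i) (StageStep.ρ i) (StageStep.c₁ i) → ResolvedTask (task i)
            outcome i (inj₁ p)       = inj₁ (suc i , λ α q → p α (StageStep.c₂≼c₁ i α q))
            outcome i (inj₂ (j , p)) = inj₂ (j , suc i , λ α q → p α (StageStep.c₂≼c₁ i α q))

            same : ∀ (α : ℕ → ℕ) → α ∘ Vec.lookup (tabulate ρ) ≗ α ∘ ρ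
            same α i = cong α (Vec.lookup∘tabulate ρ i)

            convert : Resolved φ (Vec.lookup (tabulate ρ)) → Resolved φ ρ
            convert (inj₁ p) = inj₁ (forced-map (λ α → sat-cong M (all φ) (same α)) p)
            convert (inj₂ (j , p)) = inj₂ (j , forced-map
              (λ α ¬p q → ¬p (sat-cong M φ (sym ∘ extend-cong (same α)) q)) p)

          -- Quantifying over a dummy variable turns `forced-all` into a decision of `φ` itself.
          forced-dec : ∀ {n} (φ : Formula L n) (ρ : Fin n → ℕ) →
            Forced (λ α → Satisfies M φ (α ∘ ρ)) ⊎ Forced (λ α → ¬ Satisfies M φ (α ∘ ρ))
          forced-dec φ ρ with forced-all (rename suc φ) ρ
          ... | inj₁ p = inj₁ (forced-map (λ α q → fwd (sat-rename φ) (q 0)) p)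
          ... | inj₂ (j , p) = inj₂ (forced-map (λ α ¬q q → ¬q (bwd (sat-rename φ) q)) p)

          forced-some : ∀ {n} (φ : Formula L (suc n)) (ρ : Fin n → ℕ) →
            (∀ α → ∃[ x ] Satisfies M φ (extend M x (α ∘ ρ))) →
            ∃[ j ] Forced (λ α → Satisfies M φ (extend M (α j) (α ∘ ρ)))
          forced-some φ ρ ex with forced-all (¬′ φ) ρ
          ... | inj₁ p = let α , q = forced-consistent p ; x , r = ex α in ⊥-elim (q x r)
          ... | inj₂ (j , p) = j , forced-map (λ α → byContradiction) p

          -- The domain of the generic model: variables up to forced equality,
          -- each class represented by its least element.
          representative : ∀ i → ∃[ j ] Forced (λ α → α j ≡ α i) × (∀ {k} → Forced (λ α → α k ≡ α i) → j ≤ k)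
          representative i = least (λ j → Forced (λ α → α j ≡ α i)) (i , always (λ _ → refl))

          rep : ℕ → ℕ
          rep i = proj₁ (representative i)

          rep-forced : ∀ i → Forced (λ α → α (rep i) ≡ α i)
          rep-forced i = proj₁ (proj₂ (representative i))

          rep-cong : ∀ {i j} → Forced (λ α → α i ≡ α j) → rep i ≡ rep j
          rep-cong {i} {j} e = ≤-antisym
            (proj₂ (proj₂ (representative i)) (forced-zip (λ _ p q → trans p (sym q)) (rep-forced j) e))
            (proj₂ (proj₂ (representative j)) (forced-zip (λ _ → trans) (rep-forced i) e))

        Domain : Set
        Domain = Σ ℕ λ i → rep i ≡ i

        Domain-≡ : ∀ {x y : Domain} → proj₁ x ≡ proj₁ y → x ≡ y
        Domain-≡ {i , p} {.i , q} refl = cong (i ,_) (≡-irrelevant p q)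

        Domain-code : Domain ↣ ℕ
        Domain-code = mk↣ Domain-≡

        abstract
          class : ℕ → Domain
          class i = rep i , rep-cong (rep-forced i)

          class-forced : ∀ i → Forced (λ α → α (proj₁ (class i)) ≡ α i)
          class-forced = rep-forced

          module _ {k} (f : Language.Function L k) (xs : Vec Domain k) where

            private
              φ : Formula L (suc k)
              φ = app f (tabulate (var ∘ suc)) ≈ₜ var zero

              ρ : Fin k → ℕ
              ρ i = proj₁ (Vec.lookup xs i)

              args : ∀ α x → ⟦_⟧* M (tabulate (var ∘ suc)) (extend M x (α ∘ ρ)) ≡ Vec.map (α ∘ proj₁) xs
              args α x = trans (eval-vars suc)
                (trans (Vec.tabulate-∘ (α ∘ proj₁) (Vec.lookup xs))
                       (cong (Vec.map (α ∘ proj₁)) (Vec.tabulate∘lookup xs)))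

            value : ∃[ j ] Forced (λ α → M.fun f (Vec.map (α ∘ proj₁) xs) ≡ α j)
            value with forced-some φ ρ (λ α → M.fun f _ , cong (M.fun f) (args α _))
            ... | j , p = j , forced-map (λ α e → trans (cong (M.fun f) (sym (args α (α j)))) e) p

          model : Structure L Domain
          model = record
            { fun = λ f xs → class (proj₁ (value f xs))
            ; rel = λ R xs → Forced (λ α → M.rel R (Vec.map (α ∘ proj₁) xs))
            }

          eval-forced : ∀ {n} (t : Term L n) (β : Fin n → Domain) →
            Forced (λ α → ⟦_⟧ M t (α ∘ proj₁ ∘ β) ≡ α (proj₁ (⟦_⟧ model t β)))
          eval-forced* : ∀ {n k} (ts : Vec (Term L n) k) (β : Fin n → Domain) →
            Forced (λ α → ⟦_⟧* M ts (α ∘ proj₁ ∘ β) ≡ Vec.map (α ∘ proj₁) (⟦_⟧* model ts β))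
          eval-forced (var i) β = always λ _ → refl
          eval-forced (app f ts) β = forced-zip
            (λ α e (p , q) → trans (cong (M.fun f) e) (trans p (sym q)))
            (eval-forced* ts β)
            (forced-zip (λ _ → _,_) (proj₂ (value f _)) (rep-forced _))
          eval-forced* [] β = always λ _ → refl
          eval-forced* (t ∷ ts) β =
            forced-zip (λ _ → cong₂ _∷_) (eval-forced t β) (eval-forced* ts β)

          extend-proj₁ : ∀ {n} α x (β : Fin n → Domain) →
            extend M (α (proj₁ x)) (α ∘ proj₁ ∘ β) ≗ α ∘ proj₁ ∘ extend model x β
          extend-proj₁ α x β zero    = refl
          extend-proj₁ α x β (suc i) = refl

          -- In the universal case a formula that is not forced has a counterexample named by some
          -- variable, and the class of that variable is an element of the model at which it fails.
          truth : ∀ {n} (φ : Formula L n) (β : Fin n → Domain) →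
            Satisfies model φ β ⇔ Forced (λ α → Satisfies M φ (α ∘ proj₁ ∘ β))
          truth (s ≈ₜ t) β = mk⇔
            (λ e → forced-zip (λ α p q → trans p (trans (cong (α ∘ proj₁) e) (sym q)))
                     (eval-forced s β) (eval-forced t β))
            (λ e → Domain-≡ (trans (sym (proj₂ (⟦_⟧ model s β)))
              (trans (rep-cong (forced-zip (λ _ (p , q) e → trans (sym p) (trans e q))
                                  (forced-zip (λ _ → _,_) (eval-forced s β) (eval-forced t β)) e))
                     (proj₂ (⟦_⟧ model t β)))))
          truth (atom R ts) β = mk⇔
            (forced-zip (λ _ e → subst (M.rel R) (sym e)) (eval-forced* ts β))
            (forced-zip (λ _ e → subst (M.rel R) e) (eval-forced* ts β))
          truth ⊥ β = mk⇔ ⊥-elim (proj₂ ∘ forced-consistent)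
          truth (φ ⇒ ψ) β = mk⇔ to (λ p q → bwd (truth ψ β) (forced-zip (λ _ f x → f x) p (fwd (truth φ β) q)))
            where
            to : (Satisfies model φ β → Satisfies model ψ β) →
                 Forced (λ α → Satisfies M (φ ⇒ ψ) (α ∘ proj₁ ∘ β))
            to f with forced-dec φ (proj₁ ∘ β)
            ... | inj₁ p = forced-map (λ _ q _ → q) (fwd (truth ψ β) (f (bwd (truth φ β) p)))
            ... | inj₂ ¬p = forced-map (λ _ ¬q q → ⊥-elim (¬q q)) ¬p
          truth (all φ) β = mk⇔ to from
            where
            from : Forced (λ α → Satisfies M (all φ) (α ∘ proj₁ ∘ β)) →
                   ∀ x → Satisfies model φ (extend model x β)
            from p x = bwd (truth φ (extend model x β))
              (forced-map (λ α q → sat-cong M φ (extend-proj₁ α x β) (q (α (proj₁ x)))) p)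

            to : (∀ x → Satisfies model φ (extend model x β)) →
                 Forced (λ α → Satisfies M (all φ) (α ∘ proj₁ ∘ β))
            to f with forced-all φ (proj₁ ∘ β)
            ... | inj₁ p = p
            ... | inj₂ (j , ¬p) = ⊥-elim (proj₂ (forced-consistent contradictory))
              where
              contradictory : Forced (λ _ → Empty.⊥)
              contradictory = forced-zip
                (λ α (¬q , e) q → ¬q (sat-cong M φ (λ { zero → e ; (suc i) → refl }) q))
                (forced-zip (λ _ → _,_) ¬p (rep-forced j))
                (fwd (truth φ (extend model (class j) β)) (f (class j)))

          elementary : ∀ φ → M ⊨ φ → model ⊨ φ
          elementary φ p = bwd (truth φ (λ ())) (always (λ α → sat-cong M φ (λ ()) p))

  -- Types and countable categoricity

  module Types {L : Language} {A : Set} (M : Structure L A) where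
    open Syntax {L}
    open Semantics M hiding (sat-cong; ⊨-closure)

    SameType : ∀ {n} → (Fin n → A) → (Fin n → A) → Set
    SameType u v = ∀ φ → Satisfies M φ u → Satisfies M φ v

    sameType-sym : ∀ {n} {u v : Fin n → A} → SameType u v → SameType v u
    sameType-sym s φ p = byContradiction λ ¬q → s (¬′ φ) ¬q p

    FinitelyManyTypes : Set
    FinitelyManyTypes = ∀ n → Σ[ us ∈ List (Fin n → A) ] (∀ v → ∃[ u ] u ∈ us × SameType u v)

    Isolates : ∀ {n} → Formula L n → (Fin n → A) → Set
    Isolates χ v = Satisfies M χ v × (∀ w → Satisfies M χ w → SameType v w)

    -- One formula separates `v` from each representative of another type; the conjunction of these
    -- finitely many formulas leaves only the type of `v`.
    isolating : FinitelyManyTypes → ∀ {n} (v : Fin n → A) → ∃[ χ ] Isolates χ v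
    isolating finite {n} v = ⋀ χs , bwd (sat-⋀ {φs = χs}) holds , λ w p →
      let u , u∈ , s = proj₂ (finite n) w in
      λ φ q → s φ (separates u∈ (λ {χ} χ∈ → sameType-sym s χ (fwd (sat-⋀ {φs = χs}) p χ∈)) φ q)
      where
      separate : ∀ us → Σ[ χs ∈ List (Formula L n) ] (∀ {χ} → χ ∈ χs → Satisfies M χ v) ×
        (∀ {u} → u ∈ us → (∀ {χ} → χ ∈ χs → Satisfies M χ u) → SameType v u)
      separate [] = [] , (λ ()) , λ ()
      separate (u ∷ us) with separate us | dec (SameType v u)
      ... | χs , holds , sep | yes s = χs , holds , λ { (here refl) _ → s ; (there u∈) → sep u∈ }
      ... | χs , holds , sep | no ¬s with ¬∀⇒∃¬ ¬s
      ... | χ , ¬p with ¬→⇒× ¬p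
      ... | q , ¬r = χ ∷ χs , (λ { (here refl) → q ; (there χ∈) → holds χ∈ })
        , λ { (here refl) sat → ⊥-elim (¬r (sat (here refl)))
            ; (there u∈) sat → sep u∈ (sat ∘ there) }

      χs = proj₁ (separate (proj₁ (finite n)))
      holds = proj₁ (proj₂ (separate (proj₁ (finite n))))
      separates = proj₂ (proj₂ (separate (proj₁ (finite n))))

  -- Countable categoricity implies finitely many types

  module _ {L : Language} (codes : Countable L) (M : Structure L ℕ) (categorical : IsωCategorical M) where
    open Syntax {L}
    open Semantics M hiding (sat-cong; ⊨-closure)
    open Conditions M
    open Types M

    -- The generic model is made to satisfy all of `D` at its first `n` variables, and the
    -- isomorphism given by categoricity carries this tuple back to `M`.
    realised : ∀ {n} (D : ℕ → Formula L n) →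
      (∀ {s t v} → s ≤ t → Satisfies M (D t) v → Satisfies M (D s) v) →
      (∀ s → ∃ (Satisfies M (D s))) → ∃[ v ] (∀ s → Satisfies M (D s) v)
    realised {n} D decreasing satisfiable = v , v∈D
      where
      open Generic codes D decreasing

      E : ℕ → ℕ → Pred (ℕ → ℕ) 0ℓ
      E i _ α = Satisfies M (D i) (α ∘ toℕ)

      dense : ∀ i c → Positive c → ∃[ c′ ] Positive c′ × c′ ≼ c × (∃[ s ] (∀ α → α ⊩ c′ → E i s α))
      dense i c pos = c & named (D i) toℕ , pos′ , (λ α p → proj₁ (fwd ⊩-& p))
        , 0 , λ α p → fwd (⊩-named (D i) toℕ) (proj₂ (fwd ⊩-& p))
        where
        pos′ : Positive (c & named (D i) toℕ)
        pos′ s = let α , p , q = pos (s ⊔ i) in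
          α , bwd ⊩-& (p , bwd (⊩-named (D i) toℕ) (decreasing (m≤n⊔m s i) q)) , decreasing (m≤m⊔n s i) q

      open Construct satisfiable E dense

      h = proj₁ (categorical Domain-code model elementary)
      iso = proj₂ (categorical Domain-code model elementary)

      v : Fin n → ℕ
      v i = Inverse.from h (class (toℕ i))

      forced-each : ∀ {k} {P : Fin k → Pred (ℕ → ℕ) 0ℓ} → (∀ i → Forced (P i)) → Forced (λ α → ∀ i → P i α)
      forced-each {zero}  f = always λ _ ()
      forced-each {suc k} f = forced-zip (λ { α p q zero → p ; α p q (suc i) → q i })
                                (f zero) (forced-each (f ∘ suc))

      v∈D : ∀ s → Satisfies M (D s) v
      v∈D s = bwd (iso-sat iso (D s))
        (sat-cong model (D s) (λ i → sym (Inverse.strictlyInverseˡ h (class (toℕ i))))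
          (bwd (truth (D s) (class ∘ toℕ))
            (forced-zip (λ α e → sat-cong M (D s) (sym ∘ e))
              (forced-each (λ i → class-forced (toℕ i))) (proj₂ (forced-E s)))))

    -- The condition θ, as a property of the variables ρ alone.
    module Projection {n} (k : ℕ) (θ : Formula L k) (ρ : Fin n → ℕ) where
      N = proj₁ (supremum ρ)
      K = k ⊔ N

      θ-index : Fin k → Fin (K + n)
      θ-index i = inject≤ i (m≤m⊔n k N) ↑ˡ n

      ρ-index : Fin n → Fin K
      ρ-index i = fromℕ< (≤-trans (proj₂ (supremum ρ) i) (m≤n⊔m k N))

      equations : List (Formula L (K + n))
      equations = List.tabulate (λ i → var (ρ-index i ↑ˡ n) ≈ₜ var (K ↑ʳ i))

      -- The first `K` variables stand for the assignment and get bound; the last `n` stay free and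
      -- are equated with its values at `ρ`.
      body : Formula L (K + n)
      body = rename θ-index θ ∧′ ⋀ equations

      projection : Formula L n
      projection = somes K body

      project : ∀ α → Satisfies M θ (α ∘ toℕ) → Satisfies M projection (α ∘ ρ)
      project α p = bwd (sat-somes K {φ = body}) (w , w-right ,
        bwd (sat-∧ {φ = rename θ-index θ} {⋀ equations})
          ( bwd (sat-rename θ) (sat-cong M θ (λ i → sym (trans (w-left _) (cong α (toℕ-inject≤ i _)))) p)
          , bwd (sat-⋀ {φs = equations}) (λ φ∈ → equation (∈-tabulate⁻ φ∈))))
        where
        w : Fin (K + n) → ℕ
        w = [ α ∘ toℕ , α ∘ ρ ]′ ∘ splitAt K

        w-left : ∀ i → w (i ↑ˡ n) ≡ α (toℕ i)
        w-left i = cong [ α ∘ toℕ , α ∘ ρ ]′ (splitAt-↑ˡ K i n)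

        w-right : ∀ i → w (K ↑ʳ i) ≡ α (ρ i)
        w-right i = cong [ α ∘ toℕ , α ∘ ρ ]′ (splitAt-↑ʳ K n i)

        equation : ∀ {φ} → (∃[ i ] φ ≡ (var (ρ-index i ↑ˡ n) ≈ₜ var (K ↑ʳ i))) → Satisfies M φ w
        equation (i , refl) =
          trans (w-left _) (trans (cong α (toℕ-fromℕ< _)) (sym (w-right i)))

      lift : ∀ u → Satisfies M projection u → ∃[ α ] Satisfies M θ (α ∘ toℕ) × α ∘ ρ ≗ u
      lift u p = α
        , sat-cong M θ (λ i → sym (trans (cong α (sym (toℕ-inject≤ i (m≤m⊔n k N)))) (α-toℕ _)))
            (fwd (sat-rename θ) (proj₁ both))
        , λ i → trans (cong α (sym (toℕ-fromℕ< _)))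
            (trans (α-toℕ _) (trans (fwd (sat-⋀ {φs = equations}) (proj₂ both) (∈-tabulate⁺ i)) (w-right i)))
        where
        lifted = fwd (sat-somes K {φ = body}) p
        w = proj₁ lifted
        w-right = proj₁ (proj₂ lifted)
        both = fwd (sat-∧ {φ = rename θ-index θ} {⋀ equations}) (proj₂ (proj₂ lifted))

        α : ℕ → ℕ
        α j with j <? K
        ... | yes j<K = w (fromℕ< j<K ↑ˡ n)
        ... | no _    = 0

        α-toℕ : ∀ (i : Fin K) → α (toℕ i) ≡ w (i ↑ˡ n)
        α-toℕ i with toℕ i <? K
        ... | yes i<K = cong (λ j → w (j ↑ˡ n)) (fromℕ<-toℕ i i<K)
        ... | no i≮K  = ⊥-elim (i≮K (toℕ<n i))

    abstract
      projection : ∀ {n} c (ρ : Fin n → ℕ) → ∃[ ψ ]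
        (∀ α → α ⊩ c → Satisfies M ψ (α ∘ ρ)) ×
        (∀ u → Satisfies M ψ u → ∃[ α ] α ⊩ c × α ∘ ρ ≗ u)
      projection c ρ = P.projection , (λ α p → P.project α (fwd (⊩-satisfies c) p)) , λ u p →
        let α , q , e = P.lift u p in α , bwd (⊩-satisfies c) q , e
        where module P = Projection (proj₁ c) (proj₂ c) ρ

    -- Omitting types. What a condition says about a tuple of variables is a satisfiable formula by
    -- `projection`; as it does not imply all of `D`, the condition can be strengthened until the
    -- tuple violates some `D s`. The generic model thus omits `D`, and so does its isomorphic copy
    -- `M`.
    omitted : ∀ {n} (D : ℕ → Formula L n) →
      (∀ θ → ∃ (Satisfies M θ) → ∃[ s ] ∃[ u ] Satisfies M θ u × ¬ Satisfies M (D s) u) →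
      ¬ (∃[ v ] (∀ s → Satisfies M (D s) v))
    omitted {n} D nonisolated (v , v∈D) = contradictory
      where
      open Generic codes (λ _ → ⊤′ {0}) (λ _ → id)

      tuple : ℕ → Vec ℕ n
      tuple = decode (Vec-code ℕ-code) (Vec.replicate n 0)

      E : ℕ → ℕ → Pred (ℕ → ℕ) 0ℓ
      E i s α = ¬ Satisfies M (D s) (α ∘ Vec.lookup (tuple i))

      dense : ∀ i c → Positive c → ∃[ c′ ] Positive c′ × c′ ≼ c × (∃[ s ] (∀ α → α ⊩ c′ → E i s α))
      dense i c pos = refine (nonisolated ψ (_ , project α₀ α₀⊩c))
        where
        ρ = Vec.lookup (tuple i)
        ψ = proj₁ (projection c ρ)
        project = proj₁ (proj₂ (projection c ρ))
        lift = proj₂ (proj₂ (projection c ρ))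
        α₀ = proj₁ (pos 0)
        α₀⊩c = proj₁ (proj₂ (pos 0))

        refine : (∃[ s ] ∃[ u ] Satisfies M ψ u × ¬ Satisfies M (D s) u) →
          ∃[ c′ ] Positive c′ × c′ ≼ c × (∃[ s ] (∀ α → α ⊩ c′ → E i s α))
        refine (s , u , p , ¬q) = c & named (¬′ D s) ρ
          , (λ _ → proj₁ (lift u p) , bwd ⊩-& (proj₁ (proj₂ (lift u p)) , bwd (⊩-named (¬′ D s) ρ)
              (λ q → ¬q (sat-cong M (D s) (proj₂ (proj₂ (lift u p))) q))) , id)
          , (λ α p → proj₁ (fwd ⊩-& p))
          , s , λ α p → fwd (⊩-named (¬′ D s) ρ) (proj₂ (fwd ⊩-& p))

      ⊤′-satisfiable : ∀ s → ∃ (Satisfies M (⊤′ {0}))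
      ⊤′-satisfiable _ = (λ ()) , id

      open Construct ⊤′-satisfiable E dense

      h = proj₁ (categorical Domain-code model elementary)
      iso = proj₂ (categorical Domain-code model elementary)

      β : Fin n → Domain
      β = Inverse.to h ∘ v

      i = code (Vec-code ℕ-code) (tabulate (proj₁ ∘ β))

      tuple-i : ∀ j → Vec.lookup (tuple i) j ≡ proj₁ (β j)
      tuple-i j = trans
        (cong (λ t → Vec.lookup t j) (decode-code (Vec-code ℕ-code) _ (tabulate (proj₁ ∘ β))))
        (Vec.lookup∘tabulate (proj₁ ∘ β) j)

      s = proj₁ (forced-E i)

      contradictory : Empty.⊥
      contradictory = proj₂ (forced-consistent (forced-zip
        {E i s} {λ α → Satisfies M (D s) (α ∘ proj₁ ∘ β)} {λ _ → Empty.⊥}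
        (λ α ¬p p → ¬p (sat-cong M (D s) (λ j → cong α (sym (tuple-i j))) p))
        (proj₂ (forced-E i))
        (fwd (truth (D s) β) (fwd (iso-sat iso (D s)) (v∈D s)))))

    private module InfinitelyManyTypes (n : ℕ) where
      Many : Formula L n → Set
      Many θ = ¬ (Σ[ us ∈ List (Fin n → ℕ) ] (∀ v → Satisfies M θ v → ∃[ u ] u ∈ us × SameType u v))

      many-satisfiable : ∀ θ → Many θ → ∃ (Satisfies M θ)
      many-satisfiable θ many = byContradiction λ none → many ([] , λ v p → ⊥-elim (none (v , p)))

      formula : ℕ → Formula L n
      formula = decode (Formula-code codes) ⊥

      module _ (infinite : ¬ (Σ[ us ∈ List (Fin n → ℕ) ] (∀ v → ∃[ u ] u ∈ us × SameType u v))) where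

        -- If both halves of `θ` had finitely many types, the two lists together would cover `θ`.
        step : ∀ θ φ → Many θ → ∃[ ψ ] Many (θ ∧′ ψ) × (ψ ≡ φ ⊎ ψ ≡ ¬′ φ)
        step θ φ many with dec (Many (θ ∧′ φ))
        ... | yes p = φ , p , inj₁ refl
        ... | no ¬p = ¬′ φ , negative , inj₂ refl
          where
          negative : Many (θ ∧′ (¬′ φ))
          negative (us , cover) with byContradiction ¬p
          ... | us′ , cover′ = many (us′ ++ us , λ v q → both v q (dec (Satisfies M φ v)))
            where
            both : ∀ v → Satisfies M θ v → Dec (Satisfies M φ v) →
                   ∃[ u ] u ∈ us′ ++ us × SameType u v
            both v q (yes r) with cover′ v (bwd (sat-∧ {φ = θ} {φ}) (q , r))
            ... | u , u∈ , s = u , ∈-++⁺ˡ u∈ , s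
            both v q (no ¬r) with cover v (bwd (sat-∧ {φ = θ} {¬′ φ}) (q , ¬r))
            ... | u , u∈ , s = u , ∈-++⁺ʳ us′ u∈ , s

        stage : ℕ → ∃ Many
        stage zero    = ⊤′ , λ (us , cover) → infinite (us , λ v → cover v id)
        stage (suc i) =
          let θ , many = stage i ; ψ , many′ , _ = step θ (formula i) many in θ ∧′ ψ , many′

        D : ℕ → Formula L n
        D = proj₁ ∘ stage

        choice : ∀ i → ∃[ ψ ] Many (D i ∧′ ψ) × (ψ ≡ formula i ⊎ ψ ≡ ¬′ formula i)
        choice i = step (D i) (formula i) (proj₂ (stage i))

        D-suc : ∀ i {v} → Satisfies M (D (suc i)) v → Satisfies M (D i) v × Satisfies M (proj₁ (choice i)) v
        D-suc i = fwd (sat-∧ {φ = D i} {proj₁ (choice i)})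

        D-+ : ∀ m n {v} → Satisfies M (D (m + n)) v → Satisfies M (D n) v
        D-+ zero    n p = p
        D-+ (suc m) n p = D-+ m n (proj₁ (D-suc (m + n) p))

        decreasing : ∀ {s t v} → s ≤ t → Satisfies M (D t) v → Satisfies M (D s) v
        decreasing {s} {t} {v} s≤t p =
          D-+ (t ∸ s) s (subst (λ k → Satisfies M (D k) v) (sym (m∸n+n≡m s≤t)) p)

        decided : ∀ i {u v} → Satisfies M (D (suc i)) u → Satisfies M (D (suc i)) v →
          Satisfies M (formula i) u → Satisfies M (formula i) v
        decided i p q r with choice i | D-suc i p | D-suc i q
        ... | _ , _ , inj₁ refl | _ | _ , q′ = q′
        ... | _ , _ , inj₂ refl | _ , p′ | _ = ⊥-elim (p′ r)

        formula-code : ∀ φ → formula (code (Formula-code codes) φ) ≡ φ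
        formula-code = decode-code (Formula-code codes) ⊥

        -- Suppose a satisfiable `θ` implies all of `D`. Some `D (suc i)` decides `θ`, necessarily
        -- in its favour, so it implies `θ` and with it every `D s`. Since these decide all
        -- formulas, `D (suc i)` contains a single type, against its having infinitely many.
        nonisolated : ∀ θ → ∃ (Satisfies M θ) → ∃[ s ] ∃[ u ] Satisfies M θ u × ¬ Satisfies M (D s) u
        nonisolated θ (u₀ , p₀) = byContradiction λ isolated →
          let below : ∀ s {u} → Satisfies M θ u → Satisfies M (D s) u
              below s p = byContradiction λ ¬q → isolated (s , _ , p , ¬q)

              i = code (Formula-code codes) θ

              above : ∀ {v} → Satisfies M (D (suc i)) v → Satisfies M θ v
              above {v} q = subst (λ χ → Satisfies M χ v) (formula-code θ)
                (decided i (below (suc i) p₀) q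
                  (subst (λ χ → Satisfies M χ u₀) (sym (formula-code θ)) p₀))
          in proj₂ (stage (suc i)) (u₀ ∷ [] , λ v q → u₀ , here refl , λ φ r →
               let j = code (Formula-code codes) φ in
               subst (λ χ → Satisfies M χ v) (formula-code φ)
                 (decided j (below (suc j) p₀) (below (suc j) (above q))
                   (subst (λ χ → Satisfies M χ u₀) (sym (formula-code φ)) r)))

        -- The same type would be realised and omitted in `M`.
        contradictory : Empty.⊥
        contradictory = omitted D nonisolated
          (realised D decreasing (λ s → many-satisfiable (D s) (proj₂ (stage s))))

    abstract
      finitelyManyTypes : FinitelyManyTypes
      finitelyManyTypes n = byContradiction (InfinitelyManyTypes.contradictory n)

  -- Finitely many types imply countable categoricity and homogeneity

  module _ {L : Language} {B : Set} (M : Structure L ℕ) (N : Structure L B) where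

    PartialElementary : Pred (List (ℕ × B)) 0ℓ
    PartialElementary l = ∀ φ → Satisfies M φ (proj₁ ∘ lookup l) → Satisfies N φ (proj₂ ∘ lookup l)

  module _ {L : Language} {B : Set} (B-code : B ↣ ℕ) (M : Structure L ℕ) (N : Structure L B)
           (finite : Types.FinitelyManyTypes M) (elementary : ∀ φ → M ⊨ φ → N ⊨ φ) where
    open Syntax {L}
    private
      module SM = Semantics M
      module SN = Semantics N
    open Types M

    -- That `χ` implies `φ` is, after universal closure, a sentence true in `M`, hence true in `N`.
    isolated : ∀ {n} (χ : Formula L n) {v} → Isolates χ v → ∀ φ {w} →
      Satisfies M φ v → Satisfies N χ w → Satisfies N φ w
    isolated χ {v} (_ , iso) φ {w} p = fwd (⊨-closure N (χ ⇒ φ))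
      (elementary (closure (χ ⇒ φ)) (bwd (⊨-closure M (χ ⇒ φ)) (λ u q → iso u q φ p))) w

    extend-pairs : ∀ l {a b} (χ : Formula L (suc (length l))) {v} → Isolates χ v → PartialElementary M N l →
      Satisfies M χ (extend M a (proj₁ ∘ lookup l)) → Satisfies N χ (extend N b (proj₂ ∘ lookup l)) →
      PartialElementary M N ((a , b) ∷ l)
    extend-pairs l χ {v} i@(_ , iso) r p q φ s =
      sat-cong N φ (λ { zero → refl ; (suc i) → refl })
        (isolated χ i φ (sameType-sym (iso _ p) φ
          (sat-cong M φ {w = extend M _ (proj₁ ∘ lookup l)} (λ { zero → refl ; (suc i) → refl }) s)) q)

    elementary-forth : ∀ {l a} → PartialElementary M N l → ⊤ → ∃[ b ] PartialElementary M N ((a , b) ∷ l)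
    elementary-forth {l} {a} r _ with isolating finite (extend M a (proj₁ ∘ lookup l))
    ... | χ , i@(p , _) with fwd (SN.sat-some {φ = χ} {proj₂ ∘ lookup l})
                               (r (some χ) (bwd (SM.sat-some {φ = χ}) (a , p)))
    ... | b , q = b , extend-pairs l χ i r p q

    -- It is a sentence of the theory of `M` that every tuple satisfies one of finitely many
    -- isolating formulas, so `N` realises no further types. The formula `χ` found in `N` is also
    -- witnessed over `l` in `M`, since otherwise the negation of `some χ` would transfer.
    elementary-back : ∀ {l b} → PartialElementary M N l → ⊤ → ∃[ a ] PartialElementary M N ((a , b) ∷ l)
    elementary-back {l} {b} r _ with fwd (SN.sat-⋁ {φs = χs} {v = extend N b (proj₂ ∘ lookup l)})
      (fwd (⊨-closure N (⋁ χs)) (elementary (closure (⋁ χs)) some-χ) (extend N b (proj₂ ∘ lookup l)))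
      where
      types = finite (suc (length l))

      χs : List (Formula L (suc (length l)))
      χs = List.map (proj₁ ∘ isolating finite) (proj₁ types)

      some-χ : M ⊨ closure (⋁ χs)
      some-χ = bwd (⊨-closure M (⋁ χs)) λ v → let u , u∈ , s = proj₂ types v in
        bwd (SM.sat-⋁ {φs = χs}) (_ , ∈-map⁺ _ u∈ , s (proj₁ (isolating finite u)) (proj₁ (proj₂ (isolating finite u))))
    ... | χ , χ∈ , q with ∈-map⁻ _ χ∈
    ... | u , _ , refl with fwd (SM.sat-some {φ = χ}) (byContradiction λ ¬p →
                              r (¬′ (some χ)) ¬p (bwd (SN.sat-some {φ = χ}) (b , q)))
    ... | a , p = a , extend-pairs l χ (proj₂ (isolating finite u)) r p q

    private module Extending (l₀ : List (ℕ × B)) (r₀ : PartialElementary M N l₀) where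
      open BackAndForth ℕ-code B-code (λ _ → ⊤) (λ _ → ⊤) (PartialElementary M N) elementary-forth elementary-back
      open Limit (l₀ , r₀) public

      Graph-elementary : ∀ {n} (φ : Formula L n) (z : Fin n → ℕ × B) → (∀ i → Graph (z i)) →
        Satisfies M φ (proj₁ ∘ z) → Satisfies N φ (proj₂ ∘ z)
      Graph-elementary φ z z∈ p with finite-part (All.tabulate⁺ z∈)
      ... | l , r , z⊆l = sat-cong N φ (λ i → cong proj₂ (sym (ρ-lookup i)))
          (fwd (SN.sat-rename φ) (r (rename ρ φ) (bwd (SM.sat-rename φ)
            (sat-cong M φ (λ i → cong proj₁ (ρ-lookup i)) p))))
        where
        ρ : Fin _ → Fin (length l)
        ρ i = Any.index (z⊆l (∈-tabulate⁺ i))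

        ρ-lookup : ∀ i → z i ≡ lookup l (ρ i)
        ρ-lookup i = lookup-index (z⊆l (∈-tabulate⁺ i))

      two : ∀ {A : Set} → A → A → Fin 2 → A
      two x y zero       = x
      two x y (suc zero) = y

      functional : ∀ {a b a′ b′} → Graph (a , b) → Graph (a′ , b′) → a ≡ a′ → b ≡ b′
      functional g g′ e = Graph-elementary (var zero ≈ₜ var (suc zero)) (two _ _)
        (λ { zero → g ; (suc zero) → g′ }) e

      injective : ∀ {a b a′ b′} → Graph (a , b) → Graph (a′ , b′) → b ≡ b′ → a ≡ a′
      injective g g′ e = byContradiction λ ¬e → Graph-elementary (¬′ (var zero ≈ₜ var (suc zero))) (two _ _)
        (λ { zero → g ; (suc zero) → g′ }) ¬e e

      to-B : ℕ → B
      to-B a = proj₁ (total {a} tt)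

      graph : ∀ a → Graph (a , to-B a)
      graph a = proj₂ (total {a} tt)

      h : ℕ ↔ B
      h = mk↔ₛ′ to-B (λ b → proj₁ (surjective {b} tt))
        (λ b → functional (graph _) (proj₂ (surjective {b} tt)) refl)
        (λ a → injective (proj₂ (surjective {to-B a} tt)) (graph a) refl)

      iso : IsIsomorphism M N h
      iso = record
        { fun = λ {k} f xs → sym (trans
            (cong (N.fun f) (sym (trans (SN.eval-vars suc)
              (trans (Vec.tabulate-∘ to-B (Vec.lookup xs)) (cong (Vec.map to-B) (Vec.tabulate∘lookup xs))))))
            (Graph-elementary (app f (tabulate (var ∘ suc)) ≈ₜ var zero) (pairs f xs) (pairs∈ f xs)
              (cong (M.fun f) (trans (SM.eval-vars suc) (Vec.tabulate∘lookup xs)))))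
        ; rel = λ R xs → mk⇔
            (λ p → subst (N.rel R) (seconds xs) (Graph-elementary (atom R (tabulate var)) (points xs) (λ i → graph _)
                     (subst (M.rel R) (sym (firsts xs)) p)))
            (λ q → byContradiction λ ¬p → Graph-elementary (¬′ atom R (tabulate var)) (points xs) (λ i → graph _)
                     (λ p → ¬p (subst (M.rel R) (firsts xs) p)) (subst (N.rel R) (sym (seconds xs)) q))
        }
        where
        module M = Structure M
        module N = Structure N

        points : ∀ {k} → Vec ℕ k → Fin k → ℕ × B
        points xs i = Vec.lookup xs i , to-B (Vec.lookup xs i)

        firsts : ∀ {k} (xs : Vec ℕ k) → ⟦_⟧* M (tabulate var) (proj₁ ∘ points xs) ≡ xs
        firsts xs = trans (SM.eval-vars id) (Vec.tabulate∘lookup xs)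

        seconds : ∀ {k} (xs : Vec ℕ k) → ⟦_⟧* N (tabulate var) (proj₂ ∘ points xs) ≡ Vec.map to-B xs
        seconds xs = trans (SN.eval-vars id)
          (trans (Vec.tabulate-∘ to-B (Vec.lookup xs)) (cong (Vec.map to-B) (Vec.tabulate∘lookup xs)))

        pairs : ∀ {k} → Language.Function L k → Vec ℕ k → Fin (suc k) → ℕ × B
        pairs f xs zero    = M.fun f xs , to-B (M.fun f xs)
        pairs f xs (suc i) = points xs i

        pairs∈ : ∀ {k} (f : Language.Function L k) xs i → Graph (pairs f xs i)
        pairs∈ f xs zero    = graph _
        pairs∈ f xs (suc i) = graph _

    abstract
      -- With `N` equal to `M` this is homogeneity; with `l₀` empty it is countable categoricity.
      isomorphism-extending : ∀ {l₀} → PartialElementary M N l₀ →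
        ∃[ h ] IsIsomorphism M N h × (∀ {a b} → (a , b) ∈ l₀ → Inverse.to h a ≡ b)
      isomorphism-extending {l₀} r₀ = h , iso , λ z∈ → functional (graph _) (start⊆Graph z∈) refl
        where open Extending l₀ r₀

  -- Permutation groups and orbits of tuples

  open Inverse using (to; from; strictlyInverseˡ; strictlyInverseʳ)
  open Group Sym using (_∙_; ε; _⁻¹)

  Tuple Tuples : Set
  Tuple  = List ℕ
  Tuples = List Tuple

  infixr 6 _·_ _··_

  _·_ : Perm → Tuple → Tuple
  g · u = map (to g) u

  _··_ : Perm → Tuples → Tuples
  g ·· us = map (g ·_) us

  ∙-· : ∀ g h u → (g ∙ h) · u ≡ g · h · u
  ∙-· g h = map-∘

  ε-· : ∀ u → ε · u ≡ u
  ε-· = map-id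

  ⁻¹-· : ∀ g {u v} → g · u ≡ v → g ⁻¹ · v ≡ u
  ⁻¹-· g {u} refl = trans (sym (map-∘ u)) (trans (map-cong (strictlyInverseʳ g) u) (map-id u))

  ·-cong-∈ : ∀ g h u → (∀ {x} → x ∈ u → to g x ≡ to h x) → g · u ≡ h · u
  ·-cong-∈ g h []      e = refl
  ·-cong-∈ g h (x ∷ u) e = cong₂ _∷_ (e (here refl)) (·-cong-∈ g h u (e ∘ there))

  ·-∈ : ∀ g h u → g · u ≡ h · u → ∀ {x} → x ∈ u → to g x ≡ to h x
  ·-∈ g h (y ∷ u) e (here refl) = proj₁ (∷-injective e)
  ·-∈ g h (y ∷ u) e (there x∈)  = ·-∈ g h u (proj₂ (∷-injective e)) x∈

  fixes-∈ : ∀ g u → g · u ≡ u → ∀ {x} → x ∈ u → to g x ≡ x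
  fixes-∈ g u e = ·-∈ g ε u (trans e (sym (ε-· u)))

  ∈-fixes : ∀ g u → (∀ {x} → x ∈ u → to g x ≡ x) → g · u ≡ u
  ∈-fixes g u e = trans (·-cong-∈ g ε u e) (ε-· u)

  ∙-·· : ∀ g h us → (g ∙ h) ·· us ≡ g ·· h ·· us
  ∙-·· g h us = trans (map-cong (∙-· g h) us) (map-∘ us)

  ⁻¹-·· : ∀ g {us vs} → g ·· us ≡ vs → g ⁻¹ ·· vs ≡ us
  ⁻¹-·· g {us} refl = trans (sym (map-∘ us)) (trans (map-cong (λ u → ⁻¹-· g refl) us) (map-id us))

  module _ (G : Pred Perm 0ℓ) where

    -- For fixed tuples this says that `G` meets an open set of permutations, so as a condition on a
    -- closed subgroup it is a generator of the Effros structure.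
    Orbit : Tuples → Tuples → Set
    Orbit us vs = ∃[ g ] G g × g ·· us ≡ vs

    infix 4 _~_
    _~_ : Tuple → Tuple → Set
    u ~ v = Orbit (u ∷ []) (v ∷ [])

    Oligomorphic : Set
    Oligomorphic = ∀ n → Σ[ us ∈ Tuples ] (∀ v → length v ≡ n → ∃[ u ] u ∈ us × u ~ v)

  module _ {G : Pred Perm 0ℓ} where

    ~-intro : ∀ {g} → G g → ∀ u → _~_ G u (g · u)
    ~-intro {g} g∈ u = g , g∈ , refl

    ~-elim : ∀ {u v} → _~_ G u v → ∃[ g ] G g × g · u ≡ v
    ~-elim (g , g∈ , e) = g , g∈ , proj₁ (∷-injective e)

    ~-length : ∀ {u v} → _~_ G u v → length u ≡ length v
    ~-length {u} p with g , _ , refl ← ~-elim p = sym (length-map (to g) u)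

    -- Oligomorphy counts orbits on tuples of points; through concatenation it also counts orbits on
    -- tuples of tuples of prescribed lengths.
    Orbit-concat : ∀ {us vs} → map length us ≡ map length vs → _~_ G (concat us) (concat vs) → Orbit G us vs
    Orbit-concat {us} {vs} same p with ~-elim p
    ... | g , g∈ , e = g , g∈ , go us vs same e
      where
      go : ∀ us vs → map length us ≡ map length vs → g · concat us ≡ concat vs → g ·· us ≡ vs
      go [] [] _ _ = refl
      go (u ∷ us) (v ∷ vs) same e with l , same′ ← ∷-injective same
        with ++-split (g · u) v (trans (length-map (to g) u) l) (trans (sym (map-++ (to g) u (concat us))) e)
      ... | refl , e′ = cong (_ ∷_) (go us vs same′ e′)

    module Laws (isSubgroup : IsSubgroup G) where
      open IsSubgroup isSubgroup

      Orbit-refl : ∀ us → Orbit G us us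
      Orbit-refl us = ε , ε-closed , trans (map-cong ε-· us) (map-id us)

      Orbit-sym : ∀ {us vs} → Orbit G us vs → Orbit G vs us
      Orbit-sym (g , g∈ , e) = g ⁻¹ , ⁻¹-closed g∈ , ⁻¹-·· g e

      Orbit-trans : ∀ {us vs ws} → Orbit G us vs → Orbit G vs ws → Orbit G us ws
      Orbit-trans {us} (g , g∈ , refl) (h , h∈ , refl) = h ∙ g , ∙-closed h∈ g∈ , ∙-·· h g us

      -- The tuples supplied by oligomorphy need not come from `P`; each is exchanged for an element
      -- of `P` in its orbit, where there is one.
      orbit-representatives : Oligomorphic G → ∀ {a ℓ} {A : Set a} (f : A → Tuple) (P : Pred A ℓ) n →
        (∀ {x} → P x → length (f x) ≡ n) →
        Σ[ xs ∈ List A ] (∀ {x} → x ∈ xs → P x) × (∀ {x} → P x → ∃[ y ] y ∈ xs × P y × _~_ G (f y) (f x))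
      orbit-representatives oligo f P n len =
        let us , cover = oligo n
            xs , _ , sound , complete = representatives (λ u x → P x × _~_ G u (f x)) us
        in xs , (λ x∈ → let _ , _ , p , _ = sound x∈ in p) , λ {x} p →
          let u , u∈ , u~x = cover (f x) (len p)
              y , y∈ , q , u~y = complete u∈ (p , u~x)
          in y , y∈ , q , Orbit-trans (Orbit-sym u~y) u~x

  closed-approximation : (G : ClosedSubgroup) → ∀ {g} →
    (∀ A → ∃[ h ] ClosedSubgroup.member G h × h · A ≡ g · A) → ClosedSubgroup.member G g
  closed-approximation G {g} approximate = byContradiction λ g∉ →
    let A , outside = ClosedSubgroup.closed G g∉
        h , h∈ , e = approximate A
    in outside {h} (·-∈ h g A e) h∈

  -- The theorem of Ryll-Nardzewski

  open ClosedSubgroup using (member)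

  WeakElimination-resp : ∀ {G G′} → G ≐ G′ → WeakElimination G → WeakElimination G′
  WeakElimination-resp {G} {G′} (G⊆ , ⊇G) we H H-subgroup H⊆ (A , A⊆)
    with we H H-subgroup (⊇G ∘ H⊆) (A , λ (g∈ , fix) → A⊆ (G⊆ g∈ , fix))
  ... | K , (K-supports , K-least) , _ = K , (G⇒G′ K-supports , least′) , λ (s , l) {x} →
      mk⇔ (λ x∈ → least′ s x∈) (λ x∈ → l (G⇒G′ K-supports) x∈)
    where
    transport : ∀ {G G′ : Pred Perm 0ℓ} {K} → G ≐ G′ → Supports G H K → Supports G′ H K
    transport (⊆ , ⊇) (closed , lower , upper) =
        (λ (orbit , o) → closed (orbit , λ (g∈ , fix) → o (⊆ g∈ , fix)))
      , (λ (g∈ , fix) → lower (⊇ g∈ , fix))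
      , λ h∈ → let g∈ , stab = upper h∈ in ⊆ g∈ , stab

    G⇒G′ : ∀ {K} → Supports G H K → Supports G′ H K
    G⇒G′ = transport (G⊆ , ⊇G)

    least′ : ∀ {K′} → Supports G′ H K′ → K List.⊆ K′
    least′ s = K-least (transport (⊇G , G⊆) s)

  Oligomorphic-resp : ∀ {G G′} → G ⊆ G′ → Oligomorphic G → Oligomorphic G′
  Oligomorphic-resp ⊆ oligo n = let us , cover = oligo n in us , λ v l →
    let u , u∈ , g , g∈ , e = cover v l in u , u∈ , g , ⊆ g∈ , e

  module _ {L : Language} (codes : Countable L) (M : Structure L ℕ) where
    open Syntax {L}

    -- There are finitely many types, and by homogeneity tuples of the same type are conjugate under
    -- an automorphism.
    categorical⇒oligomorphic : IsωCategorical M → Oligomorphic (Aut M)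
    categorical⇒oligomorphic categorical n = List.map List.tabulate us , cover
      where
      finite = finitelyManyTypes codes M categorical
      us = proj₁ (finite n)

      cover : ∀ v → length v ≡ n → ∃[ u ] u ∈ List.map List.tabulate us × _~_ (Aut M) u v
      cover v refl with proj₂ (finite n) (lookup v)
      ... | u , u∈ , same = _ , ∈-map⁺ List.tabulate u∈ , h , iso , cong List.[_]
          (trans (map-tabulate u (to h))
            (trans (tabulate-cong (λ i → extends (∈-tabulate⁺ i))) (tabulate-lookup v)))
        where
        z : Fin n → ℕ × ℕ
        z i = u i , lookup v i

        σ : ∀ p → ∃[ i ] lookup (List.tabulate z) p ≡ z i
        σ p = ∈-tabulate⁻ (∈-lookup {xs = List.tabulate z} p)

        partial : PartialElementary M M (List.tabulate z)
        partial φ p = sat-cong M φ (λ j → cong proj₂ (sym (proj₂ (σ j))))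
          (fwd (sat-rename φ) (same (rename (proj₁ ∘ σ) φ)
            (bwd (sat-rename φ) (sat-cong M φ (λ j → cong proj₁ (proj₂ (σ j))) p))))
          where open Semantics M using (sat-rename)

        extension = isomorphism-extending ℕ-code M M finite (λ _ → id) partial
        h = proj₁ extension
        iso = proj₁ (proj₂ extension)
        extends = proj₂ (proj₂ extension)

  -- The canonical structure of an oligomorphic group

  module Canonical (G : ClosedSubgroup) (oligomorphic : Oligomorphic (member G)) where
    open IsSubgroup (ClosedSubgroup.isSubgroup G)
    open Laws (ClosedSubgroup.isSubgroup G)

    -- The relation symbols are the tuples themselves; the symbol `t` is going to denote the orbit
    -- of `t`.
    language : Language
    language = record { Function = λ _ → Empty.⊥ ; Relation = Vec ℕ }

    countable : Countable language
    countable = mk↣ {to = λ ()} (λ { {_ , ()} }) , Σ-code (λ n → Vec-code ℕ-code)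

    structure : Structure language ℕ
    structure = record
      { fun = λ ()
      ; rel = λ t xs → ∃[ g ] member G g × Vec.map (to g) t ≡ xs
      }

    open Syntax {language}
    open Types structure

    G⊆Aut : member G ⊆ Aut structure
    G⊆Aut {g} g∈ = record
      { fun = λ ()
      ; rel = λ t xs → mk⇔
          (λ { (h , h∈ , refl) → _ , ∙-closed g∈ h∈ , Vec.map-∘ (to g) (to h) t })
          (λ (h , h∈ , e) → _ , ∙-closed (⁻¹-closed g∈) h∈ , trans (Vec.map-∘ (from g) (to h) t)
            (trans (cong (Vec.map (from g)) e)
              (trans (sym (Vec.map-∘ (from g) (to g) xs))
                (trans (Vec.map-cong (strictlyInverseʳ g) xs) (Vec.map-id xs)))))
      }

    -- The relation named by `A` holds at `A`, hence at `h · A`. So some element of `G` agrees with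
    -- `h` on `A`, and `G` is closed.
    Aut⊆G : Aut structure ⊆ member G
    Aut⊆G {h} aut = closed-approximation G λ A →
      let t = Vec.fromList A
          g , g∈ , e = fwd (IsIsomorphism.rel aut t t) (_ , ε-closed , Vec.map-id t)
      in g , g∈ , lists g h A e
      where
      lists : ∀ g h A → Vec.map (to g) (Vec.fromList A) ≡ Vec.map (to h) (Vec.fromList A) → g · A ≡ h · A
      lists g h [] e      = refl
      lists g h (x ∷ A) e = cong₂ _∷_ (Vec.∷-injectiveˡ e) (lists g h A (Vec.∷-injectiveʳ e))

    finite : FinitelyManyTypes
    finite n = let us , _ , cover = orbit-representatives oligomorphic
                                  List.tabulate (λ _ → ⊤) n (λ {v} _ → length-tabulate v) in
      us , λ v → let u , u∈ , _ , p = cover {v} tt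
                     g , g∈ , e = ~-elim p
                 in u , u∈ , λ φ q → sat-cong structure φ
                   (pointwise-≡ (trans (sym (map-tabulate u (to g))) e))
                   (fwd (iso-sat (G⊆Aut g∈) φ) q)
      where
      pointwise-≡ : ∀ {n} {u v : Fin n → ℕ} → List.tabulate u ≡ List.tabulate v → u ≗ v
      pointwise-≡ {suc n} e zero    = ∷-injectiveˡ e
      pointwise-≡ {suc n} e (suc i) = pointwise-≡ (∷-injectiveʳ e) i

    categorical : IsωCategorical structure
    categorical B-code N elementary =
      let h , iso , _ = isomorphism-extending B-code structure N finite elementary {[]}
            (λ φ p → sat-cong N φ (λ ()) (elementary φ (sat-cong structure φ (λ ()) p)))
      in h , iso

  𝒲⇒ : ∀ G → 𝒲 G → Oligomorphic (member G) × WeakElimination (member G)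
  𝒲⇒ G (L , countable , M , categorical , weak , G≐) =
    Oligomorphic-resp (proj₂ G≐) (categorical⇒oligomorphic countable M categorical) ,
    WeakElimination-resp (≐-sym G≐) weak

  ⇒𝒲 : ∀ G → Oligomorphic (member G) → WeakElimination (member G) → 𝒲 G
  ⇒𝒲 G oligomorphic weak = language , countable , structure , categorical ,
    WeakElimination-resp (G⊆Aut , Aut⊆G) weak , G⊆Aut , Aut⊆G
    where open Canonical G oligomorphic

  -- Cantor space and Borel maps

  -- The Cantor space, with d(x,y) = max {1/(i+1) | x i ≢ y i}

  Cantor : Setoid 0ℓ 0ℓ
  Cantor = ℕ →-setoid Bool

  radius : ℕ → ℚ
  radius n = mkℚ (ℤ.+ 1) n (1-coprimeTo (suc n))

  radius-positive : ∀ n → 0ℚ ℚ.< radius n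
  radius-positive n = *<* (+<+ (s≤s z≤n))

  radius-antitone : ∀ {m n} → m ≤ n → radius n ℚ.≤ radius m
  radius-antitone m≤n = *≤* (+≤+ (+-monoˡ-≤ 0 (s≤s m≤n)))

  radius-small : ∀ {ε} → 0ℚ ℚ.< ε → ∃[ n ] radius n ℚ.< ε
  -- A number (k + 1)/(d + 1) exceeds 1/(d + 2).
  radius-small {mkℚ (ℤ.+ suc k) d _} _ = suc d , *<* (+<+ (s≤s (begin
    suc (d + 0)                  ≡⟨ cong suc (+-identityʳ d) ⟩
    suc d                        ≤⟨ m≤m+n (suc d) (k * suc (suc d)) ⟩
    suc d + k * suc (suc d)      ∎)))
    where open ≤-Reasoning
  radius-small {mkℚ (ℤ.+ 0) d _} (*<* (+<+ ()))
  radius-small {mkℚ ℤ.-[1+ k ] d _} (*<* ())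

  radius<2 : ∀ n → radius n ℚ.< mkℚ (ℤ.+ 2) 0 (λ { (_ , d) → ∣1⇒≡1 d })
  radius<2 n = ℚ.≤-<-trans (radius-antitone z≤n) (*<* (+<+ (s≤s (s≤s z≤n))))

  cantorMetric : Metric Cantor
  cantorMetric = record
    { Near      = Near
    ; monotone  = λ δ<ε (0<δ , near) → ℚ.<-trans 0<δ δ<ε , λ i d → ℚ.<-trans (near i d) δ<ε
    ; rounded   = rounded
    ; finite    = λ x y → _ , ℚ.<-trans (radius-positive 0) (radius<2 0) , λ i _ → radius<2 i
    ; positive  = proj₁
    ; zero-≈    = λ x≗y 0<ε → 0<ε , λ i d → ⊥-elim (d (x≗y i))
    ; separated = λ {x} {y} near i → near-agree (near (radius-positive i)) ≤-refl
    ; symmetric = λ (0<ε , near) → 0<ε , λ i d → near i (d ∘ sym)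
    ; triangle  = triangle
    }
    where
    Near : ℚ → (x y : ℕ → Bool) → Set
    Near ε x y = 0ℚ ℚ.< ε × (∀ i → x i ≢ y i → radius i ℚ.< ε)

    near-agree : ∀ {n x y} → Near (radius n) x y → ∀ {i} → i ≤ n → x i ≡ y i
    near-agree (_ , near) {i} i≤n = byContradiction λ d →
      ℚ.<-irrefl refl (ℚ.<-≤-trans (near i d) (radius-antitone i≤n))

    rounded : ∀ {ε x y} → Near ε x y → ∃[ δ ] δ ℚ.< ε × Near δ x y
    rounded {ε} {x} {y} (0<ε , near) with dec (∃ λ i → x i ≢ y i)
    ... | no same = let δ , 0<δ , δ<ε = ℚ.<-dense 0<ε in
      δ , δ<ε , 0<δ , λ i d → ⊥-elim (same (i , d))
    -- Radii decrease, so the first difference has the largest radius and is the only one that has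
    -- to be kept below the new bound.
    ... | yes differ =
      let i , d , first = least (λ i → x i ≢ y i) differ
          δ , i<δ , δ<ε = ℚ.<-dense (near i d)
      in δ , δ<ε , ℚ.<-trans (radius-positive i) i<δ
           , λ j d → ℚ.≤-<-trans (radius-antitone (first d)) i<δ

    <-+ : ∀ {δ ε} → 0ℚ ℚ.< ε → δ ℚ.< δ ℚ.+ ε
    <-+ {δ} {ε} 0<ε = subst (ℚ._< δ ℚ.+ ε) (ℚ.+-identityʳ δ) (ℚ.+-monoʳ-< δ 0<ε)

    triangle : ∀ {δ ε x y z} → Near δ x y → Near ε y z → Near (δ ℚ.+ ε) x z
    triangle {δ} {ε} {x} {y} {z} (0<δ , p) (0<ε , q) = ℚ.<-trans 0<δ (<-+ 0<ε) , bound
      where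
      bound : ∀ i → x i ≢ z i → radius i ℚ.< δ ℚ.+ ε
      bound i d with x i Bool.≟ y i
      ... | no d′ = ℚ.<-trans (p i d′) (<-+ 0<ε)
      ... | yes e = ℚ.<-trans (q i (d ∘ trans e))
        (subst (ε ℚ.<_) (ℚ.+-comm ε δ) (<-+ 0<δ))

  open Metric cantorMetric using (Near; Complete; Separable) renaming (Open to CantorOpen)

  agree-near : ∀ {n x y ε} → radius n ℚ.< ε → (∀ i → i < n → x i ≡ y i) → Near ε x y
  agree-near {n} r<ε agree = ℚ.<-trans (radius-positive n) r<ε , λ i d →
    ℚ.≤-<-trans (radius-antitone (≮⇒≥ λ i<n → d (agree i i<n))) r<ε

  cantor-complete : Complete
  cantor-complete s cauchy = (λ i → s (N i) i) , converges
    where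
    N : ℕ → ℕ
    N i = proj₁ (cauchy (radius-positive i))

    N-agree : ∀ {n i j k} → i ≥ N n → j ≥ N n → k ≤ n → s i k ≡ s j k
    N-agree {n} {k = k} i≥ j≥ k≤n = byContradiction λ d →
      ℚ.<-irrefl refl (ℚ.<-≤-trans (proj₂ (proj₂ (cauchy (radius-positive n)) i≥ j≥) k d) (radius-antitone k≤n))

    converges : Metric._ConvergesTo_ cantorMetric s (λ i → s (N i) i)
    converges 0<ε with radius-small 0<ε
    ... | n , r<ε = N n , λ i≥N → agree-near r<ε λ k k<n →
      trans (N-agree i≥N (m≤m⊔n (N n) (N k)) (<⇒≤ k<n)) (N-agree (m≤n⊔m (N n) (N k)) ≤-refl ≤-refl)

  pad : List Bool → ℕ → Bool
  pad []       _       = false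
  pad (b ∷ bs) zero    = b
  pad (b ∷ bs) (suc i) = pad bs i

  pad-applyUpTo : ∀ x n {i} → i < n → pad (applyUpTo x n) i ≡ x i
  pad-applyUpTo x (suc n) {zero}  _         = refl
  pad-applyUpTo x (suc n) {suc i} (s≤s i<n) = pad-applyUpTo (x ∘ suc) n i<n

  Bool-code : Bool ↣ ℕ
  Bool-code = mk↣ {to = λ { true → 1 ; false → 0 }}
    λ { {true} {true} _ → refl ; {false} {false} _ → refl }

  cantor-separable : Separable
  cantor-separable = (λ n → just (pad (word n))) , λ x 0<ε →
    let n , r<ε = radius-small 0<ε
        w = applyUpTo x n
    in code words w , pad w , cong (just ∘ pad) (decode-code words [] w)
       , agree-near r<ε λ i i<n → sym (pad-applyUpTo x n i<n)
    where
    words = List-code Bool-code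
    word = decode words []

  cantorSpace : MeasurableSpace 0ℓ 0ℓ (lsuc 0ℓ)
  cantorSpace = generatedSpace Cantor CantorOpen λ open-U x≗y x∈U →
    let ε , 0<ε , ball = open-U x∈U in ball (Metric.zero-≈ cantorMetric x≗y 0<ε)

  cantor-standard : IsStandardBorel cantorSpace
  cantor-standard = cantorMetric , cantor-complete , cantor-separable , λ S → mk⇔ id id

  -- Borel conditions on closed subgroups

  Borel : Pred (Pred ClosedSubgroup 0ℓ) (lsuc 0ℓ)
  Borel = MeasurableSpace.Measurable effros

  private variable
    P Q : Pred ClosedSubgroup 0ℓ

  borel-orbit : ∀ us vs → Borel (λ G → Orbit (member G) us vs)
  borel-orbit us vs = gen (hits {λ g → g ·· us ≡ vs} λ {g} e →
    List.concat us , λ {h} same → trans (move us h g same) e)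
    where
    move : ∀ us h g → h ≈[ concat us ] g → h ·· us ≡ g ·· us
    move []       h g same = refl
    move (u ∷ us) h g same = cong₂ _∷_ (·-cong-∈ h g u (same ∘ ∈-++⁺ˡ))
                                       (move us h g (same ∘ ∈-++⁺ʳ u))

  -- Excluded middle makes a condition that does not mention the group either the whole space or
  -- empty, however complicated it is.
  borel-const : (A : Set) → Borel (λ _ → A)
  borel-const A with dec A
  ... | yes a = gen-≐ ((λ _ → a) , λ _ ()) (gen-∁ gen-∅)
  ... | no ¬a = gen-≐ ((λ ()) , ¬a) gen-∅

  borel-¬ : Borel P → Borel (λ G → ¬ P G)
  borel-¬ = gen-∁

  borel-∃ : {A : Set} (i : A ↣ ℕ) (default : A) {P : A → Pred ClosedSubgroup 0ℓ} →
    (∀ x → Borel (P x)) → Borel (λ G → ∃[ x ] P x G)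
  borel-∃ i default {P} b = gen-≐
    ((λ (n , p) → decode i default n , p)
    , λ {G} (x , p) → code i x , subst (λ y → P y G) (sym (decode-code i default x)) p)
    (gen-⋃ (λ n → b (decode i default n)))

  borel-∀ : {A : Set} (i : A ↣ ℕ) (default : A) {P : A → Pred ClosedSubgroup 0ℓ} →
    (∀ x → Borel (P x)) → Borel (λ G → ∀ x → P x G)
  borel-∀ i default b = gen-≐
    ((λ ¬∃¬ x → byContradiction λ ¬p → ¬∃¬ (x , ¬p)) , λ p (x , ¬p) → ¬p (p x))
    (gen-∁ (borel-∃ i default (gen-∁ ∘ b)))

  borel-⊎ : Borel P → Borel Q → Borel (λ G → P G ⊎ Q G)
  borel-⊎ {P} {Q} p q = gen-≐
    ((λ { (zero , x) → inj₁ x ; (suc n , x) → inj₂ x }) , [ (0 ,_) , (1 ,_) ]′)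
    (gen-⋃ {S = λ { zero → P ; (suc _) → Q }} λ { zero → p ; (suc _) → q })

  borel-→ : Borel P → Borel Q → Borel (λ G → P G → Q G)
  borel-→ p q = gen-≐
    ( [ (λ ¬p x → ⊥-elim (¬p x)) , (λ y _ → y) ]′
    , λ f → byContradiction λ none → none (inj₁ λ x → none (inj₂ (f x))))
    (borel-⊎ (borel-¬ p) q)

  borel-× : Borel P → Borel Q → Borel (λ G → P G × Q G)
  borel-× p q = gen-≐
    ((λ none → byContradiction (none ∘ inj₁) , byContradiction (none ∘ inj₂))
    , λ (x , y) → [ (λ ¬p → ¬p x) , (λ ¬q → ¬q y) ]′)
    (borel-¬ (borel-⊎ (borel-¬ p) (borel-¬ q)))

  borel-⇔ : Borel P → Borel Q → Borel (λ G → P G ⇔ Q G)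
  borel-⇔ p q = gen-≐
    ((λ (f , g) → mk⇔ f g) , λ e → Equivalence.to e , Equivalence.from e)
    (borel-× (borel-→ p q) (borel-→ q p))

  -- Countably many Borel conditions as a Borel map to Cantor space

  module Invariant {b} (W : Pred ClosedSubgroup b) (Φ : ℕ → Pred ClosedSubgroup 0ℓ) (borel-Φ : ∀ n → Borel (Φ n)) where

    bits : ClosedSubgroup → ℕ → Bool
    bits G n = does (dec (Φ n G))

    bits-cong : ∀ {G H} → (∀ n → Φ n G ⇔ Φ n H) → bits G ≗ bits H
    bits-cong {G} {H} e n with dec (Φ n G) | dec (Φ n H)
    ... | yes _ | yes _ = refl
    ... | no _  | no _  = refl
    ... | yes p | no ¬q = ⊥-elim (¬q (Equivalence.to (e n) p))
    ... | no ¬p | yes q = ⊥-elim (¬p (Equivalence.from (e n) q))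

    bits-reflect : ∀ {G H} → bits G ≗ bits H → ∀ n → Φ n G → Φ n H
    bits-reflect {G} {H} e n p with dec (Φ n G) | dec (Φ n H) | e n
    ... | yes _ | yes q | _ = q
    ... | yes _ | no _  | ()
    ... | no ¬p | _     | _ = ⊥-elim (¬p p)

    borel-bit : ∀ n b → Borel (λ G → bits G n ≡ b)
    borel-bit n true = gen-≐ (bit-true , true-bit) (borel-Φ n)
      where
      bit-true : ∀ {G} → Φ n G → bits G n ≡ true
      bit-true {G} p with dec (Φ n G)
      ... | yes _ = refl
      ... | no ¬p = ⊥-elim (¬p p)
      true-bit : ∀ {G} → bits G n ≡ true → Φ n G
      true-bit {G} e with dec (Φ n G)
      ... | yes p = p
    borel-bit n false = gen-≐ (Bool.¬-not , λ { e e′ → false≢true (trans (sym e) e′) })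
      (borel-¬ (borel-bit n true))
      where
      false≢true : false ≢ true
      false≢true ()

    -- An open set is the union of the cylinders inside it. There are countably many, coded by
    -- finite words, and each constrains finitely many bits.
    borel-preimage : ∀ {S} → Generated CantorOpen S → Borel (S ∘ bits)
    borel-preimage (gen {U} open-U) = gen-≐ (inside , outside)
      (borel-∃ (×-code ℕ-code (List-code Bool-code)) (0 , [])
        {λ (n , w) G → (∀ x → (∀ i → i < n → pad w i ≡ x i) → U x) × (∀ i → i < n → bits G i ≡ pad w i)}
        λ (n , w) → borel-× (borel-const _)
          (borel-∀ ℕ-code 0 λ i → borel-→ (borel-const _) (borel-bit i (pad w i))))
      where
      inside : ∀ {G} → (∃ λ ((n , w) : ℕ × List Bool) →
        (∀ x → (∀ i → i < n → pad w i ≡ x i) → U x) × (∀ i → i < n → bits G i ≡ pad w i)) → U (bits G)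
      inside (_ , cylinder⊆U , agree) = cylinder⊆U _ λ i i<n → sym (agree i i<n)

      outside : ∀ {G} → U (bits G) → ∃ λ ((n , w) : ℕ × List Bool) →
        (∀ x → (∀ i → i < n → pad w i ≡ x i) → U x) × (∀ i → i < n → bits G i ≡ pad w i)
      outside {G} u with open-U u
      ... | ε , 0<ε , ball with radius-small 0<ε
      ... | n , r<ε = (n , applyUpTo (bits G) n)
        , (λ x agree → ball (agree-near r<ε λ i i<n →
            trans (sym (pad-applyUpTo (bits G) n i<n)) (agree i i<n)))
        , λ i i<n → sym (pad-applyUpTo (bits G) n i<n)
    borel-preimage (gen-≐ (p , q) s) = gen-≐ (p , q) (borel-preimage s)
    borel-preimage gen-∅ = gen-∅
    borel-preimage (gen-∁ s) = gen-∁ (borel-preimage s)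
    borel-preimage (gen-⋃ s) = gen-⋃ (borel-preimage ∘ s)

    borelMap : BorelMap (subspace effros W) cantorSpace
    borelMap = record
      { func  = record
        { to   = bits ∘ proj₁
        ; cong = λ {(G , _)} {(H , _)} e → bits-cong λ n →
            mk⇔ (MeasurableSpace.respects effros (borel-Φ n) e)
                (MeasurableSpace.respects effros (borel-Φ n) (proj₂ e , proj₁ e))
        }
      ; borel = λ {S} s → (S ∘ bits) , borel-preimage s , id , id
      }

  -- Weak elimination of imaginaries is Borel

  open ClosedSubgroup using (member; isSubgroup)

  Tuple-code : Tuple ↣ ℕ
  Tuple-code = List-code ℕ-code

  Tuples-code : Tuples ↣ ℕ
  Tuples-code = List-code Tuple-code

  borel-∃-tuple : {P : Tuple → Pred ClosedSubgroup 0ℓ} → (∀ u → Borel (P u)) → Borel (λ G → ∃[ u ] P u G)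
  borel-∃-tuple = borel-∃ Tuple-code []

  borel-∃-tuples : {P : Tuples → Pred ClosedSubgroup 0ℓ} → (∀ u → Borel (P u)) → Borel (λ G → ∃[ u ] P u G)
  borel-∃-tuples = borel-∃ Tuples-code []

  borel-∀-ℕ : {P : ℕ → Pred ClosedSubgroup 0ℓ} → (∀ n → Borel (P n)) → Borel (λ G → ∀ n → P n G)
  borel-∀-ℕ = borel-∀ ℕ-code 0

  borel-∀-tuple : {P : Tuple → Pred ClosedSubgroup 0ℓ} → (∀ u → Borel (P u)) → Borel (λ G → ∀ u → P u G)
  borel-∀-tuple = borel-∀ Tuple-code []

  borel-∀-tuples : {P : Tuples → Pred ClosedSubgroup 0ℓ} → (∀ u → Borel (P u)) → Borel (λ G → ∀ u → P u G)
  borel-∀-tuples = borel-∀ Tuples-code []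

  borel-oligomorphic : Borel (λ G → Oligomorphic (member G))
  borel-oligomorphic = borel-∀-ℕ λ n → borel-∃-tuples λ us → borel-∀-tuple λ v →
    borel-→ (borel-const _) (borel-∃-tuple λ u → borel-× (borel-const _) (borel-orbit _ _))

  module _ (G : Pred Perm 0ℓ) where

    OverOrbit : Tuple → Tuple → Tuple → Set
    OverOrbit A u v = Orbit G (A ∷ u ∷ []) (A ∷ v ∷ [])

    -- Quantifying over the images `y` instead of over group elements brings algebraicity into Borel
    -- form.
    Algebraic⇔ : ∀ A x → Algebraic G A x ⇔
      (Σ[ orbit ∈ List ℕ ] (∀ y → OverOrbit A (x ∷ []) (y ∷ []) → y ∈ orbit))
    Algebraic⇔ A x = mk⇔
      (λ (orbit , o) → orbit , λ { y (g , g∈ , e) → let p , q = ∷-injective e in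
        subst (_∈ orbit) (∷-injectiveˡ (∷-injectiveˡ q)) (o (g∈ , fixes-∈ g A p)) })
      (λ (orbit , o) → orbit , λ {g} (g∈ , fix) →
        o (to g x) (g , g∈ , cong (_∷ _) (∈-fixes g A fix)))

    module _ (A : Tuple) (c : Tuples) where

      Meets : Tuple → Set
      Meets u = ∃[ b ] b ∈ c × OverOrbit A b u

      -- An open subgroup H ⊇ G_(A) is a finite union of double cosets of
      -- G_(A); the tuples in c are the images of A under representatives.
      Coded : Pred Perm 0ℓ
      Coded g = G g × Meets (g · A)

      -- The subgroup axioms read off from images of `A`. In the product clause `u`, `v`, `w` are
      -- gA, hA and ghA; in the inverse clause `u` is gA and `w` is the image of `A` under the
      -- inverse of g.
      CodesSubgroup : Set
      CodesSubgroup = Meets A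
        × (∀ u v w → Meets u → Meets v → _~_ G A v → Orbit G (A ∷ v ∷ []) (u ∷ w ∷ []) → Meets w)
        × (∀ u w → Meets u → Orbit G (w ∷ A ∷ []) (A ∷ u ∷ []) → Meets w)

      -- In the last clause `u` and `K′` are the images of `A` and `K` under one element of the
      -- coded group, so that stabilising `K` setwise becomes an equality of sets.
      CodesSupport : Tuple → Set
      CodesSupport K =
          AlgebraicallyClosed G K
        × (∀ u → OverOrbit K A u → Meets u)
        × (∀ u K′ → Meets u → Orbit G (A ∷ K ∷ []) (u ∷ K′ ∷ []) → K List.⊆ K′ × K′ List.⊆ K)

    -- The codes are countable in number and the statement lies in `Set`, unlike one about all
    -- predicates `H`. Uniqueness of `K` up to set equality is recovered from minimality.
    CodedWeakElimination : Set
    CodedWeakElimination = ∀ A c → IsSubgroup (Coded A c) →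
      ∃[ K ] Supports G (Coded A c) K × (∀ K′ → Supports G (Coded A c) K′ → K List.⊆ K′)

  module _ {G : Pred Perm 0ℓ} (isSubgroup : IsSubgroup G) (A : Tuple) (c : Tuples) where
    open IsSubgroup isSubgroup

    subgroup⇔ : IsSubgroup (Coded G A c) ⇔ CodesSubgroup G A c
    subgroup⇔ = mk⇔
      (λ H → let module H = IsSubgroup H in
          subst (Meets G A c) (ε-· A) (proj₂ H.ε-closed)
        , (λ u v w u∈ v∈ A~v (g , g∈ , e) →
            let h , h∈ , e₁ = ~-elim A~v
                e₂ , e₃ = ∷-injective e
            in subst (Meets G A c) (trans (∙-· g h A) (trans (cong (g ·_) e₁) (∷-injectiveˡ e₃)))
                 (proj₂ (H.∙-closed {g} {h} (g∈ , subst (Meets G A c) (sym e₂) u∈) (h∈ , subst (Meets G A c) (sym e₁) v∈))))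
        , (λ u w u∈ (g , g∈ , e) →
            let e₁ , e₂ = ∷-injective e in
            subst (Meets G A c) (⁻¹-· g e₁)
              (proj₂ (H.⁻¹-closed {g} (g∈ , subst (Meets G A c) (sym (∷-injectiveˡ e₂)) u∈)))))
      (λ (identity , product , inverse) → record
        { respects  = λ {g} {h} g≈h (g∈ , m) →
            respects {g} {h} g≈h g∈ , subst (Meets G A c) (map-cong g≈h A) m
        ; ε-closed  = ε-closed , subst (Meets G A c) (sym (ε-· A)) identity
        ; ∙-closed  = λ {g} {h} (g∈ , m) (h∈ , m′) → ∙-closed {g} {h} g∈ h∈ ,
            subst (Meets G A c) (sym (∙-· g h A))
              (product (g · A) (h · A) (g · h · A) m m′ (~-intro {g = h} h∈ A) (g , g∈ , refl))
        ; ⁻¹-closed = λ {g} (g∈ , m) → ⁻¹-closed {g} g∈ ,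
            inverse (g · A) (g ⁻¹ · A) m (g , g∈ , cong (_∷ (g · A) ∷ []) (trans (sym (∙-· g (g ⁻¹) A))
              (trans (map-cong {g = id} (strictlyInverseˡ g) A) (ε-· A))))
        })

    supports⇔ : ∀ K → Supports G (Coded G A c) K ⇔ CodesSupport G A c K
    supports⇔ K = mk⇔
      (λ (closed , lower , upper) →
          closed
        , (λ { u (g , g∈ , e) → let e₁ , e₂ = ∷-injective e in
            subst (Meets G A c) (∷-injectiveˡ e₂) (proj₂ (lower {g} (g∈ , fixes-∈ g K e₁))) })
        , (λ u K′ u∈ (g , g∈ , e) →
            let e₁ , e₂ = ∷-injective e
                stab = proj₂ (upper {g} (g∈ , subst (Meets G A c) (sym e₁) u∈))
            in subst (λ K′ → K List.⊆ K′ × K′ List.⊆ K) (∷-injectiveˡ e₂)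
              ( (λ {y} y∈ → subst (_∈ g · K) (strictlyInverseˡ g y) (∈-map⁺ (to g)
                  (bwd stab (subst (_∈ K) (sym (strictlyInverseˡ g y)) y∈))))
              , λ y∈ → let x , x∈ , y≡ = ∈-map⁻ (to g) y∈ in subst (_∈ K) (sym y≡) (fwd stab x∈))))
      (λ (closed , lower , upper) →
          closed
        , (λ {g} (g∈ , fix) → g∈ , lower _ (g , g∈ , cong (_∷ _) (∈-fixes g K fix)))
        , λ {g} (g∈ , m) → g∈ , λ {x} → let K⊆ , ⊆K = upper _ _ m (g , g∈ , refl) in mk⇔
            (λ x∈ → ⊆K (∈-map⁺ (to g) x∈))
            (λ gx∈ → let y , y∈ , e = ∈-map⁻ (to g) (K⊆ gx∈) in
              subst (_∈ K) (sym (to-injective g e)) y∈))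

  Supports-resp : ∀ {G H H′ : Pred Perm 0ℓ} → H ≐ H′ → ∀ {K} → Supports G H K → Supports G H′ K
  Supports-resp (⊆ , ⊇) (closed , lower , upper) = closed , ⊆ ∘ lower , upper ∘ ⊇

  module _ {G : Pred Perm 0ℓ} (isSubgroup : IsSubgroup G) (oligo : Oligomorphic G)
           (H : Pred Perm 0ℓ) (H-subgroup : IsSubgroup H) (H⊆G : H ⊆ G)
           (A : Tuple) (G-A⊆H : pointwise G A ⊆ H) where

    open Laws isSubgroup
    open IsSubgroup isSubgroup
    private module H = IsSubgroup H-subgroup

    private
      reps = orbit-representatives oligo (λ g → A ++ g · A) H (length A + length A)
        λ {g} _ → trans (length-++ A) (cong (length A +_) (length-map (to g) A))
      gs = proj₁ reps

    -- The tuples gA and hA lie in one orbit over `A` exactly if g and h lie in the same double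
    -- coset of G_(A). Oligomorphy for tuples of twice the length of `A` therefore leaves finitely
    -- many double cosets, and `gs` represents those inside `H`.
    images : Tuples
    images = map (_· A) gs

    overOrbit : ∀ {u v} → length u ≡ length v → _~_ G (A ++ u) (A ++ v) → OverOrbit G A u v
    overOrbit {u} {v} e p = Orbit-concat (cong (λ l → length A ∷ l ∷ []) e)
      (subst₂ (_~_ G) (cong (A ++_) (sym (++-identityʳ u))) (cong (A ++_) (sym (++-identityʳ v))) p)

    H⊆Coded : H ⊆ Coded G A images
    H⊆Coded {g} g∈ = H⊆G g∈ ,
      let h , h∈ , _ , p = proj₂ (proj₂ reps) g∈ in h · A , ∈-map⁺ (_· A) h∈ ,
      overOrbit (trans (length-map (to h) A) (sym (length-map (to g) A))) p

    same-image : ∀ f g → H f → G g → f · A ≡ g · A → H g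
    same-image f g f∈ g∈ e = H.respects {f ∙ (f ⁻¹ ∙ g)} {g} (λ x → strictlyInverseˡ f (to g x))
      (H.∙-closed {f} {f ⁻¹ ∙ g} f∈ (G-A⊆H {f ⁻¹ ∙ g}
        (∙-closed {f ⁻¹} {g} (⁻¹-closed {f} (H⊆G f∈)) g∈
        , fixes-∈ (f ⁻¹ ∙ g) A (trans (∙-· (f ⁻¹) g A) (⁻¹-· f e)))))

    -- The permutation `g` maps `A` as k ∙ h does, where k fixes `A` pointwise and h is in `H`; so
    -- it differs from an element of `H` by one of G_(A).
    Coded⊆H : Coded G A images ⊆ H
    Coded⊆H {g} (g∈ , b , b∈ , k , k∈ , e) =
      let h , h∈ , b≡ = ∈-map⁻ (_· A) b∈
          kA≡A , kb≡gA = ∷-injective e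
      in same-image (k ∙ h) g
           (H.∙-closed {k} {h} (G-A⊆H {k} (k∈ , fixes-∈ k A kA≡A)) (proj₁ (proj₂ reps) h∈)) g∈
           (trans (∙-· k h A) (trans (cong (k ·_) (sym b≡)) (∷-injectiveˡ kb≡gA)))

    Coded-isSubgroup : IsSubgroup (Coded G A images)
    Coded-isSubgroup = record
      { respects  = λ {g} {h} g≈h m → H⊆Coded {h} (H.respects {g} {h} g≈h (Coded⊆H {g} m))
      ; ε-closed  = H⊆Coded {ε} H.ε-closed
      ; ∙-closed  = λ {g} {h} m m′ → H⊆Coded {g ∙ h} (H.∙-closed {g} {h} (Coded⊆H {g} m) (Coded⊆H {h} m′))
      ; ⁻¹-closed = λ {g} m → H⊆Coded {g ⁻¹} (H.⁻¹-closed {g} (Coded⊆H {g} m))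
      }

  coded⇒weakElimination : ∀ {G} → IsSubgroup G → Oligomorphic G → CodedWeakElimination G → WeakElimination G
  coded⇒weakElimination {G} isSubgroup oligo coded H H-subgroup H⊆G (A , G-A⊆H) =
    K , (Supports-resp H≐Coded K-supports , least′) , λ (s , l) {x} →
      mk⇔ (λ x∈ → least′ s x∈) (λ x∈ → l (Supports-resp H≐Coded K-supports) x∈)
    where
    H≐Coded : Coded G A (images isSubgroup oligo H H-subgroup H⊆G A G-A⊆H) ≐ H
    H≐Coded = (λ {g} → Coded⊆H isSubgroup oligo H H-subgroup H⊆G A G-A⊆H {g})
            , (λ {g} → H⊆Coded isSubgroup oligo H H-subgroup H⊆G A G-A⊆H {g})

    support = coded A _ (Coded-isSubgroup isSubgroup oligo H H-subgroup H⊆G A G-A⊆H)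
    K = proj₁ support
    K-supports = proj₁ (proj₂ support)

    least′ : ∀ {K′} → Supports G H K′ → K List.⊆ K′
    least′ s = proj₂ (proj₂ support) _ (Supports-resp (proj₂ H≐Coded , proj₁ H≐Coded) s)

  Coded⊇pointwise : ∀ {G A c} → IsSubgroup (Coded G A c) → pointwise G A ⊆ Coded G A c
  Coded⊇pointwise {G} {A} {c} H {g} (g∈ , fix) = g∈ , subst (Meets G A c)
    (trans (ε-· A) (sym (∈-fixes g A fix))) (proj₂ (IsSubgroup.ε-closed H))

  weakElimination⇒coded : ∀ {G} → WeakElimination G → CodedWeakElimination G
  weakElimination⇒coded {G} weak A c H = K , supports , λ K′ s → minimal {K′} s
    where
    support = weak (Coded G A c) H proj₁ (A , λ {g} → Coded⊇pointwise {G} {A} {c} H {g})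
    K = proj₁ support
    supports = proj₁ (proj₁ (proj₂ support))
    minimal = proj₂ (proj₁ (proj₂ support))

  borel-meets : ∀ A c u → Borel (λ G → Meets (member G) A c u)
  borel-meets A c u = borel-∃-tuple λ b → borel-× (borel-const _) (borel-orbit _ _)

  borel-algebraicallyClosed : ∀ K → Borel (λ G → AlgebraicallyClosed (member G) K)
  borel-algebraicallyClosed K = gen-≐
    ((λ {G} closed {x} a → closed x (fwd (Algebraic⇔ (member G) K x) a))
    , λ {G} closed x a → closed (bwd (Algebraic⇔ (member G) K x) a))
    (borel-∀-ℕ λ x → borel-→ (borel-∃-tuple λ orbit → borel-∀-ℕ λ y →
      borel-→ (borel-orbit _ _) (borel-const _)) (borel-const (x ∈ K)))

  borel-codedSubgroup : ∀ A c → Borel (λ G → IsSubgroup (Coded (member G) A c))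
  borel-codedSubgroup A c = gen-≐
    ((λ {G} → bwd (subgroup⇔ (isSubgroup G) A c)) , λ {G} → fwd (subgroup⇔ (isSubgroup G) A c))
    (borel-× (borel-meets A c A) (borel-×
      (borel-∀-tuple λ u → borel-∀-tuple λ v → borel-∀-tuple λ w →
        borel-→ (borel-meets A c u) (borel-→ (borel-meets A c v) (borel-→ (borel-orbit _ _)
          (borel-→ (borel-orbit _ _) (borel-meets A c w)))))
      (borel-∀-tuple λ u → borel-∀-tuple λ w → borel-→ (borel-meets A c u)
        (borel-→ (borel-orbit _ _) (borel-meets A c w)))))

  borel-codedSupport : ∀ A c K → Borel (λ G → Supports (member G) (Coded (member G) A c) K)
  borel-codedSupport A c K = gen-≐
    ((λ {G} → bwd (supports⇔ (isSubgroup G) A c K)) , λ {G} → fwd (supports⇔ (isSubgroup G) A c K))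
    (borel-× (borel-algebraicallyClosed K)
      (borel-× (borel-∀-tuple λ u → borel-→ (borel-orbit _ _) (borel-meets A c u))
        (borel-∀-tuple λ u → borel-∀-tuple λ K′ → borel-→ (borel-meets A c u)
          (borel-→ (borel-orbit _ _) (borel-const _)))))

  𝒲-borel : IsBorel effros 𝒲
  𝒲-borel = (λ G → Oligomorphic (member G) × CodedWeakElimination (member G))
    , borel-× borel-oligomorphic (borel-∀-tuple λ A → borel-∀-tuples λ c →
        borel-→ (borel-codedSubgroup A c) (borel-∃-tuple λ K → borel-× (borel-codedSupport A c K)
          (borel-∀-tuple λ K′ → borel-→ (borel-codedSupport A c K′) (borel-const _))))
    , (λ {G} (oligo , coded) → ⇒𝒲 G oligo (coded⇒weakElimination (isSubgroup G) oligo coded))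
    , λ {G} G∈𝒲 → let oligo , weak = 𝒲⇒ G G∈𝒲 in oligo , weakElimination⇒coded weak

  -- Algebraic closure and bases

  words : List A → ℕ → List (List A)
  words as zero    = [] ∷ []
  words as (suc n) = cartesianProductWith _∷_ as (words as n)

  ∈-words : ∀ {as : List A} {w} → All (_∈ as) w → w ∈ words as (length w)
  ∈-words []       = here refl
  ∈-words (x ∷ xs) = ∈-cartesianProductWith⁺ _∷_ x (∈-words xs)

  unique-lookup : ∀ {xs : List A} → Unique xs → ∀ i j → lookup xs i ≡ lookup xs j → i ≡ j
  unique-lookup (_ ∷ _) zero zero _ = refl
  unique-lookup {xs = _ ∷ xs} (new ∷ _) zero (suc j) e = ⊥-elim (All.lookup new (∈-lookup {xs = xs} j) e)
  unique-lookup {xs = _ ∷ xs} (new ∷ _) (suc i) zero e = ⊥-elim (All.lookup new (∈-lookup {xs = xs} i) (sym e))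
  unique-lookup (_ ∷ unique) (suc i) (suc j) e = cong suc (unique-lookup unique i j e)

  unique-⊆-length : ∀ {xs ys : List A} → Unique xs → xs List.⊆ ys → length xs ≤ length ys
  unique-⊆-length {xs = xs} {ys} unique xs⊆ys = injective⇒≤ {f = position} injective
    where
    position : Fin (length xs) → Fin (length ys)
    position i = Any.index (xs⊆ys (∈-lookup {xs = xs} i))

    injective : ∀ {i j} → position i ≡ position j → i ≡ j
    injective {i} {j} e = unique-lookup unique i j
      (trans (lookup-index (xs⊆ys (∈-lookup i))) (trans (cong (lookup ys) e)
        (sym (lookup-index (xs⊆ys (∈-lookup j))))))

  bounded : (f : A → ℕ) (as : List A) → ∃[ N ] (∀ {x} → x ∈ as → f x ≤ N)
  bounded f [] = 0 , λ ()
  bounded f (x ∷ as) with bounded f as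
  ... | N , f≤N = f x ⊔ N , λ { (here refl) → m≤m⊔n (f x) N
                              ; (there x∈) → ≤-trans (f≤N x∈) (m≤n⊔m (f x) N) }

  -- An orbit is finite as soon as finitely many cosets cover the group.
  finite-orbit : (perm : A → Perm) (P : Pred A ℓ) (f : A → Tuple) (fs : Tuples) {x : ℕ} (orbit : List ℕ) →
    (∀ {g} → P g → f g ∈ fs) →
    (∀ {g h} → P g → P h → f g ≡ f h → from (perm h) (to (perm g) x) ∈ orbit) →
    Σ[ orbit′ ∈ List ℕ ] (∀ {g} → P g → to (perm g) x ∈ orbit′)
  finite-orbit perm P f fs {x} orbit f∈ same with representatives (λ w g → P g × f g ≡ w) fs
  ... | hs , _ , _ , complete = concatMap (λ h → map (to (perm h)) orbit) hs , λ {g} p →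
    let h , h∈ , q , e = complete (f∈ p) (p , refl) in
    ∈-concat⁺′ {xss = map (λ h → map (to (perm h)) orbit) hs}
      (subst (_∈ map (to (perm h)) orbit) (strictlyInverseˡ (perm h) (to (perm g) x))
        (∈-map⁺ (to (perm h)) (same p q (sym e))))
      (∈-map⁺ (λ h → map (to (perm h)) orbit) h∈)

  module _ (G : Pred Perm 0ℓ) where

    -- Equivalently, the conjugates of the pointwise stabilizer of t form a
    -- neighbourhood subbasis at the identity.
    Base : Tuple → Set
    Base t = ∀ x → ∃[ us ] All (_~_ G t) us ×
      (∀ y → Orbit G ((x ∷ []) ∷ us) ((y ∷ []) ∷ us) → x ≡ y)

    -- A list meeting every orbit on pairs of translates is used in place of the number of these
    -- orbits, because such a list can be carried along a matching.
    PairBound : ℕ → Tuple → Set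
    PairBound r t = Σ[ ps ∈ List (Tuple × Tuple) ] length ps ≤ r ×
      (∀ c d → _~_ G t c → _~_ G t d → ∃[ p ] p ∈ ps × Orbit G (proj₁ p ∷ proj₂ p ∷ []) (c ∷ d ∷ []))

    -- An entry is independent of the entries after it only. Algebraic closure need not satisfy the
    -- exchange property, so the order matters.
    data Independent : Tuple → Set where
      []  : Independent []
      _∷_ : ∀ {x a} → ¬ Algebraic G a x → Independent a → Independent (x ∷ a)

  base-fixes : ∀ {G t x} (b : Base G t) {h} → G h → h ·· proj₁ (b x) ≡ proj₁ (b x) → to h x ≡ x
  base-fixes {x = x} b {h} h∈ e = sym (proj₂ (proj₂ (b x)) (to h x) (h , h∈ , cong (_ ∷_) e))

  base-agree : ∀ {G t x} → IsSubgroup G → (b : Base G t) → ∀ {g h} → G g → G h →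
    g ·· proj₁ (b x) ≡ h ·· proj₁ (b x) → to g x ≡ to h x
  base-agree {x = x} isSubgroup b {g} {h} g∈ h∈ e = trans (sym (strictlyInverseˡ h (to g x)))
    (cong (to h) (base-fixes b {h ⁻¹ ∙ g} (∙-closed {h ⁻¹} {g} (⁻¹-closed {h} h∈) g∈)
      (trans (∙-·· (h ⁻¹) g (proj₁ (b x))) (⁻¹-·· h (sym e)))))
    where open IsSubgroup isSubgroup

  base-intro : ∀ {G t x us} → All (_~_ G t) us → (∀ {h} → G h → h ·· us ≡ us → to h x ≡ x) →
    ∃[ us ] All (_~_ G t) us × (∀ y → Orbit G ((x ∷ []) ∷ us) ((y ∷ []) ∷ us) → x ≡ y)
  base-intro {us = us} in-orbit fix = us , in-orbit , λ y (h , h∈ , e) →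
    let e₁ , e₂ = ∷-injective e in trans (sym (fix {h} h∈ e₂)) (∷-injectiveˡ e₁)

  -- Algebraicity, independence and the length of bases

  module GroupAction {G : Pred Perm 0ℓ} (isSubgroup : IsSubgroup G) where
    open IsSubgroup isSubgroup
    open Laws isSubgroup

    algebraic-move : ∀ {g a x} → G g → Algebraic G a x → Algebraic G (g · a) (to g x)
    algebraic-move {g} {a} {x} g∈ (orbit , o) = map (to g) orbit , λ {h} (h∈ , fix) →
      subst (_∈ map (to g) orbit) (strictlyInverseˡ g (to h (to g x)))
        (∈-map⁺ (to g) (o {g ⁻¹ ∙ (h ∙ g)}
          ( ∙-closed {g ⁻¹} {h ∙ g} (⁻¹-closed {g} g∈) (∙-closed {h} {g} h∈ g∈)
          , λ {y} y∈ → trans (cong (from g) (fix (∈-map⁺ (to g) y∈))) (strictlyInverseʳ g y))))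

    algebraic-fix : ∀ {g a x} → pointwise G a g → Algebraic G a x → Algebraic G a (to g x)
    algebraic-fix {g} {a} {x} (g∈ , fix) alg =
      subst (λ b → Algebraic G b (to g x)) (∈-fixes g a fix) (algebraic-move {g} g∈ alg)

    algebraic-∈ : ∀ {a x} → x ∈ a → Algebraic G a x
    algebraic-∈ {a} x∈ = a , λ (_ , fix) → subst (_∈ a) (sym (fix x∈)) x∈

    AlgebraicClosure : Tuple → Set
    AlgebraicClosure a = ∃[ K ] AlgebraicallyClosed G K × (∀ x → x ∈ K ⇔ Algebraic G a x)

    -- The elements algebraic over `a` fall into finitely many orbits over `a`, each finite. The
    -- resulting set `K` is closed because G_(a) permutes it: G_(K) has finite index in G_(a), so
    -- what is algebraic over `K` is algebraic over `a`.
    algebraicClosure : Oligomorphic G → ∀ a → AlgebraicClosure a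
    algebraicClosure oligo a = K , closed , K⇔
      where
      reps = orbit-representatives oligo (_∷ a) (Algebraic G a) (suc (length a)) (λ _ → refl)
      xs = proj₁ reps

      orbits : Tuples
      orbits = proj₁ (representatives (λ x o → ∀ {g} → pointwise G a g → to g x ∈ o) xs)

      K : Tuple
      -- The chosen lists may be larger than the orbits they bound; the surplus is removed.
      K = filter (λ x → dec (Algebraic G a x)) (concat orbits)

      K⇔ : ∀ x → x ∈ K ⇔ Algebraic G a x
      K⇔ x = mk⇔ (λ x∈ → proj₂ (∈-filter⁻ (λ x → dec (Algebraic G a x)) {xs = concat orbits} x∈)) λ alg →
        let y , y∈ , (orbit , o) , y~x = proj₂ (proj₂ reps) alg
            g , g∈ , e = ~-elim y~x
            gy≡x , fix = ∷-injective e
            orbit′ , orbit′∈ , o′ = proj₂ (proj₂ (proj₂ (representatives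
              (λ x o → ∀ {g} → pointwise G a g → to g x ∈ o) xs))) y∈ (λ {g} → o {g})
        in ∈-filter⁺ (λ x → dec (Algebraic G a x))
             (∈-concat⁺′ (subst (_∈ orbit′) gy≡x (o′ {g} (g∈ , fixes-∈ g a fix))) orbit′∈) alg

      closed : AlgebraicallyClosed G K
      closed {x} (orbit , o) = bwd (K⇔ x) (finite-orbit id (pointwise G a) (_· K) (words K (length K)) orbit
        (λ {g} p → subst (λ n → g · K ∈ words K n) (length-map (to g) K)
          (∈-words (All.tabulate (λ y∈ → let z , z∈ , e = ∈-map⁻ (to g) y∈ in
            subst (_∈ K) (sym e) (bwd (K⇔ (to g z)) (algebraic-fix {g} p (fwd (K⇔ z) z∈)))))))
        (λ {g} {h} (g∈ , _) (h∈ , _) e → o {h ⁻¹ ∙ g} (∙-closed {h ⁻¹} {g} (⁻¹-closed {h} h∈) g∈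
          , fixes-∈ (h ⁻¹ ∙ g) K (trans (∙-· (h ⁻¹) g K) (⁻¹-· h (sym e))))))

    closed-resp : ∀ {K K′} → K List.⊆ K′ → K′ List.⊆ K → AlgebraicallyClosed G K → AlgebraicallyClosed G K′
    closed-resp K⊆ K′⊆ closed (orbit , o) =
      K⊆ (closed (orbit , λ {g} (g∈ , fix) → o {g} (g∈ , λ x∈ → fix (K′⊆ x∈))))

    closed-unique : ∀ {K} → AlgebraicallyClosed G K → ∃[ t ] AlgebraicallyClosed G t × Unique t ×
      K List.⊆ t × t List.⊆ K
    closed-unique {K} closed = deduplicate _≟_ K
      , closed-resp (∈-deduplicate⁺ _≟_) (∈-deduplicate⁻ _≟_ K) closed
      , deduplicate-! K , ∈-deduplicate⁺ _≟_ , ∈-deduplicate⁻ _≟_ K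

    -- As `t` contains a point of every orbit, each point lies in a translate of `t` and is
    -- determined by that single translate. The algebraic closure is taken so that the stabilizer of
    -- `t` can be recognised in the topological group.
    base-exists : Oligomorphic G → ∃[ t ] AlgebraicallyClosed G t × Unique t × Base G t
    base-exists oligo = t , proj₁ (proj₂ unique) , proj₁ (proj₂ (proj₂ unique)) , base
      where
      reps = concat (proj₁ (oligo 1))
      closure = algebraicClosure oligo reps
      unique = closed-unique (proj₁ (proj₂ closure))
      t = proj₁ unique

      t-meets : ∀ x → ∃[ y ] y ∈ t × (∃[ g ] G g × to g y ≡ x)
      t-meets x with proj₂ (oligo 1) (x ∷ []) refl
      ... | y ∷ [] , y∈ , y~x = let g , g∈ , e = ~-elim y~x in y
        , proj₁ (proj₂ (proj₂ (proj₂ unique)))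
            (bwd (proj₂ (proj₂ closure) y) (algebraic-∈ (∈-concat⁺′ (here refl) y∈)))
        , g , g∈ , ∷-injectiveˡ e
      ... | [] , _ , y~x with () ← proj₂ (proj₂ (~-elim y~x))
      ... | _ ∷ _ ∷ _ , _ , y~x with () ← proj₂ (proj₂ (~-elim y~x))

      base : Base G t
      base x = let y , y∈ , g , g∈ , gy≡x = t-meets x in
        base-intro (~-intro {g = g} g∈ t ∷ []) λ {h} h∈ e →
          trans (cong (to h) (sym gy≡x)) (trans (fixes-∈ h (g · t) (∷-injectiveˡ e) (∈-map⁺ (to g) y∈)) gy≡x)

    base-move : ∀ {t t′} → _~_ G t t′ → Base G t → Base G t′
    base-move t~t′ base x = let us , in-orbit , fix = base x in
      us , All.map (Orbit-trans (Orbit-sym t~t′)) in-orbit , fix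

    pairBound : Oligomorphic G → ∀ t → ∃[ r ] PairBound G r t
    pairBound oligo t = length ps , ps , ≤-refl , λ c d t~c t~d →
      let (p , q) , pq∈ , (t~p , t~q) , same = proj₂ (proj₂ reps) {c , d} (t~c , t~d)
      in (p , q) , pq∈ , Orbit-concat
           (cong₂ (λ k l → k ∷ l ∷ []) (trans (sym (~-length t~p)) (~-length t~c))
                                       (trans (sym (~-length t~q)) (~-length t~d))) same
      where
      reps = orbit-representatives oligo (λ (c , d) → concat (c ∷ d ∷ [])) (λ (c , d) → _~_ G t c × _~_ G t d)
        (length t + (length t + 0)) λ {(c , d)} (t~c , t~d) → trans (length-++ c)
          (cong₂ _+_ (sym (~-length t~c)) (trans (length-++ d) (cong (_+ 0) (sym (~-length t~d)))))
      ps = proj₁ reps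

    -- For independent x₁, …, xₛ in t choose gᵢ moving xᵢ but fixing the
    -- entries it is independent of: the pairs (t , gᵢ t) lie in distinct orbits.
    independent-length : ∀ {r t a} → PairBound G r t → Independent G a → a List.⊆ t → length a ≤ r
    independent-length {r} {t} {a} (ps , short , cover) independent a⊆t =
      ≮⇒≥ λ r<s → collision (pigeonhole (≤-trans (s≤s short) r<s) class)
      where
      mover : ∀ {a} → Independent G a → (i : Fin (length a)) → Σ[ g ∈ Perm ] G g ×
        to g (lookup a i) ≢ lookup a i × (∀ {j} → i Fin.< j → to g (lookup a j) ≡ lookup a j)
      mover {x ∷ a} (¬alg ∷ _) zero = moves (λ f → ¬alg (x ∷ [] , λ {g} p → here (f g p)))
        where
        moves : ¬ (∀ g → pointwise G a g → to g x ≡ x) → _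
        moves ¬f = let g , ¬p = ¬∀⇒∃¬ ¬f
                       (g∈ , fix) , g-moves = ¬→⇒× ¬p
                   in g , g∈ , g-moves , λ { {suc j} _ → fix (∈-lookup {xs = a} j) }
      mover {x ∷ a} (_ ∷ independent) (suc i) = let g , g∈ , moves , fix = mover independent i in
        g , g∈ , moves , λ { {suc j} (s≤s i<j) → fix i<j }

      g : Fin (length a) → Perm
      g i = proj₁ (mover independent i)

      g∈ : ∀ i → G (g i)
      g∈ i = proj₁ (proj₂ (mover independent i))

      witness : ∀ i → ∃[ p ] p ∈ ps × Orbit G (proj₁ p ∷ proj₂ p ∷ []) (t ∷ g i · t ∷ [])
      witness i = cover t (g i · t) (Orbit-refl (t ∷ [])) (~-intro {g = g i} (g∈ i) t)

      class : Fin (length a) → Fin (length ps)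
      class i = Any.index (proj₁ (proj₂ (witness i)))

      pair-at : ∀ i → proj₁ (witness i) ≡ lookup ps (class i)
      pair-at i = lookup-index (proj₁ (proj₂ (witness i)))

      collision : ¬ (∃[ i ] ∃[ j ] i Fin.< j × class i ≡ class j)
      collision (i , j , i<j , e) = proj₁ (proj₂ (proj₂ (mover independent j))) (begin
        to (g j) x          ≡⟨ sym (·-∈ (h ∙ g i) (g j) t (trans (∙-· h (g i) t) (∷-injectiveˡ (proj₂ moved))) x∈t) ⟩
        to h (to (g i) x)   ≡⟨ cong (to h) (proj₂ (proj₂ (proj₂ (mover independent i))) i<j) ⟩
        to h x              ≡⟨ fixes-∈ h t (proj₁ moved) x∈t ⟩
        x                   ∎)
        where
        open ≡-Reasoning
        x = lookup a j
        x∈t = a⊆t (∈-lookup {xs = a} j)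

        same : proj₁ (witness i) ≡ proj₁ (witness j)
        same = trans (pair-at i) (trans (cong (lookup ps) e) (sym (pair-at j)))

        orbit : Orbit G (t ∷ g i · t ∷ []) (t ∷ g j · t ∷ [])
        orbit = Orbit-trans (Orbit-sym (proj₂ (proj₂ (witness i))))
          (subst (λ p → Orbit G (proj₁ p ∷ proj₂ p ∷ []) (t ∷ g j · t ∷ [])) (sym same) (proj₂ (proj₂ (witness j))))

        h = proj₁ orbit
        moved = ∷-injective (proj₂ (proj₂ orbit))

    -- A maximal independent list of entries of `t`: maximality puts `t` into its algebraic closure.
    -- When the fuel is used up the list already has length at least `r`, and a further independent
    -- entry would break the bound.
    basis : ∀ {r t} → PairBound G r t → ∃[ a ] length a ≤ r × (∀ {x} → x ∈ t → Algebraic G a x)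
    basis {r} {t} bound = enlarge r [] (λ ()) (m≤m+n r 0)
      where
      enlarge : ∀ fuel {a} → Independent G a → a List.⊆ t → r ≤ fuel + length a →
        ∃[ a ] length a ≤ r × (∀ {x} → x ∈ t → Algebraic G a x)
      enlarge fuel {a} independent a⊆t r≤ with dec (∃[ x ] x ∈ t × ¬ Algebraic G a x)
      ... | no none = a , independent-length bound independent a⊆t , λ x∈ → byContradiction λ ¬alg → none (_ , x∈ , ¬alg)
      enlarge zero {a} independent a⊆t r≤ | yes (x , x∈ , ¬alg) = ⊥-elim (<-irrefl refl (≤-trans
        (independent-length bound (¬alg ∷ independent) λ { (here refl) → x∈ ; (there y∈) → a⊆t y∈ }) r≤))
      enlarge (suc fuel) {a} independent a⊆t r≤ | yes (x , x∈ , ¬alg) =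
        enlarge fuel (¬alg ∷ independent) (λ { (here refl) → x∈ ; (there y∈) → a⊆t y∈ })
          (≤-trans r≤ (≤-reflexive (sym (+-suc fuel (length a)))))

    tuples-upTo : Oligomorphic G → ∀ N → Σ[ us ∈ Tuples ] (∀ v → length v ≤ N → ∃[ u ] u ∈ us × _~_ G u v)
    tuples-upTo oligo N = concatMap (proj₁ ∘ oligo) (upTo (suc N)) , λ v v≤N →
      let u , u∈ , u~v = proj₂ (oligo (length v)) v refl in
      u , ∈-concat⁺′ u∈ (∈-map⁺ (proj₁ ∘ oligo) (∈-upTo⁺ (s≤s v≤N))) , u~v

    -- Up to translation the basis of `t` is one of finitely many tuples of length at most `r`, so
    -- its algebraic closure has bounded size. This closure contains `t`, which has no repeated
    -- entries.
    length-bound : Oligomorphic G → ∀ r → ∃[ N ] (∀ t → Unique t → PairBound G r t → length t ≤ N)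
    length-bound oligo r = N , bound
      where
      us = tuples-upTo oligo r

      size : Tuple → ℕ
      size u = length (proj₁ (algebraicClosure oligo u))

      N = proj₁ (bounded size (proj₁ us))

      bound : ∀ t → Unique t → PairBound G r t → length t ≤ N
      bound t unique pairs = ≤-trans
        (≤-trans (≤-reflexive (sym (length-map (from g) t)))
          (unique-⊆-length (Unique.map⁺ (to-injective (g ⁻¹)) unique) inside))
        (proj₂ (bounded size (proj₁ us)) u∈)
        where
        a = basis pairs
        translate = proj₂ us (proj₁ a) (proj₁ (proj₂ a))
        u = proj₁ translate
        u∈ = proj₁ (proj₂ translate)
        u~a = ~-elim (proj₂ (proj₂ translate))
        g = proj₁ u~a

        inside : g ⁻¹ · t List.⊆ proj₁ (algebraicClosure oligo u)
        inside y∈ with ∈-map⁻ (from g) y∈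
        ... | x , x∈ , refl = bwd (proj₂ (proj₂ (algebraicClosure oligo u)) (from g x))
          (subst (λ b → Algebraic G b (from g x)) (⁻¹-· g (proj₂ (proj₂ u~a)))
            (algebraic-move {g ⁻¹} (⁻¹-closed {g} (proj₁ (proj₂ u~a))) (proj₂ (proj₂ a) x∈)))

  -- Patterns and matchings

  -- A junk value makes words plain lists of numbers, so that patterns can be coded; `Word` keeps
  -- the indices in range.
  nth : Tuples → ℕ → Tuple
  nth []       _       = []
  nth (u ∷ us) zero    = u
  nth (u ∷ us) (suc i) = nth us i

  pick : Tuples → List ℕ → Tuples
  pick us = map (nth us)

  nth-All : ∀ {P : Pred Tuple 0ℓ} {us i} → All P us → i < length us → P (nth us i)
  nth-All {i = zero}  (p ∷ _)  _         = p
  nth-All {i = suc i} (_ ∷ ps) (s≤s i<n) = nth-All ps i<n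

  nth-∈ : ∀ {us u} → u ∈ us → ∃[ i ] i < length us × nth us i ≡ u
  nth-∈ (here refl) = 0 , s≤s z≤n , refl
  nth-∈ (there u∈)  = let i , i< , e = nth-∈ u∈ in suc i , s≤s i< , e

  pick-⊆ : ∀ {us ws} → ws List.⊆ us → ∃[ w ] All (_< length us) w × pick us w ≡ ws
  pick-⊆ {ws = []} _ = [] , [] , refl
  pick-⊆ {ws = u ∷ ws} sub =
    let i , i< , e = nth-∈ (sub (here refl)) ; w , w< , e′ = pick-⊆ (sub ∘ there)
    in i ∷ w , i< ∷ w< , cong₂ _∷_ e e′

  Pattern : Set
  Pattern = ℕ × ℕ × List (List ℕ × List ℕ)

  Word : ℕ → ℕ → List ℕ → Set
  Word n k w = length w ≤ n × All (_< k) w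

  module _ (G : Pred Perm 0ℓ) where

    Realises : Tuple → Pattern → Set
    Realises t (n , k , E) = ∃[ xs ] length xs ≡ k × All (_~_ G t) xs
      × (∀ v w → Word n k v → Word n k w → ((v , w) ∈ E ⇔ Orbit G (pick xs v) (pick xs w)))
      × (∀ ys → length ys ≤ n → All (_~_ G t) ys → ∃[ w ] Word n k w × Orbit G (pick xs w) ys)

    -- Closedness lets a topological isomorphism match the stabilizer of `t`, uniqueness of entries
    -- lets the pattern bound the length of `t`, and the base property makes the action on
    -- translates determine the group.
    Occurs : Pattern → Set
    Occurs p = ∃[ t ] AlgebraicallyClosed G t × Unique t × Base G t × Realises t p

  Pattern-code : Pattern ↣ ℕ
  Pattern-code = ×-code ℕ-code (×-code ℕ-code (List-code (×-code Tuple-code Tuple-code)))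

  borel-translates : ∀ t us → Borel (λ G → All (_~_ (member G) t) us)
  borel-translates t []       = gen-≐ ((λ _ → []) , λ _ → tt) (borel-const ⊤)
  borel-translates t (u ∷ us) = gen-≐ (uncurry _∷_ , λ { (p ∷ ps) → p , ps })
    (borel-× (borel-orbit _ _) (borel-translates t us))

  borel-occurs : ∀ p → Borel (λ G → Occurs (member G) p)
  borel-occurs (n , k , E) = borel-∃-tuple λ t → borel-× (borel-algebraicallyClosed t)
    (borel-× (borel-const (Unique t)) (borel-× base
      (borel-∃-tuples λ xs → borel-× (borel-const (length xs ≡ k)) (borel-× (borel-translates t xs) (borel-×
        (borel-∀-tuple λ v → borel-∀-tuple λ w → borel-→ (borel-const (Word n k v)) (borel-→ (borel-const (Word n k w))
          (borel-⇔ (borel-const ((v , w) ∈ E)) (borel-orbit (pick xs v) (pick xs w)))))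
        (borel-∀-tuples λ ys → borel-→ (borel-const (length ys ≤ n)) (borel-→ (borel-translates t ys)
          (borel-∃-tuple λ w → borel-× (borel-const (Word n k w)) (borel-orbit (pick xs w) ys)))))))))
    where
    base : ∀ {t} → Borel (λ G → Base (member G) t)
    base {t} = borel-∀-ℕ λ x → borel-∃-tuples λ us → borel-× (borel-translates t us)
      (borel-∀-ℕ λ y → borel-→ (borel-orbit _ _) (borel-const (x ≡ y)))

  Orbit-length : ∀ {G us vs} → Orbit G us vs → length us ≡ length vs
  Orbit-length {us = us} (g , _ , refl) = sym (length-map (g ·_) us)

  lengths : ∀ {G t us} → All (_~_ G t) us → length (concat us) ≡ length us * length t
  lengths [] = refl
  lengths {us = u ∷ us} (t~u ∷ alls) =
    trans (length-++ u) (cong₂ _+_ (sym (~-length t~u)) (lengths alls))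

  same-lengths : ∀ {G t us vs} → All (_~_ G t) us → All (_~_ G t) vs → length us ≡ length vs →
    map length us ≡ map length vs
  same-lengths [] [] _ = refl
  same-lengths (t~u ∷ us) (t~v ∷ vs) e =
    cong₂ _∷_ (trans (sym (~-length t~u)) (~-length t~v)) (same-lengths us vs (suc-injective e))

  module _ {G : Pred Perm 0ℓ} (isSubgroup : IsSubgroup G) (oligo : Oligomorphic G) where
    open Laws isSubgroup

    word-representatives : ∀ t q → Σ[ wss ∈ List Tuples ] (∀ {ws} → ws ∈ wss → All (_~_ G t) ws) ×
      (∀ ys → length ys ≡ q → All (_~_ G t) ys → ∃[ ws ] ws ∈ wss × Orbit G ws ys)
    word-representatives t q =
      let wss , sound , complete = orbit-representatives oligo concat
            (λ ws → All (_~_ G t) ws × length ws ≡ q) (q * length t)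
            (λ (alls , e) → trans (lengths alls) (cong (_* length t) e))
      in wss , proj₁ ∘ sound , λ ys e alls →
        let ws , ws∈ , (all′ , e′) , same = complete (alls , e)
        in ws , ws∈ , Orbit-concat (same-lengths all′ alls (trans e′ (sym e))) same

    -- The translates in `xs` are all those occurring in chosen representatives of the orbits on
    -- words of length at most `n`; hence the words over `xs` represent all these orbits.
    realised-pattern : ∀ t n → ∃[ k ] ∃[ E ] Realises G t (n , k , E)
    realised-pattern t n = length xs , E , xs , refl , in-orbit , E⇔ , exhaustive
      where
      wss = concatMap (proj₁ ∘ word-representatives t) (upTo (suc n))
      xs = concat wss

      in-orbit : All (_~_ G t) xs
      in-orbit = All.tabulate λ x∈ →
        let ws , x∈ws , ws∈ = ∈-concat⁻′ wss x∈
            wss′ , ws∈′ , wss∈ = ∈-concat⁻′ (map (proj₁ ∘ word-representatives t) (upTo (suc n))) ws∈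
            q , _ , e = ∈-map⁻ (proj₁ ∘ word-representatives t) wss∈
        in All.lookup (proj₁ (proj₂ (word-representatives t q)) (subst (ws ∈_) e ws∈′)) x∈ws

      vocabulary : List (List ℕ)
      vocabulary = concatMap (words (upTo (length xs))) (upTo (suc n))

      ∈-vocabulary : ∀ {w} → Word n (length xs) w → w ∈ vocabulary
      ∈-vocabulary (w≤n , w<) = ∈-concat⁺′ (∈-words (All.map ∈-upTo⁺ w<))
        (∈-map⁺ (words (upTo (length xs))) (∈-upTo⁺ (s≤s w≤n)))

      related? : ∀ vw → Dec (Orbit G (pick xs (proj₁ vw)) (pick xs (proj₂ vw)))
      related? _ = dec _

      E = filter related? (cartesianProduct vocabulary vocabulary)

      E⇔ : ∀ v w → Word n (length xs) v → Word n (length xs) w →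
        ((v , w) ∈ E ⇔ Orbit G (pick xs v) (pick xs w))
      E⇔ v w word-v word-w = mk⇔
        (λ vw∈ → proj₂ (∈-filter⁻ related? {xs = cartesianProduct vocabulary vocabulary} vw∈))
        (∈-filter⁺ related? (∈-cartesianProduct⁺ (∈-vocabulary word-v) (∈-vocabulary word-w)))

      exhaustive : ∀ ys → length ys ≤ n → All (_~_ G t) ys →
        ∃[ w ] Word n (length xs) w × Orbit G (pick xs w) ys
      exhaustive ys ys≤n alls =
        let ws , ws∈ , same = proj₂ (proj₂ (word-representatives t (length ys))) ys refl alls
            ws∈wss = ∈-concat⁺′ ws∈ (∈-map⁺ (proj₁ ∘ word-representatives t) (∈-upTo⁺ (s≤s ys≤n)))
            w , w< , e = pick-⊆ {xs} {ws} (λ u∈ → ∈-concat⁺′ u∈ ws∈wss)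
            same′ = subst (λ us → Orbit G us ys) (sym e) same
        in w , (≤-trans (≤-reflexive (trans (sym (length-map (nth xs) w)) (Orbit-length same′))) ys≤n , w<) , same′

  -- Similarities and their approximations by matchings

  Transfers : (Tuple → Tuple → Set) → Pred Perm 0ℓ → Pred Perm 0ℓ → Set
  Transfers R G G′ = ∀ {us us′ vs vs′} → Pointwise R us us′ → Pointwise R vs vs′ →
    Orbit G us vs → Orbit G′ us′ vs′

  TransfersUpTo : ℕ → (Tuple → Tuple → Set) → Pred Perm 0ℓ → Pred Perm 0ℓ → Set
  TransfersUpTo n R G G′ = ∀ {us us′ vs vs′} → Pointwise R us us′ → Pointwise R vs vs′ →
    length us ≤ n → Orbit G us vs → Orbit G′ us′ vs′

  -- An isomorphism between the canonical structures of the two actions on translates. Applied to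
  -- words with repeated letters, `forward` and `backward` make `Graph` a bijection.
  record Similar (G G′ : Pred Perm 0ℓ) (t t′ : Tuple) : Set₁ where
    field
      Graph      : Tuple → Tuple → Set
      domain     : ∀ {c c′} → Graph c c′ → _~_ G t c
      codomain   : ∀ {c c′} → Graph c c′ → _~_ G′ t′ c′
      total      : ∀ {c} → _~_ G t c → ∃[ c′ ] Graph c c′
      surjective : ∀ {c′} → _~_ G′ t′ c′ → ∃[ c ] Graph c c′
      forward    : Transfers Graph G G′
      backward   : Transfers (flip Graph) G′ G

    total* : ∀ {us} → All (_~_ G t) us → ∃[ us′ ] Pointwise Graph us us′
    total* [] = [] , []
    total* (p ∷ ps) = let c′ , h = total p ; us′ , hs = total* ps in c′ ∷ us′ , h ∷ hs

    codomain* : ∀ {us us′} → Pointwise Graph us us′ → All (_~_ G′ t′) us′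
    codomain* []       = []
    codomain* (h ∷ hs) = codomain h ∷ codomain* hs

  flip-pointwise : {R : Tuple → Tuple → Set} → ∀ {us vs} → Pointwise R us vs → Pointwise (flip R) vs us
  flip-pointwise = Pointwise.symmetric id

  Similar-sym : ∀ {G G′ t t′} → Similar G G′ t t′ → Similar G′ G t′ t
  Similar-sym s = record
    { Graph      = flip Graph
    ; domain     = codomain
    ; codomain   = domain
    ; total      = surjective
    ; surjective = total
    ; forward    = backward
    ; backward   = forward
    }
    where open Similar s

  pick-pointwise : ∀ {R : Tuple → Tuple → Set} {us us′ w} → Pointwise R us us′ →
    All (_< length us) w → Pointwise R (pick us w) (pick us′ w)
  pick-pointwise rs []        = []
  pick-pointwise rs (i< ∷ w<) = nth-pointwise rs i< ∷ pick-pointwise rs w<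
    where
    nth-pointwise : ∀ {R : Tuple → Tuple → Set} {us us′ i} → Pointwise R us us′ → i < length us →
      R (nth us i) (nth us′ i)
    nth-pointwise {i = zero}  (r ∷ _)  _        = r
    nth-pointwise {i = suc i} (_ ∷ rs) (s≤s i<) = nth-pointwise rs i<

  realises-similar : ∀ {G G′ t t′ p} → Similar G G′ t t′ → Realises G t p → Realises G′ t′ p
  realises-similar {G′ = G′} {p = n , _ , E} s (xs , refl , in-orbit , E⇔ , exhaustive) = xs′
    , sym (Pointwise-length hs) , codomain* hs
    , (λ v w word-v word-w → mk⇔
        (λ vw∈ → forward (pick-pointwise hs (proj₂ word-v)) (pick-pointwise hs (proj₂ word-w))
          (fwd (E⇔ v w word-v word-w) vw∈))
        (λ o → bwd (E⇔ v w word-v word-w)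
          (backward (pick-flip word-v) (pick-flip word-w) o)))
    , λ ys′ ys≤n in-orbit′ →
        let ys , gs = Similar.total* (Similar-sym s) in-orbit′
            w , word , o = exhaustive ys (≤-trans (≤-reflexive (sym (Pointwise-length gs))) ys≤n)
                             (Similar.codomain* (Similar-sym s) gs)
        in w , word , forward (pick-pointwise hs (proj₂ word)) (flip-pointwise gs) o
    where
    open Similar s
    xs′ = proj₁ (total* in-orbit)
    hs = proj₂ (total* in-orbit)

    pick-flip : ∀ {w} → Word n (length xs) w → Pointwise (flip Graph) (pick xs′ w) (pick xs w)
    pick-flip word = flip-pointwise (pick-pointwise hs (proj₂ word))

  -- An approximation of a similarity: `Graph` may relate few translates, and instead of being total
  -- its words have to represent all orbits on words of length at most `n`.
  record Matching (G G′ : Pred Perm 0ℓ) (n : ℕ) (t t′ : Tuple) : Set₁ where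
    field
      Graph       : Tuple → Tuple → Set
      domain      : ∀ {c c′} → Graph c c′ → _~_ G t c
      codomain    : ∀ {c c′} → Graph c c′ → _~_ G′ t′ c′
      forward     : TransfersUpTo n Graph G G′
      backward    : TransfersUpTo n (flip Graph) G′ G
      exhaustive  : ∀ ys → length ys ≤ n → All (_~_ G t) ys →
                    ∃[ us ] ∃[ us′ ] Pointwise Graph us us′ × Orbit G us ys
      exhaustive′ : ∀ ys → length ys ≤ n → All (_~_ G′ t′) ys →
                    ∃[ us′ ] ∃[ us ] Pointwise Graph us us′ × Orbit G′ us′ ys

  Matching-sym : ∀ {G G′ n t t′} → Matching G G′ n t t′ → Matching G′ G n t′ t
  Matching-sym m = record
    { Graph       = flip Graph
    ; domain      = codomain
    ; codomain    = domain
    ; forward     = backward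
    ; backward    = forward
    ; exhaustive  = λ ys ≤n alls → let us , us′ , p , o = exhaustive′ ys ≤n alls in us , us′ , flip-pointwise p , o
    ; exhaustive′ = λ ys ≤n alls → let us , us′ , p , o = exhaustive ys ≤n alls in us , us′ , flip-pointwise p , o
    }
    where open Matching m

  Matching-antitone : ∀ {G G′ m n t t′} → m ≤ n → Matching G G′ n t t′ → Matching G G′ m t t′
  Matching-antitone m≤n M = record
    { Graph       = Graph
    ; domain      = domain
    ; codomain    = codomain
    ; forward     = λ p q ≤m → forward p q (≤-trans ≤m m≤n)
    ; backward    = λ p q ≤m → backward p q (≤-trans ≤m m≤n)
    ; exhaustive  = λ ys ≤m → exhaustive ys (≤-trans ≤m m≤n)
    ; exhaustive′ = λ ys ≤m → exhaustive′ ys (≤-trans ≤m m≤n)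
    }
    where open Matching M

  realises-matching : ∀ {G G′ t t′ n k E} → Realises G t (n , k , E) → Realises G′ t′ (n , k , E) →
    Matching G G′ n t t′
  realises-matching {G} {G′} {t} {t′} {n} {k} {E}
    (xs , refl , in-orbit , E⇔ , exhaustive) (xs′ , e , in-orbit′ , E⇔′ , exhaustive′) = record
    { Graph       = Graph
    ; domain      = λ { (i , i< , refl , _) → nth-All in-orbit i< }
    ; codomain    = λ { (i , i< , _ , refl) → nth-All in-orbit′ (≤-trans i< (≤-reflexive (sym e))) }
    ; forward     = forward
    ; backward    = backward
    ; exhaustive  = λ ys ≤n alls → let w , (w≤ , w<) , o = exhaustive ys ≤n alls in
        pick xs w , pick xs′ w , graph w< , o
    ; exhaustive′ = λ ys ≤n alls → let w , (w≤ , w<) , o = exhaustive′ ys ≤n alls in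
        pick xs′ w , pick xs w , graph w< , o
    }
    where
    Graph : Tuple → Tuple → Set
    Graph c c′ = ∃[ i ] i < k × nth xs i ≡ c × nth xs′ i ≡ c′

    graph : ∀ {w} → All (_< k) w → Pointwise Graph (pick xs w) (pick xs′ w)
    graph []        = []
    graph (i< ∷ w<) = (_ , i< , refl , refl) ∷ graph w<

    word : ∀ {us us′} → Pointwise Graph us us′ → ∃[ w ] All (_< k) w × pick xs w ≡ us × pick xs′ w ≡ us′
    word [] = [] , [] , refl , refl
    word ((i , i< , refl , refl) ∷ hs) with word hs
    ... | w , w< , refl , refl = i ∷ w , i< ∷ w< , refl , refl

    short : ∀ {us : Tuples} {w xs} → pick xs w ≡ us → length us ≤ n → length w ≤ n
    short {w = w} {xs} refl ≤n = ≤-trans (≤-reflexive (sym (length-map (nth xs) w))) ≤n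

    forward : TransfersUpTo n Graph G G′
    forward p q ≤n o with word p | word q
    ... | v , v< , refl , refl | w , w< , refl , refl = fwd (E⇔′ v w word-v word-w) (bwd (E⇔ v w word-v word-w) o)
      where
      word-v = short {w = v} {xs} refl ≤n , v<
      word-w = short {w = w} {xs} refl (≤-trans (≤-reflexive (sym (Orbit-length o))) ≤n) , w<

    backward : TransfersUpTo n (flip Graph) G′ G
    backward p q ≤n o with word (flip-pointwise p) | word (flip-pointwise q)
    ... | v , v< , refl , refl | w , w< , refl , refl = fwd (E⇔ v w word-v word-w) (bwd (E⇔′ v w word-v word-w) o)
      where
      word-v = short {w = v} {xs′} refl ≤n , v<
      word-w = short {w = w} {xs′} refl (≤-trans (≤-reflexive (sym (Orbit-length o))) ≤n) , w<

  MatchingAt : (G G′ : Pred Perm 0ℓ) (t t′ : Tuple) (l : List (Tuple × Tuple)) → ℕ → Set₁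
  MatchingAt G G′ t t′ l n = Σ[ m ∈ Matching G G′ n t t′ ] All (uncurry (Matching.Graph m)) l

  module _ {G G′ : Pred Perm 0ℓ} (isSubgroup : IsSubgroup G) (isSubgroup′ : IsSubgroup G′) where
    private
      module S = IsSubgroup isSubgroup
      module S′ = IsSubgroup isSubgroup′
      module L = Laws isSubgroup
      module L′ = Laws isSubgroup′

    -- For every listed orbit of `G` that meets the graph one pair is kept together with its
    -- partner. A pair of translates for `G′` is represented by partners of some pair in the graph,
    -- and `forward` then puts it into the orbit of a kept partner. These are words of length 2.
    matching-pairBound : ∀ {n r t t′} → 2 ≤ n → Matching G G′ n t t′ → PairBound G r t → PairBound G′ r t′
    matching-pairBound {t′ = t′} 2≤n m (ps , short , cover) = map image qs
      , ≤-trans (≤-reflexive (length-map image qs)) (≤-trans (proj₁ (proj₂ reps)) short)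
      , λ c d t~c t~d → covers (exhaustive′ (c ∷ d ∷ []) 2≤n (t~c ∷ t~d ∷ []))
      where
      open Matching m

      Quadruple : Set
      Quadruple = (Tuple × Tuple) × (Tuple × Tuple)

      image : Quadruple → Tuple × Tuple
      image ((_ , c) , (_ , d)) = c , d

      Lifts : Tuple × Tuple → Quadruple → Set
      Lifts (p , q) ((c , c′) , (d , d′)) = Graph c c′ × Graph d d′ × Orbit G (p ∷ q ∷ []) (c ∷ d ∷ [])

      reps = representatives Lifts ps
      qs = proj₁ reps

      covers : ∀ {c d} → (∃[ us′ ] ∃[ us ] Pointwise Graph us us′ × Orbit G′ us′ (c ∷ d ∷ [])) →
        ∃[ p ] p ∈ map image qs × Orbit G′ (proj₁ p ∷ proj₂ p ∷ []) (c ∷ d ∷ [])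
      covers (_ , _ , h₁ ∷ h₂ ∷ [] , o) =
        let p , p∈ , o₁ = cover _ _ (domain h₁) (domain h₂)
            q , q∈ , k₁ , k₂ , o₂ = proj₂ (proj₂ (proj₂ reps)) p∈ (h₁ , h₂ , o₁)
        in image q , ∈-map⁺ image q∈ ,
          L′.Orbit-trans (forward (k₁ ∷ k₂ ∷ []) (h₁ ∷ h₂ ∷ []) 2≤n (L.Orbit-trans (L.Orbit-sym o₂) o₁)) o
      covers (_ , _ , [] , _ , _ , ())
      covers (_ , _ , _ ∷ [] , _ , _ , ())
      covers (_ , _ , _ ∷ _ ∷ _ ∷ _ , _ , _ , ())

    translate-orbit : ∀ {H} (isSubgroup : IsSubgroup H) {g} → H g → ∀ {us vs} →
      Orbit H us vs → Orbit H (g ·· us) (g ·· vs)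
    translate-orbit isSubgroup {g} g∈ o = Orbit-trans (Orbit-sym (g , g∈ , refl)) (Orbit-trans o (g , g∈ , refl))
      where open Laws isSubgroup

    untranslate-orbit : ∀ {H} (isSubgroup : IsSubgroup H) {g} → H g → ∀ {us vs} →
      Orbit H (g ·· us) (g ·· vs) → Orbit H us vs
    untranslate-orbit isSubgroup {g} g∈ o = Orbit-trans (g , g∈ , refl) (Orbit-trans o (Orbit-sym (g , g∈ , refl)))
      where open Laws isSubgroup

    -- A matching speaks of orbits only, so it may be translated independently on the two sides;
    -- this is how prescribed pairs are brought into the graph.
    module Move {n t t′} (m : Matching G G′ n t t′) {g g′} (g∈ : G g) (g′∈ : G′ g′) where
      open Matching m

      Graph′ : Tuple → Tuple → Set
      Graph′ d d′ = Graph (g ⁻¹ · d) (g′ ⁻¹ · d′)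

      private
        to-Graph : ∀ {us us′} → Pointwise Graph′ us us′ → Pointwise Graph (g ⁻¹ ·· us) (g′ ⁻¹ ·· us′)
        to-Graph []       = []
        to-Graph (h ∷ hs) = h ∷ to-Graph hs

        to-flip : ∀ {us′ us} → Pointwise (flip Graph′) us′ us →
          Pointwise (flip Graph) (g′ ⁻¹ ·· us′) (g ⁻¹ ·· us)
        to-flip p = flip-pointwise (to-Graph (flip-pointwise p))

        from-Graph : ∀ {us us′} → Pointwise Graph us us′ → Pointwise Graph′ (g ·· us) (g′ ·· us′)
        from-Graph []       = []
        from-Graph (h ∷ hs) = subst₂ Graph (sym (⁻¹-· g refl)) (sym (⁻¹-· g′ refl)) h ∷ from-Graph hs

        g⁻¹∈ = S.⁻¹-closed {g} g∈
        g′⁻¹∈ = S′.⁻¹-closed {g′} g′∈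

        translate-≤ : ∀ (h : Perm) {us : Tuples} → length us ≤ n → length (h ·· us) ≤ n
        translate-≤ h {us} = ≤-trans (≤-reflexive (length-map (h ·_) us))

      moved : Matching G G′ n t t′
      moved = record
        { Graph       = Graph′
        ; domain      = λ {c} h → L.Orbit-trans (domain h) (L.Orbit-sym (~-intro {g = g ⁻¹} g⁻¹∈ c))
        ; codomain    = λ {_} {c′} h → L′.Orbit-trans (codomain h) (L′.Orbit-sym (~-intro {g = g′ ⁻¹} g′⁻¹∈ c′))
        ; forward     = λ {us} p q ≤n o → untranslate-orbit isSubgroup′ {g′ ⁻¹} g′⁻¹∈
            (forward (to-Graph p) (to-Graph q) (translate-≤ (g ⁻¹) {us} ≤n) (translate-orbit isSubgroup {g ⁻¹} g⁻¹∈ o))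
        ; backward    = λ {us′} p q ≤n o → untranslate-orbit isSubgroup {g ⁻¹} g⁻¹∈
            (backward (to-flip p) (to-flip q) (translate-≤ (g′ ⁻¹) {us′} ≤n) (translate-orbit isSubgroup′ {g′ ⁻¹} g′⁻¹∈ o))
        ; exhaustive  = λ ys ≤n alls → let us , us′ , p , o = exhaustive ys ≤n alls in
            g ·· us , g′ ·· us′ , from-Graph p , L.Orbit-trans (L.Orbit-sym (g , g∈ , refl)) o
        ; exhaustive′ = λ ys ≤n alls → let us′ , us , p , o = exhaustive′ ys ≤n alls in
            g′ ·· us′ , g ·· us , from-Graph p , L′.Orbit-trans (L′.Orbit-sym (g′ , g′∈ , refl)) o
        }

      contains : ∀ l {us us′} → Pointwise Graph us us′ → g ·· us ≡ map proj₁ l → g′ ·· us′ ≡ map proj₂ l →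
        All (uncurry Graph′) l
      contains l p e e′ = go l (subst₂ (Pointwise Graph′) e e′ (from-Graph p))
        where
        go : ∀ l → Pointwise Graph′ (map proj₁ l) (map proj₂ l) → All (uncurry Graph′) l
        go []      []       = []
        go (_ ∷ l) (h ∷ hs) = h ∷ go l hs

    abstract
      matching-move : ∀ {n t t′} (m : Matching G G′ n t t′) {g g′} → G g → G′ g′ → ∀ l {us us′} →
        Pointwise (Matching.Graph m) us us′ → g ·· us ≡ map proj₁ l → g′ ·· us′ ≡ map proj₂ l →
        MatchingAt G G′ t t′ l n
      matching-move m {g} {g′} g∈ g′∈ l p e e′ =
        Move.moved m {g} {g′} g∈ g′∈ , Move.contains m {g} {g′} g∈ g′∈ l p e e′

  -- The pairs in `l` are kept if at every level some matching contains them; the matchings at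
  -- different levels need not cohere.
  PartialMatching : (G G′ : Pred Perm 0ℓ) (t t′ : Tuple) → List (Tuple × Tuple) → Set₁
  PartialMatching G G′ t t′ l = ∀ n → MatchingAt G G′ t t′ l n

  pointwise-pairs : ∀ {R : Tuple → Tuple → Set} {l} → All (uncurry R) l → Pointwise R (map proj₁ l) (map proj₂ l)
  pointwise-pairs []       = []
  pointwise-pairs (r ∷ rs) = r ∷ pointwise-pairs rs

  module _ {G G′ : Pred Perm 0ℓ} (isSubgroup : IsSubgroup G) (isSubgroup′ : IsSubgroup G′)
           (oligo′ : Oligomorphic G′) {t t′ : Tuple} where
    private
      module S = IsSubgroup isSubgroup
      module L′ = Laws isSubgroup′

    ExtendedMatching : List (Tuple × Tuple) → Tuple → ℕ → Set₁
    ExtendedMatching l y n = ∃[ y′ ] _~_ G′ t′ y′ × All (λ z → _~_ G′ t′ (proj₂ z)) l ×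
      MatchingAt G G′ t t′ ((y , y′) ∷ l) n

    -- A word of the graph represents the orbit of `y` followed by the sources in `l`. The tail of
    -- its partner is conjugate to the targets in `l` by `forward`, and translating by the two
    -- conjugating elements makes the matching contain `l` together with an image of `y`.
    extend-matching : ∀ {l y} → PartialMatching G G′ t t′ l → _~_ G t y → ∀ n → ExtendedMatching l y n
    extend-matching {l} {y} partial t~y n = extended (exhaustive (y ∷ map proj₁ l)
        (≤-trans (≤-reflexive (cong suc (length-map proj₁ l))) (m≤n⊔m n (suc (length l))))
        (t~y ∷ All.map⁺ (All.map domain alls)))
      where
      -- The word formed by `y` and the sources has `suc (length l)` letters, so the level is raised
      -- to cover it and lowered to `n` afterwards.
      N = n ⊔ suc (length l)
      m = proj₁ (partial N)
      alls = proj₂ (partial N)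
      open Matching m

      extended : (∃[ us ] ∃[ us′ ] Pointwise Graph us us′ × Orbit G us (y ∷ map proj₁ l)) → ExtendedMatching l y n
      extended (_ , _ , [] , _ , _ , ())
      extended (u ∷ us , u′ ∷ us′ , h ∷ hs , g , g∈ , e) = moved
        (forward hs (pointwise-pairs alls) us≤N (g , g∈ , proj₂ (∷-injective e)))
        where
        us≤N : length us ≤ N
        us≤N = ≤-trans (≤-reflexive (trans (sym (length-map (g ·_) us))
            (trans (cong length (proj₂ (∷-injective e))) (length-map proj₁ l))))
          (≤-trans (n≤1+n (length l)) (m≤n⊔m n (suc (length l))))

        moved : Orbit G′ us′ (map proj₂ l) → ExtendedMatching l y n
        moved (g′ , g′∈ , e′) = g′ · u′
          , L′.Orbit-trans (codomain h) (~-intro {G = G′} {g = g′} g′∈ u′) , All.map codomain alls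
          , matching-move isSubgroup isSubgroup′ (Matching-antitone (m≤m⊔n n (suc (length l))) m)
              {g} {g′} g∈ g′∈ ((y , g′ · u′) ∷ l) (h ∷ hs) e (cong (_ ∷_) e′)

    -- The image of `y` found above depends on the level, but only its orbit over the targets in `l`
    -- matters. Oligomorphy leaves finitely many candidates `cs`, and one of them works at every
    -- level.
    matching-forth : ∀ {l y} → PartialMatching G G′ t t′ l → _~_ G t y →
      ∃[ y′ ] PartialMatching G G′ t t′ ((y , y′) ∷ l)
    matching-forth {l} {y} partial t~y =
      let c , _ , matchings = uniformWitness (λ n c → MatchingAt G G′ t t′ ((y , c) ∷ l) n)
            (λ m≤n (m , alls) → Matching-antitone m≤n m , alls) cs candidate
      in c , matchings
      where
      l′ = map proj₂ l

      in-orbit′ : All (_~_ G′ t′) l′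
      in-orbit′ = All.map⁺ (proj₁ (proj₂ (proj₂ (extend-matching partial t~y 0))))

      reps = orbit-representatives isSubgroup′ oligo′ (λ c → concat (c ∷ l′)) (_~_ G′ t′)
        (suc (length l′) * length t′) (λ t~c → lengths (t~c ∷ in-orbit′))
        where open Laws using (orbit-representatives)
      cs = proj₁ reps

      replace : ∀ {n y′ c} → MatchingAt G G′ t t′ ((y , y′) ∷ l) n → Orbit G′ (y′ ∷ l′) (c ∷ l′) →
        MatchingAt G G′ t t′ ((y , c) ∷ l) n
      replace {c = c} (m , alls) (g , g∈ , e) = matching-move isSubgroup isSubgroup′ m {ε} {g} S.ε-closed g∈
        ((y , c) ∷ l) (pointwise-pairs alls) (trans (map-cong ε-· _) (map-id _)) e

      candidate : ∀ n → ∃[ c ] c ∈ cs × MatchingAt G G′ t t′ ((y , c) ∷ l) n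
      candidate n =
        let y′ , t~y′ , _ , matching = extend-matching partial t~y n
            c , c∈ , t~c , same = proj₂ (proj₂ reps) t~y′
        in c , c∈ , replace matching (L′.Orbit-sym
             (Orbit-concat (same-lengths (t~c ∷ in-orbit′) (t~y′ ∷ in-orbit′) refl) same))

  PartialMatching-sym : ∀ {G G′ t t′} l → PartialMatching G G′ t t′ l → PartialMatching G′ G t′ t (map swap l)
  PartialMatching-sym l partial n = let m , alls = partial n in Matching-sym m , All.map⁺ alls

  PartialMatching-unsym : ∀ {G G′ t t′} l → PartialMatching G′ G t′ t (map swap l) → PartialMatching G G′ t t′ l
  PartialMatching-unsym l partial n = let m , alls = partial n in Matching-sym m , All.map⁻ alls

  module _ {G G′ : Pred Perm 0ℓ} (isSubgroup : IsSubgroup G) (isSubgroup′ : IsSubgroup G′)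
           (oligo : Oligomorphic G) (oligo′ : Oligomorphic G′) {t t′ : Tuple} where

    matching-back : ∀ {l y′} → PartialMatching G G′ t t′ l → _~_ G′ t′ y′ →
      ∃[ y ] PartialMatching G G′ t t′ ((y , y′) ∷ l)
    matching-back {l} {y′} partial t~y′ =
      let y , partial′ = matching-forth isSubgroup′ isSubgroup oligo (PartialMatching-sym l partial) t~y′
      in y , PartialMatching-unsym ((y , y′) ∷ l) partial′

    module _ (matchings : ∀ n → Matching G G′ n t t′) where
      private
        open module Chain = BackAndForth Tuple-code Tuple-code (_~_ G t) (_~_ G′ t′) (PartialMatching G G′ t t′)
          (matching-forth isSubgroup isSubgroup′ oligo′) matching-back using (Stage; module Limit)

        start : Stage
        start = [] , λ n → matchings n , []

        Paired : Tuple → Tuple → Set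
        Paired c c′ = Limit.Graph start (c , c′)

        pairs : ∀ {us us′} → Pointwise Paired us us′ → Σ[ w ∈ List (Tuple × Tuple) ] All (Limit.Graph start) w ×
          (∀ {R : Tuple → Tuple → Set} → All (uncurry R) w → Pointwise R us us′)
        pairs [] = [] , [] , λ _ → []
        pairs (h ∷ hs) = let w , alls , p = pairs hs in _ ∷ w , h ∷ alls , λ { (r ∷ rs) → r ∷ p rs }

        abstract
          matched : ∀ n {us us′ vs vs′} → Pointwise Paired us us′ → Pointwise Paired vs vs′ →
            Σ[ m ∈ Matching G G′ n t t′ ] Pointwise (Matching.Graph m) us us′ × Pointwise (Matching.Graph m) vs vs′
          matched n p q =
            let v , all-v , p′ = pairs p ; w , all-w , q′ = pairs q
                l , partial , vw⊆l = Limit.finite-part start {v ++ w} (All.++⁺ all-v all-w)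
                m , alls = partial n
            in m , p′ {Matching.Graph m} (All.tabulate (λ z∈ → All.lookup alls (vw⊆l (∈-++⁺ˡ z∈))))
                 , q′ {Matching.Graph m} (All.tabulate (λ z∈ → All.lookup alls (vw⊆l (∈-++⁺ʳ v z∈))))

        domain : ∀ {c c′} → Paired c c′ → _~_ G t c
        domain h = let m , p , _ = matched 0 (h ∷ []) [] in Matching.domain m (Pointwise.head p)

        codomain : ∀ {c c′} → Paired c c′ → _~_ G′ t′ c′
        codomain h = let m , p , _ = matched 0 (h ∷ []) [] in Matching.codomain m (Pointwise.head p)

        forward : Transfers Paired G G′
        forward {us} p q o = let m , p′ , q′ = matched (length us) p q in Matching.forward m p′ q′ ≤-refl o

        backward : Transfers (flip Paired) G′ G
        backward {us} p q o =
          let m , p′ , q′ = matched (length us) (flip-pointwise p) (flip-pointwise q)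
          in Matching.backward m (flip-pointwise p′) (flip-pointwise q′) ≤-refl o

      matchings-similar : Similar G G′ t t′
      matchings-similar = record
        { Graph      = Paired
        ; domain     = domain
        ; codomain   = codomain
        ; total      = Limit.total start
        ; surjective = Limit.surjective start
        ; forward    = forward
        ; backward   = backward
        }

  -- Reconstruction of the topological isomorphism

  open ClosedSubgroup using (member; isSubgroup; Element; group)

  Sends : Perm → List (Tuple × Tuple) → Set
  Sends g = All λ (u , v) → g · u ≡ v

  sends-·· : ∀ g {ps} → Sends g ps → g ·· map proj₁ ps ≡ map proj₂ ps
  sends-·· g []       = refl
  sends-·· g (e ∷ es) = cong₂ _∷_ e (sends-·· g es)

  ··-sends : ∀ g ps → g ·· map proj₁ ps ≡ map proj₂ ps → Sends g ps
  ··-sends g []       e = []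
  ··-sends g (p ∷ ps) e = let e₁ , e₂ = ∷-injective e in e₁ ∷ ··-sends g ps e₂

  -- As t is a base, finitely many instances of T determine the value at a
  -- point x of any element of G inducing them.
  module Completion
    (G : ClosedSubgroup) {t : Tuple} (base : Base (member G) t) (T : Tuple → Tuple → Set)
    (total : ∀ {c} → _~_ (member G) t c → ∃ (T c))
    (surjective : ∀ {d} → _~_ (member G) t d → ∃ (flip T d))
    (approximate : ∀ {ps} → All (uncurry T) ps → ∃[ g ] member G g × Sends g ps)
    where
    open IsSubgroup (isSubgroup G)

    sources : ∀ {us} → All (_~_ (member G) t) us → ∃[ ps ] All (uncurry T) ps × map proj₁ ps ≡ us
    sources [] = [] , [] , refl
    sources (p ∷ ps) = let d , h = total p ; qs , hs , e = sources ps in _ ∷ qs , h ∷ hs , cong (_ ∷_) e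

    targets : ∀ {us} → All (_~_ (member G) t) us → ∃[ ps ] All (uncurry T) ps × map proj₂ ps ≡ us
    targets [] = [] , [] , refl
    targets (p ∷ ps) = let c , h = surjective p ; qs , hs , e = targets ps in _ ∷ qs , h ∷ hs , cong (_ ∷_) e

    module Source (x : ℕ) where
      points : ∃[ ps ] All (uncurry T) ps × map proj₁ ps ≡ proj₁ (base x)
      points = sources (proj₁ (proj₂ (base x)))

      g : ∃[ g ] member G g × Sends g (proj₁ points)
      g = approximate (proj₁ (proj₂ points))

      determined : ∀ {h} → member G h → Sends h (proj₁ points) → to h x ≡ to (proj₁ g) x
      determined {h} h∈ sends = base-agree (isSubgroup G) base {h} {proj₁ g} h∈ (proj₁ (proj₂ g))
        (subst (λ us → h ·· us ≡ proj₁ g ·· us) (proj₂ (proj₂ points))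
          (trans (sends-·· h sends) (sym (sends-·· (proj₁ g) (proj₂ (proj₂ g))))))

    module Target (y : ℕ) where
      points : ∃[ ps ] All (uncurry T) ps × map proj₂ ps ≡ proj₁ (base y)
      points = targets (proj₁ (proj₂ (base y)))

      g : ∃[ g ] member G g × Sends g (proj₁ points)
      g = approximate (proj₁ (proj₂ points))

      determined : ∀ {h} → member G h → Sends h (proj₁ points) → from h y ≡ from (proj₁ g) y
      determined {h} h∈ sends = base-agree (isSubgroup G) base {h ⁻¹} {proj₁ g ⁻¹}
        (⁻¹-closed {h} h∈) (⁻¹-closed {proj₁ g} (proj₁ (proj₂ g)))
        (subst (λ us → h ⁻¹ ·· us ≡ proj₁ g ⁻¹ ·· us) (proj₂ (proj₂ points))
          (trans (⁻¹-·· h (sends-·· h sends)) (sym (⁻¹-·· (proj₁ g) (sends-·· (proj₁ g) (proj₂ (proj₂ g)))))))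

    forth back : ℕ → ℕ
    forth x = to (proj₁ (Source.g x)) x
    back  y = from (proj₁ (Target.g y)) y

    -- One element meeting the constraints of both points has both values, whence `forth` and `back`
    -- are mutually inverse.
    forth-back : ∀ x y → ∃[ g ] to g x ≡ forth x × from g y ≡ back y
    forth-back x y =
      let g , g∈ , sends = approximate (All.++⁺ (proj₁ (proj₂ (Source.points x))) (proj₁ (proj₂ (Target.points y))))
      in g , Source.determined x {g} g∈ (All.++⁻ˡ (proj₁ (Source.points x)) sends)
           , Target.determined y {g} g∈ (All.++⁻ʳ (proj₁ (Source.points x)) sends)

    limit : Perm
    limit = mk↔ₛ′ forth back
      (λ y → let g , e , e′ = forth-back (back y) y in
        trans (sym e) (trans (cong (to g) (sym e′)) (strictlyInverseˡ g y)))
      (λ x → let g , e , e′ = forth-back x (forth x) in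
        trans (sym e′) (trans (cong (from g) (sym e)) (strictlyInverseʳ g x)))

    approximates : ∀ A {ps} → All (uncurry T) ps → ∃[ g ] member G g × g · A ≡ limit · A × Sends g ps
    approximates A {ps} alls =
      let qs , all′ , agrees = constraints A
          g , g∈ , sends = approximate (All.++⁺ all′ alls)
      in g , g∈ , agrees {g} g∈ (All.++⁻ˡ qs sends) , All.++⁻ʳ qs sends
      where
      constraints : ∀ A → ∃[ qs ] All (uncurry T) qs × (∀ {g} → member G g → Sends g qs → g · A ≡ limit · A)
      constraints [] = [] , [] , λ _ _ → refl
      constraints (x ∷ A) =
        let qs , alls , agrees = constraints A in
        proj₁ (Source.points x) ++ qs , All.++⁺ (proj₁ (proj₂ (Source.points x))) alls , λ {g} g∈ sends →
          cong₂ _∷_ (Source.determined x {g} g∈ (All.++⁻ˡ (proj₁ (Source.points x)) sends))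
                    (agrees {g} g∈ (All.++⁻ʳ (proj₁ (Source.points x)) sends))

    limit∈G : member G limit
    limit∈G = closed-approximation G {limit} λ A →
      let g , g∈ , e , _ = approximates A [] in g , g∈ , e

    limit-T : ∀ {c d} → T c d → limit · c ≡ d
    limit-T {c} {d} h with approximates c {(c , d) ∷ []} (h ∷ [])
    ... | g , _ , e , e′ ∷ [] = trans (sym e) e′

    abstract
      induced : ∃[ g ] member G g × (∀ {c d} → T c d → g · c ≡ d)
      induced = limit , limit∈G , limit-T

  module Transfer (G G′ : ClosedSubgroup) {t t′ : Tuple}
    (s : Similar (member G) (member G′) t t′) (base′ : Base (member G′) t′) where
    open Similar s
    private
      module S = IsSubgroup (isSubgroup G)
      module L = Laws (isSubgroup G)

    Compatible : Perm → Perm → Set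
    Compatible g g′ = ∀ {c c′} → Graph c c′ → Graph (g · c) (g′ · c′)

    functional : ∀ {c c′ d′} → Graph c c′ → Graph c d′ → c′ ≡ d′
    functional h h′ with forward (h ∷ h ∷ []) (h ∷ h′ ∷ []) (L.Orbit-refl _)
    ... | g , _ , e = let e₁ , e₂ = ∷-injective e in trans (sym e₁) (∷-injectiveˡ e₂)

    -- Carried through `Graph`, the action of `g` becomes the relation `T` on translates of `t′`. By
    -- `forward` finite parts of it are induced by elements of `G′`, so the completion yields one
    -- element inducing all of it.
    image : ∀ {g} → member G g → ∃[ g′ ] member G′ g′ × Compatible g g′
    image {g} g∈ = proj₁ induced , proj₁ (proj₂ induced) , λ {c} {c′} h →
      let d′ , h′ = total (L.Orbit-trans (domain h) (~-intro {g = g} g∈ c)) in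
      subst (Graph (g · c)) (sym (proj₂ (proj₂ induced) (c , h , h′))) h′
      where
      T : Tuple → Tuple → Set
      T c′ d′ = ∃[ c ] Graph c c′ × Graph (g · c) d′

      T-pointwise : ∀ {ps} → All (uncurry T) ps →
        ∃[ cs ] Pointwise Graph cs (map proj₁ ps) × Pointwise Graph (g ·· cs) (map proj₂ ps)
      T-pointwise [] = [] , [] , []
      T-pointwise ((c , h , h′) ∷ ts) = let cs , hs , hs′ = T-pointwise ts in c ∷ cs , h ∷ hs , h′ ∷ hs′

      g-g⁻¹ : ∀ d → g · (g ⁻¹ · d) ≡ d
      g-g⁻¹ d = trans (sym (map-∘ d)) (trans (map-cong (strictlyInverseˡ g) d) (map-id d))

      T-total : ∀ {c′} → _~_ (member G′) t′ c′ → ∃ (T c′)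
      T-total t~c′ =
        let c , h = surjective t~c′
            d′ , h′ = total (L.Orbit-trans (domain h) (~-intro {g = g} g∈ c))
        in d′ , c , h , h′

      T-surjective : ∀ {d′} → _~_ (member G′) t′ d′ → ∃ (flip T d′)
      T-surjective t~d′ =
        let d , h = surjective t~d′
            c′ , h′ = total (L.Orbit-trans (domain h) (~-intro {g = g ⁻¹} (S.⁻¹-closed {g} g∈) d))
        in c′ , g ⁻¹ · d , h′ , subst (λ e → Graph e _) (sym (g-g⁻¹ d)) h

      T-approximate : ∀ {ps} → All (uncurry T) ps → ∃[ g′ ] member G′ g′ × Sends g′ ps
      T-approximate {ps} ts =
        let cs , hs , hs′ = T-pointwise ts
            g′ , g′∈ , e = forward hs hs′ (g , g∈ , refl)
        in g′ , g′∈ , ··-sends g′ ps e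

      open Completion G′ base′ T T-total T-surjective T-approximate using (induced)

    -- A point of `A′` is determined by finitely many translates of `t′`; the entries of the
    -- translates of `t` paired with them go into `A`. Both uniqueness of the image and continuity
    -- follow.
    determined : ∀ A′ → ∃[ A ] (∀ {g h g′ h′} → member G′ g′ → member G′ h′ →
      Compatible g g′ → Compatible h h′ → g · A ≡ h · A → g′ · A′ ≡ h′ · A′)
    determined [] = [] , λ _ _ _ _ _ → refl
    determined (x ∷ A′) =
      let A , det = determined A′
          cs , hs = Similar.total* (Similar-sym s) (proj₁ (proj₂ (base′ x)))
      in concat cs ++ A , λ {g} {h} {g′} {h′} g′∈ h′∈ comp comp′ e →
        let agree : ∀ {y} → y ∈ concat cs ++ A → to g y ≡ to h y
            agree = ·-∈ g h (concat cs ++ A) e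
        in cong₂ _∷_
          (base-agree (isSubgroup G′) base′ {g′} {h′} g′∈ h′∈
            (translates {g} {h} {g′} {h′} comp comp′ (λ y∈ → agree (∈-++⁺ˡ y∈)) (flip-pointwise hs)))
          (det {g} {h} {g′} {h′} g′∈ h′∈ comp comp′ (·-cong-∈ g h A (λ y∈ → agree (∈-++⁺ʳ (concat cs) y∈))))
      where
      translates : ∀ {g h g′ h′} → Compatible g g′ → Compatible h h′ → ∀ {cs us} →
        (∀ {y} → y ∈ concat cs → to g y ≡ to h y) → Pointwise Graph cs us → g′ ·· us ≡ h′ ·· us
      translates comp comp′ agree [] = refl
      translates {g} {h} {g′} {h′} comp comp′ {c ∷ cs} {u ∷ us} agree (p ∷ ps) = cong₂ _∷_
        (functional (subst (λ d → Graph d (g′ · u)) (·-cong-∈ g h c (λ y∈ → agree (∈-++⁺ˡ y∈))) (comp p)) (comp′ p))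
        (translates {g} {h} {g′} {h′} comp comp′ (λ y∈ → agree (∈-++⁺ʳ c y∈)) ps)

    unique : ∀ (x y : Element G) (x′ y′ : Element G′) → Compatible (proj₁ x) (proj₁ x′) →
      Compatible (proj₁ y) (proj₁ y′) → proj₁ x ≈ₚ proj₁ y → proj₁ x′ ≈ₚ proj₁ y′
    unique (g , _) (h , _) (g′ , g′∈) (h′ , h′∈) comp comp′ g≈h n = ∷-injectiveˡ
      (proj₂ (determined (n ∷ [])) {g} {h} {g′} {h′} g′∈ h′∈ comp comp′ (map-cong g≈h _))

    compatible-∙ : ∀ {g h g′ h′} → Compatible g g′ → Compatible h h′ → Compatible (g ∙ h) (g′ ∙ h′)
    compatible-∙ {g} {h} {g′} {h′} comp comp′ {c} {c′} p =
      subst₂ Graph (sym (∙-· g h c)) (sym (∙-· g′ h′ c′)) (comp (comp′ p))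

    compatible-ε : Compatible ε ε
    compatible-ε {c} {c′} p = subst₂ Graph (sym (ε-· c)) (sym (ε-· c′)) p

    compatible-⁻¹ : ∀ {g g′} → member G g → Compatible g g′ → Compatible (g ⁻¹) (g′ ⁻¹)
    compatible-⁻¹ {g} {g′} g∈ comp {c} {c′} p =
      let d′ , q = total (L.Orbit-trans (domain p) (~-intro {g = g ⁻¹} (S.⁻¹-closed {g} g∈) c))
          r = subst (λ e → Graph e (g′ · d′))
                (trans (sym (map-∘ c)) (trans (map-cong (strictlyInverseˡ g) c) (map-id c))) (comp q)
      in subst (Graph (g ⁻¹ · c)) (sym (⁻¹-· g′ (functional r p))) q

    continuous : (f : Element G → Element G′) → (∀ e → Compatible (proj₁ e) (proj₁ (f e))) →
      Continuous (ClosedSubgroup.perm G) (ClosedSubgroup.perm G′) f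
    continuous f comp open-U {e} u =
      let A′ , inside = open-U u
          A , det = determined A′
      in A , λ {e′} agree → inside {f e′} (·-∈ (proj₁ (f e′)) (proj₁ (f e)) A′
        (det {proj₁ e′} {proj₁ e} {proj₁ (f e′)} {proj₁ (f e)} (proj₂ (f e′)) (proj₂ (f e)) (comp e′) (comp e)
          (·-cong-∈ (proj₁ e′) (proj₁ e) A agree)))

  -- Every law is an instance of `unique`: both sides are compatible with the same element of the
  -- other group.
  similar⇒isomorphic : ∀ (G G′ : ClosedSubgroup) {t t′} → Similar (member G) (member G′) t t′ →
    Base (member G) t → Base (member G′) t′ → TopologicalIsomorphism G G′
  similar⇒isomorphic G G′ s base base′ = record
    { bijection = record
      { to        = f
      ; from      = b
      ; to-cong   = λ {x} {y} → f-cong x y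
      ; from-cong = λ {x} {y} → B.unique x y (b x) (b y) (b-comp x) (b-comp y)
      ; inverse   = (λ {x} {y} → F.unique y (b x) (f y) x (f-comp y) (λ p → b-comp x p))
                  , (λ {x} {y} → B.unique y (f x) (b y) x (b-comp y) (λ p → f-comp x p))
      }
    ; isGroupHomomorphism = record
      { isMonoidHomomorphism = record
        { isMagmaHomomorphism = record
          { isRelHomomorphism = record { cong = λ {x} {y} → f-cong x y }
          ; homo = λ x y → F.unique (x ∘G y) (x ∘G y) (f (x ∘G y)) (f x ∘G′ f y) (f-comp (x ∘G y))
              (F.compatible-∙ {proj₁ x} {proj₁ y} {proj₁ (f x)} {proj₁ (f y)} (f-comp x) (f-comp y)) (λ _ → refl)
          }
        ; ε-homo = F.unique εG εG (f εG) εG′ (f-comp εG) F.compatible-ε (λ _ → refl)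
        }
      ; ⁻¹-homo = λ x → F.unique (invG x) (invG x) (f (invG x)) (invG′ (f x)) (f-comp (invG x))
          (F.compatible-⁻¹ {proj₁ x} {proj₁ (f x)} (proj₂ x) (f-comp x)) (λ _ → refl)
      }
    ; to-continuous   = F.continuous f f-comp
    ; from-continuous = B.continuous b b-comp
    }
    where
    module F = Transfer G G′ s base′
    module B = Transfer G′ G (Similar-sym s) base
    open Group (group G) using () renaming (_∙_ to _∘G_; ε to εG; _⁻¹ to invG)
    open Group (group G′) using () renaming (_∙_ to _∘G′_; ε to εG′; _⁻¹ to invG′)

    f : Element G → Element G′
    f (g , g∈) = let g′ , g′∈ , _ = F.image {g} g∈ in g′ , g′∈

    b : Element G′ → Element G
    b (g , g∈) = let g′ , g′∈ , _ = B.image {g} g∈ in g′ , g′∈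

    f-comp : ∀ e → F.Compatible (proj₁ e) (proj₁ (f e))
    f-comp (g , g∈) = proj₂ (proj₂ (F.image {g} g∈))

    b-comp : ∀ e → B.Compatible (proj₁ e) (proj₁ (b e))
    b-comp (g , g∈) = proj₂ (proj₂ (B.image {g} g∈))

    f-cong : ∀ x y → proj₁ x ≈ₚ proj₁ y → proj₁ (f x) ≈ₚ proj₁ (f y)
    f-cong x y = F.unique x y (f x) (f y) (f-comp x) (f-comp y)

  -- Invariance under topological isomorphism

  module Isomorphism {G G′ : ClosedSubgroup} (φ : TopologicalIsomorphism G G′) where
    private
      module φ = TopologicalIsomorphism φ
      module hom = IsGroupHomomorphism φ.isGroupHomomorphism
      module S = IsSubgroup (isSubgroup G)
      module S′ = IsSubgroup (isSubgroup G′)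
    open Group (group G) public using () renaming (_∙_ to _⋆_; ε to e₀; _⁻¹ to _⁻)

    image : Element G → Element G′
    image = Inverse.to φ.bijection

    preimage : Element G′ → Element G
    preimage = Inverse.from φ.bijection

    infixr 6 _▹_
    _▹_ : Element G → Tuple → Tuple
    x ▹ u = proj₁ (image x) · u

    image-preimage : ∀ y u → preimage y ▹ u ≡ proj₁ y · u
    image-preimage y = map-cong (proj₁ (Inverse.inverse φ.bijection) {y} {preimage y} (λ _ → refl))

    preimage-image : ∀ x u → proj₁ (preimage (image x)) · u ≡ proj₁ x · u
    preimage-image x = map-cong (proj₂ (Inverse.inverse φ.bijection) {x} {image x} (λ _ → refl))

    ▹-cong : ∀ {x y} → proj₁ x ≈ₚ proj₁ y → ∀ u → x ▹ u ≡ y ▹ u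
    ▹-cong {x} {y} e = map-cong (Inverse.to-cong φ.bijection {x} {y} e)

    ▹-⋆ : ∀ x y u → (x ⋆ y) ▹ u ≡ x ▹ (y ▹ u)
    ▹-⋆ x y u = trans (map-cong (hom.homo x y) u) (∙-· (proj₁ (image x)) (proj₁ (image y)) u)

    ▹-ε : ∀ u → e₀ ▹ u ≡ u
    ▹-ε u = trans (map-cong hom.ε-homo u) (ε-· u)

    ▹-⁻ : ∀ x {u v} → x ▹ u ≡ v → (x ⁻) ▹ v ≡ u
    ▹-⁻ x {u} {v} e = trans (map-cong (hom.⁻¹-homo x) v) (⁻¹-· (proj₁ (image x)) e)

    ▹-open : ∀ K′ → ∃[ A ] (∀ x → proj₁ x · A ≡ A → x ▹ K′ ≡ K′)
    ▹-open K′ =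
      let A , inside = φ.to-continuous {λ y → proj₁ y · K′ ≡ K′}
            (λ {y} fix → K′ , λ {z} agree → trans (·-cong-∈ (proj₁ z) (proj₁ y) K′ agree) fix) {e₀} (▹-ε K′)
      in A , λ x fix → inside {x} (fixes-∈ (proj₁ x) A fix)

    -- The preimage of the pointwise stabilizer of `K′`. The membership proof is bundled because the
    -- isomorphism acts on elements with proofs; `▹-cong` shows that the choice of proof does not
    -- affect the action.
    Fixer : Tuple → Pred Perm 0ℓ
    Fixer K′ g = Σ[ g∈ ∈ member G g ] (g , g∈) ▹ K′ ≡ K′

    fixer-isSubgroup : ∀ K′ → IsSubgroup (Fixer K′)
    fixer-isSubgroup K′ = record
      { respects  = λ {g} {h} g≈h (g∈ , fix) → S.respects {g} {h} g≈h g∈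
          , trans (sym (▹-cong {g , g∈} {h , S.respects {g} {h} g≈h g∈} g≈h K′)) fix
      ; ε-closed  = S.ε-closed , ▹-ε K′
      ; ∙-closed  = λ {g} {h} (g∈ , fix) (h∈ , fix′) → S.∙-closed {g} {h} g∈ h∈
          , trans (▹-⋆ (g , g∈) (h , h∈) K′) (trans (cong ((g , g∈) ▹_) fix′) fix)
      ; ⁻¹-closed = λ {g} (g∈ , fix) → S.⁻¹-closed {g} g∈ , ▹-⁻ (g , g∈) fix
      }

    fixer-intro : ∀ x {K′} → x ▹ K′ ≡ K′ → Fixer K′ (proj₁ x)
    fixer-intro (_ , g∈) fix = g∈ , fix

    fixer-elim : ∀ x {K′} → Fixer K′ (proj₁ x) → x ▹ K′ ≡ K′
    fixer-elim x {K′} (g∈ , fix) = trans (▹-cong {x} {proj₁ x , g∈} (λ _ → refl) K′) fix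

    fixer-open : ∀ K′ → ∃[ A ] pointwise (member G) A ⊆ Fixer K′
    fixer-open K′ = let A , inside = ▹-open K′ in
      A , λ {g} (g∈ , fix) → g∈ , inside (g , g∈) (∈-fixes g A fix)

    module Translates {t t′ : Tuple} (fixes : ∀ x → proj₁ x · t ≡ t → x ▹ t′ ≡ t′) where

      Graph : Tuple → Tuple → Set
      Graph c c′ = ∃[ x ] proj₁ x · t ≡ c × x ▹ t′ ≡ c′

      -- Both `z ⋆ x` and `y` take `t` to the same translate, so they differ by an element fixing
      -- `t`, whose image fixes `t′`.
      equivariant : ∀ {c c′ d d′} → Graph c c′ → Graph d d′ → ∀ z → proj₁ z · c ≡ d → z ▹ c′ ≡ d′
      equivariant (x , refl , refl) (y , refl , refl) z e = begin
        z ▹ (x ▹ t′)                     ≡⟨ sym (▹-⋆ z x t′) ⟩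
        (z ⋆ x) ▹ t′                     ≡⟨ ▹-cong {z ⋆ x} {y ⋆ ((y ⁻) ⋆ (z ⋆ x))}
                                               (λ a → sym (strictlyInverseˡ (proj₁ y) _)) t′ ⟩
        (y ⋆ ((y ⁻) ⋆ (z ⋆ x))) ▹ t′     ≡⟨ ▹-⋆ y ((y ⁻) ⋆ (z ⋆ x)) t′ ⟩
        y ▹ (((y ⁻) ⋆ (z ⋆ x)) ▹ t′)     ≡⟨ cong (y ▹_) (fixes ((y ⁻) ⋆ (z ⋆ x)) fix) ⟩
        y ▹ t′                           ∎
        where
        open ≡-Reasoning

        fix : (proj₁ y ⁻¹ ∙ (proj₁ z ∙ proj₁ x)) · t ≡ t
        fix = trans (∙-· (proj₁ y ⁻¹) (proj₁ z ∙ proj₁ x) t)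
          (⁻¹-· (proj₁ y) (sym (trans (∙-· (proj₁ z) (proj₁ x) t) e)))

      equivariant* : ∀ {us us′ vs vs′} → Pointwise Graph us us′ → Pointwise Graph vs vs′ →
        ∀ z → proj₁ z ·· us ≡ vs → map (z ▹_) us′ ≡ vs′
      equivariant* [] [] z e = refl
      equivariant* (p ∷ ps) (q ∷ qs) z e = let e₁ , e₂ = ∷-injective e in
        cong₂ _∷_ (equivariant p q z e₁) (equivariant* ps qs z e₂)

  TopologicalIsomorphism-sym : ∀ {G G′} → TopologicalIsomorphism G G′ → TopologicalIsomorphism G′ G
  TopologicalIsomorphism-sym {G} {G′} φ = record
    { bijection = record
      { to        = b
      ; from      = f
      ; to-cong   = λ {x} {y} → b-cong {x} {y}
      ; from-cong = λ {x} {y} → Inverse.to-cong φ.bijection {x} {y}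
      ; inverse   = (λ {x} {y} → proj₂ (Inverse.inverse φ.bijection) {x} {y})
                  , (λ {x} {y} → proj₁ (Inverse.inverse φ.bijection) {x} {y})
      }
    ; isGroupHomomorphism = record
      { isMonoidHomomorphism = record
        { isMagmaHomomorphism = record
          { isRelHomomorphism = record { cong = λ {x} {y} → b-cong {x} {y} }
          ; homo = λ x y → b-unique (b x ⋆ b y) (x ⋆′ y) λ n → trans (hom.homo (b x) (b y) n)
              (trans (cong (to (proj₁ (f (b x)))) (f-b y n)) (f-b x (to (proj₁ y) n)))
          }
        ; ε-homo = b-unique e₀ e₀′ hom.ε-homo
        }
      ; ⁻¹-homo = λ x → b-unique (b x ⁻) (x ⁻′) λ n → trans (hom.⁻¹-homo (b x) n)
          (Group.⁻¹-cong (group G′) {f (b x)} {x} (f-b x) n)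
      }
    ; to-continuous   = φ.from-continuous
    ; from-continuous = φ.to-continuous
    }
    where
    module φ = TopologicalIsomorphism φ
    module hom = IsGroupHomomorphism φ.isGroupHomomorphism
    open Group (group G) using () renaming (_∙_ to _⋆_; ε to e₀; _⁻¹ to _⁻)
    open Group (group G′) using () renaming (_∙_ to _⋆′_; ε to e₀′; _⁻¹ to _⁻′)
    f = Inverse.to φ.bijection
    b = Inverse.from φ.bijection

    b-cong : ∀ {x y} → proj₁ x ≈ₚ proj₁ y → proj₁ (b x) ≈ₚ proj₁ (b y)
    b-cong {x} {y} = Inverse.from-cong φ.bijection {x} {y}

    f-b : ∀ y → proj₁ (f (b y)) ≈ₚ proj₁ y
    f-b y = proj₁ (Inverse.inverse φ.bijection) {y} {b y} (λ _ → refl)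

    b-unique : ∀ x y → proj₁ (f x) ≈ₚ proj₁ y → proj₁ (b y) ≈ₚ proj₁ x
    b-unique x y e = proj₂ (Inverse.inverse φ.bijection) {x} {y} (λ n → sym (e n))

  module _ {G G′ : ClosedSubgroup} (φ : TopologicalIsomorphism G G′) where
    private
      φ⁻¹ = TopologicalIsomorphism-sym φ
      module F = Isomorphism φ
      module B = Isomorphism φ⁻¹
      module S = IsSubgroup (isSubgroup G)

    -- The pointwise stabilizers of finite algebraically closed sets are the
    -- open subgroups without proper open subgroups of finite index.
    stabilizer-image : WeakElimination (member G) → WeakElimination (member G′) →
      ∀ {K} → AlgebraicallyClosed (member G) K →
      ∃[ K′ ] AlgebraicallyClosed (member G′) K′ ×
        (∀ x → proj₁ x · K ≡ K ⇔ proj₁ (F.image x) · K′ ≡ K′)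
    stabilizer-image weak weak′ {K} closed = K′ , proj₁ supports , λ x → mk⇔
        (λ fix → F.fixer-elim x (proj₁ (proj₂ supports″) {proj₁ x}
          (proj₂ x , λ y∈ → fixes-∈ (proj₁ x) K fix (K″⊆K y∈))))
        (λ fix → trans (sym (F.preimage-image x K))
          (B.fixer-elim (F.image x) (proj₁ (proj₂ supports) {proj₁ (F.image x)}
            (proj₂ (F.image x) , fixes-∈ (proj₁ (F.image x)) K′ fix))))
      where
      support = weak′ (B.Fixer K) (B.fixer-isSubgroup K) proj₁ (B.fixer-open K)
      K′ = proj₁ support
      supports : Supports (member G′) (B.Fixer K) K′
      supports = proj₁ (proj₁ (proj₂ support))

      support″ = weak (F.Fixer K′) (F.fixer-isSubgroup K′) proj₁ (F.fixer-open K′)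
      K″ = proj₁ support″
      supports″ : Supports (member G) (F.Fixer K′) K″
      supports″ = proj₁ (proj₁ (proj₂ support″))

      -- The image of G_(K) lies in the setwise stabilizer of `K′`, so it moves `K′` to finitely
      -- many tuples only.
      image∈ : ∀ {x} → proj₁ x · K ≡ K → F._▹_ x K′ ∈ words K′ (length K′)
      image∈ {x} fix = subst (λ n → F._▹_ x K′ ∈ words K′ n) (length-map _ K′)
        (∈-words (All.tabulate λ y∈ →
          let z , z∈ , e = ∈-map⁻ (to (proj₁ (F.image x))) y∈
              _ , stab = proj₂ (proj₂ supports) {proj₁ (F.image x)}
                (B.fixer-intro (F.image x) (trans (F.preimage-image x K) fix))
          in subst (_∈ K′) (sym e) (fwd stab z∈)))

      -- By `image∈` the preimage of the pointwise stabilizer of `K′` has finite index in G_(K). As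
      -- it stabilises `K″` setwise, the points of `K″` have finite orbits under G_(K), and `K` is
      -- closed.
      K″⊆K : K″ List.⊆ K
      K″⊆K {y} y∈ = closed (let orbit , o = finite in orbit , λ {g} (g∈ , fix) → o {g , g∈} (∈-fixes g K fix))
        where
        open F using (_▹_; _⋆_; _⁻)

        finite = finite-orbit {A = Element G} proj₁ (λ x → proj₁ x · K ≡ K) (_▹ K′) (words K′ (length K′)) {y} K″
          (λ {x} → image∈ {x})
          λ {g} {h} fix-g fix-h e → fwd (proj₂ (proj₂ (proj₂ supports″) {proj₁ ((h ⁻) ⋆ g)}
            (F.fixer-intro ((h ⁻) ⋆ g) (trans (F.▹-⋆ (h ⁻) g K′) (F.▹-⁻ h (sym e)))))) y∈

    module _ {t t′ : Tuple} (fixes : ∀ x → proj₁ x · t ≡ t ⇔ proj₁ (F.image x) · t′ ≡ t′) where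
      private
        fixes⁻¹ : ∀ y → proj₁ y · t′ ≡ t′ → proj₁ (F.preimage y) · t ≡ t
        fixes⁻¹ y fix = bwd (fixes (F.preimage y)) (trans (F.image-preimage y t′) fix)

        module FT = F.Translates {t} {t′} (λ x → fwd (fixes x))
        module BT = B.Translates {t′} {t} fixes⁻¹

        flip-graph : ∀ {c c′} → FT.Graph c c′ → BT.Graph c′ c
        flip-graph (x , e , e′) = F.image x , e′ , trans (F.preimage-image x t) e

        flip-graph* : ∀ {us us′} → Pointwise FT.Graph us us′ → Pointwise BT.Graph us′ us
        flip-graph* []       = []
        flip-graph* (p ∷ ps) = flip-graph p ∷ flip-graph* ps

      isomorphic⇒similar : Similar (member G) (member G′) t t′
      isomorphic⇒similar = record
        { Graph      = FT.Graph
        ; domain     = λ { (x , refl , _) → ~-intro {g = proj₁ x} (proj₂ x) t }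
        ; codomain   = λ { (x , _ , refl) → ~-intro {g = proj₁ (F.image x)} (proj₂ (F.image x)) t′ }
        ; total      = λ t~c → let g , g∈ , e = ~-elim t~c in _ , (g , g∈) , e , refl
        ; surjective = λ t~c′ → let g , g∈ , e = ~-elim t~c′ in
            _ , F.preimage (g , g∈) , refl , trans (F.image-preimage (g , g∈) t′) e
        ; forward    = λ { p q (g , g∈ , e) → proj₁ (F.image (g , g∈)) , proj₂ (F.image (g , g∈))
                         , FT.equivariant* p q (g , g∈) e }
        ; backward   = λ { p q (g , g∈ , e) → proj₁ (B.image (g , g∈)) , proj₂ (B.image (g , g∈))
                         , BT.equivariant* (flip-graph* (flip-pointwise p)) (flip-graph* (flip-pointwise q)) (g , g∈) e }
        }

      -- By continuity, an element of `G` fixing a suitable finite `A` has an image fixing `x`.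
      -- Finitely many translates of `t` determine `A`, and their partners determine `x`.
      base-image : Base (member G) t → Base (member G′) t′
      base-image base x =
        let A , inside = F.▹-open (x ∷ [])
            us , in-orbit , determine = translates A
            us′ , ps = Similar.total* isomorphic⇒similar in-orbit
        in base-intro (Similar.codomain* isomorphic⇒similar ps) λ {h} h∈ e →
             let z = F.preimage (h , h∈)
                 e′ = BT.equivariant* (flip-graph* ps) (flip-graph* ps) (h , h∈) e
             in ∷-injectiveˡ (trans (sym (F.image-preimage (h , h∈) (x ∷ [])))
                  (inside z (determine {proj₁ z} (proj₂ z) e′)))
        where
        translates : ∀ A → ∃[ us ] All (_~_ (member G) t) us ×
          (∀ {g} → member G g → g ·· us ≡ us → g · A ≡ A)
        translates [] = [] , [] , λ _ _ → refl
        translates (a ∷ A) =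
          let us , in-orbit , determine = translates A
              vs = proj₁ (base a)
          in vs ++ us , All.++⁺ (proj₁ (proj₂ (base a))) in-orbit , λ {g} g∈ e →
               let e₁ , e₂ = ++-split (g ·· vs) vs (length-map (g ·_) vs) (trans (sym (map-++ (g ·_) vs us)) e) in
               cong₂ _∷_ (base-fixes base {g} g∈ e₁) (determine {g} g∈ e₂)

    occurs-isomorphic : WeakElimination (member G) → WeakElimination (member G′) →
      ∀ {p} → Occurs (member G) p → Occurs (member G′) p
    occurs-isomorphic weak weak′ (t , closed , _ , base , realises) =
      let K′ , closed′ , fixes = stabilizer-image weak weak′ closed
          -- The support may have repeated entries; removing them keeps the pointwise stabilizer,
          -- which depends only on the underlying set.
          t′ , closed″ , unique , K′⊆t′ , t′⊆K′ = GroupAction.closed-unique (isSubgroup G′) closed′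
          fixes′ : ∀ x → proj₁ x · t ≡ t ⇔ proj₁ (F.image x) · t′ ≡ t′
          fixes′ x = mk⇔
            (λ e → fixes-⊆ (proj₁ (F.image x)) K′ t′ t′⊆K′ (fwd (fixes x) e))
            (λ e → bwd (fixes x) (fixes-⊆ (proj₁ (F.image x)) t′ K′ K′⊆t′ e))
      in t′ , closed″ , unique , base-image fixes′ base , realises-similar (isomorphic⇒similar fixes′) realises
      where
      fixes-⊆ : ∀ g u v → v List.⊆ u → g · u ≡ u → g · v ≡ v
      fixes-⊆ g u v v⊆u e = ∈-fixes g v λ x∈ → fixes-∈ g u e (v⊆u x∈)

  -- Completeness of the invariant

  occurs⇒isomorphic : (G G′ : ClosedSubgroup) → Oligomorphic (member G) → Oligomorphic (member G′) →
    (∀ p → Occurs (member G) p → Occurs (member G′) p) → TopologicalIsomorphism G G′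
  occurs⇒isomorphic G G′ oligo oligo′ occurs =
    similar⇒isomorphic G G′
      (matchings-similar (isSubgroup G) (isSubgroup G′) oligo oligo′ (λ n → proj₂ (matched n)))
      base (proj₁ (matched 0))
    where
    module A = GroupAction (isSubgroup G)
    module A′ = GroupAction (isSubgroup G′)
    module L′ = Laws (isSubgroup G′)

    existing = A.base-exists oligo
    t = proj₁ existing
    base = proj₂ (proj₂ (proj₂ existing))
    r = proj₁ (A.pairBound oligo t)
    N = proj₁ (A′.length-bound oligo′ r)
    candidates = A′.tuples-upTo oligo′ N

    matching-resp : ∀ {n t′ t₀} → _~_ (member G′) t₀ t′ →
      Matching (member G) (member G′) n t t′ → Matching (member G) (member G′) n t t₀
    matching-resp t₀~t′ m = record
      { Graph       = Graph
      ; domain      = domain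
      ; codomain    = λ h → L′.Orbit-trans t₀~t′ (codomain h)
      ; forward     = forward
      ; backward    = backward
      ; exhaustive  = exhaustive
      ; exhaustive′ = λ ys ≤n alls → exhaustive′ ys ≤n (All.map (L′.Orbit-trans (L′.Orbit-sym t₀~t′)) alls)
      }
      where open Matching m

    -- The number of orbits on pairs of translates is visible in a pattern
    -- with n ≥ 2, so t′ ranges over finitely many orbits as n varies.
    candidate : ∀ n → ∃[ t₀ ] t₀ ∈ proj₁ candidates ×
      (Base (member G′) t₀ × Matching (member G) (member G′) n t t₀)
    candidate n =
      let k , E , realises = realised-pattern (isSubgroup G) oligo t (2 + n)
          t′ , _ , unique , base′ , realises′ = occurs (2 + n , k , E)
            (t , proj₁ (proj₂ existing) , proj₁ (proj₂ (proj₂ existing)) , base , realises)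
          m = realises-matching realises realises′
          bound = matching-pairBound (isSubgroup G) (isSubgroup G′) (s≤s (s≤s z≤n)) m (proj₂ (A.pairBound oligo t))
          t₀ , t₀∈ , t₀~t′ = proj₂ candidates t′ (proj₂ (A′.length-bound oligo′ r) t′ unique bound)
      in t₀ , t₀∈ , A′.base-move (L′.Orbit-sym t₀~t′) base′
         , Matching-antitone (m≤n+m n 2) (matching-resp t₀~t′ m)

    uniform = uniformWitness (λ n t₀ → Base (member G′) t₀ × Matching (member G) (member G′) n t t₀)
      (λ m≤n (base′ , m) → base′ , Matching-antitone m≤n m) (proj₁ candidates) candidate
    matched = proj₂ (proj₂ uniform)

  pattern-number : ℕ → Pattern
  pattern-number = decode Pattern-code (0 , 0 , [])

  open Invariant 𝒲 (λ n G → Occurs (member G) (pattern-number n)) (λ n → borel-occurs (pattern-number n))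
    public using (bits; bits-cong; bits-reflect; borelMap)

  classification : ∀ G (G∈𝒲 : 𝒲 G) H (H∈𝒲 : 𝒲 H) →
    TopologicalIsomorphism G H ⇔
    MeasurableSpace._≈_ cantorSpace (BorelMap.to borelMap (G , G∈𝒲)) (BorelMap.to borelMap (H , H∈𝒲))
  classification G G∈𝒲 H H∈𝒲 = mk⇔
    (λ φ → bits-cong {G} {H} λ n → mk⇔
      (occurs-isomorphic φ (weak G G∈𝒲) (weak H H∈𝒲))
      (occurs-isomorphic (TopologicalIsomorphism-sym φ) (weak H H∈𝒲) (weak G G∈𝒲)))
    (λ e → occurs⇒isomorphic G H (proj₁ (𝒲⇒ G G∈𝒲)) (proj₁ (𝒲⇒ H H∈𝒲)) λ p o →
      subst (Occurs (member H)) (decode-code Pattern-code _ p)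
        (bits-reflect {G} {H} e (code Pattern-code p)
          (subst (Occurs (member G)) (sym (decode-code Pattern-code _ p)) o)))
    where
    weak : ∀ G → 𝒲 G → WeakElimination (member G)
    weak G G∈𝒲 = proj₂ (𝒲⇒ G G∈𝒲)

open import Level using (0ℓ; suc)

theorem1p1 : (∀ ℓ → ExcludedMiddle ℓ) →
    IsBorel effros 𝒲 ×
    (Σ[ Y ∈ MeasurableSpace 0ℓ 0ℓ (suc 0ℓ) ]
    IsStandardBorel Y ×
    (Σ[ f ∈ BorelMap (subspace effros 𝒲) Y ]
    (∀ G (G∈𝒲 : 𝒲 G) H (H∈𝒲 : 𝒲 H) →
    TopologicalIsomorphism G H ⇔
    MeasurableSpace._≈_ Y (BorelMap.to f (G , G∈𝒲)) (BorelMap.to f (H , H∈𝒲)))))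
theorem1p1 em = 𝒲-borel , cantorSpace , cantor-standard , borelMap , classification
  where open Classical em
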